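{- Let $G_0$ be a finite simple undirected graph on $n_0$ vertices and let $w_1,w_2,\ldots$ be distinct new vertices not in $V(G_0)$. Define $G_i=G_{i-1}\cup w_i$ if $i\ge1$ is odd and $G_i=G_{i-1}\vee w_i$ if $i\ge 1$ is even. Let $a:=|\det(A(G_0))|$, $b:=|\det(W(G_0))|$ and $p:=|\det(A(\overline{G}_1))|$. Suppose that $\{a,p\}=\{1,2\}$ and that $b\cdot 2^{ -\lfloor n_0/2\rfloor}$ is an odd square-free integer. Then for all $i\ge1$ the graph $G_i$ is determined by its generalized spectrum.
   Context: For a graph $H$, $A(H)$ denotes its adjacency matrix, $\overline{H}$ its complement, and $W(H)=[e,A(H)e,\ldots,A(H)^{m-1}e]$ its walk matrix ($m=|V(H)|$, $e$ the all-ones vector). $H\cup w$ adds a new isolated vertex $w$; $H\vee w$ adds a new vertex $w$ adjacent to all vertices of $H$. The spectrum of a graph is the multiset of eigenvalues of its adjacency matrix; its generalized spectrum is the pair $(\mathrm{spec}(H),\mathrm{spec}(\overline{H}))$. A graph $H$ is determined by its generalized spectrum if every graph $H'$ with $(\mathrm{spec}(H'),\mathrm{spec}(\overline{H'}))=(\mathrm{spec}(H),\mathrm{spec}(\overline{H}))$ is isomorphic to $H$. -}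

module Defs where

open import Data.Nat using (ℕ; zero; suc; _^_; _/_; _%_)
open import Data.Nat.Divisibility using (_∣_)
import Data.Nat as ℕ
open import Data.Integer using (ℤ; +_) renaming (_+_ to _+ℤ_; _*_ to _*ℤ_; -_ to -ℤ_)
open import Data.Fin using (Fin; zero; suc; punchIn; _≟_)
open import Data.Bool using (Bool; true; false; not; if_then_else_)
open import Data.Product using (Σ; _×_; _,_; ∃)
open import Data.Sum using (_⊎_)
open import Relation.Nullary using (yes; no; ¬_)
open import Relation.Binary.PropositionalEquality using (_≡_)
open import Function.Bundles using (_↔_; Inverse)

record Graph (n : ℕ) : Set where
  field
    adj    : Fin n → Fin n → Bool
    sym    : ∀ i j → adj i j ≡ adj j i
    irrefl : ∀ i → adj i i ≡ false
open Graph public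

unionV : ∀ {n} → Graph n → Graph (suc n)
unionV H = record { adj = a ; sym = s ; irrefl = r }
  where
  a : _ → _ → Bool
  a zero zero = false
  a zero (suc j) = false
  a (suc i) zero = false
  a (suc i) (suc j) = adj H i j
  s : ∀ i j → a i j ≡ a j i
  s zero zero = _≡_.refl
  s zero (suc j) = _≡_.refl
  s (suc i) zero = _≡_.refl
  s (suc i) (suc j) = sym H i j
  r : ∀ i → a i i ≡ false
  r zero = _≡_.refl
  r (suc i) = irrefl H i

joinV : ∀ {n} → Graph n → Graph (suc n)
joinV H = record { adj = a ; sym = s ; irrefl = r }
  where
  a : _ → _ → Bool
  a zero zero = false
  a zero (suc j) = true
  a (suc i) zero = true
  a (suc i) (suc j) = adj H i j
  s : ∀ i j → a i j ≡ a j i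
  s zero zero = _≡_.refl
  s zero (suc j) = _≡_.refl
  s (suc i) zero = _≡_.refl
  s (suc i) (suc j) = sym H i j
  r : ∀ i → a i i ≡ false
  r zero = _≡_.refl
  r (suc i) = irrefl H i

complement : ∀ {n} → Graph n → Graph n
complement {n} H = record { adj = a ; sym = s ; irrefl = r }
  where
  a : Fin n → Fin n → Bool
  a i j with i ≟ j
  ... | yes _ = false
  ... | no _ = not (adj H i j)
  s : ∀ i j → a i j ≡ a j i
  s i j with i ≟ j | j ≟ i
  ... | yes _ | yes _ = _≡_.refl
  ... | yes p | no q = Data.Empty.⊥-elim (q (Relation.Binary.PropositionalEquality.sym p))
    where import Data.Empty
  ... | no p | yes q = Data.Empty.⊥-elim (p (Relation.Binary.PropositionalEquality.sym q))
    where import Data.Empty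
  ... | no _ | no _ = Relation.Binary.PropositionalEquality.cong not (sym H i j)
  r : ∀ i → a i i ≡ false
  r i with i ≟ i
  ... | yes _ = _≡_.refl
  ... | no p = Data.Empty.⊥-elim (p _≡_.refl)
    where import Data.Empty

Iso : ∀ {n m} → Graph n → Graph m → Set
Iso {n} {m} H H' =
  Σ (Fin n ↔ Fin m) λ f → ∀ i j → adj H i j ≡ adj H' (Inverse.to f i) (Inverse.to f j)

record Ops (A : Set) : Set where
  field
    0# 1# : A
    _⊕_ _⊗_ : A → A → A
    ⊖_ : A → A

module Det {A : Set} (O : Ops A) where
  open Ops O
  det : ∀ {n} → (Fin n → Fin n → A) → A
  det {zero} M = 1#
  det {suc n} M = go n (λ j → M zero j) (λ j r c → M (suc r) (punchIn j c))
    where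
    go : ∀ k → (Fin (suc k) → A) → (Fin (suc k) → Fin n → Fin n → A) → A
    go zero row mn = row zero ⊗ det (mn zero)
    go (suc k) row mn =
      (row zero ⊗ det (mn zero)) ⊕ (⊖ go k (λ j → row (suc j)) (λ j → mn (suc j)))

ℤOps : Ops ℤ
ℤOps = record { 0# = + 0 ; 1# = + 1 ; _⊕_ = _+ℤ_ ; _⊗_ = _*ℤ_ ; ⊖_ = -ℤ_ }

detℤ : ∀ {n} → (Fin n → Fin n → ℤ) → ℤ
detℤ = Det.det ℤOps

-- Polynomials in ℤ[x] as coefficient sequences

Poly : Set
Poly = ℕ → ℤ

convSum : ℕ → (ℕ → ℕ → ℤ) → ℤ
convSum zero f = f 0 0
convSum (suc k) f = f 0 (suc k) +ℤ convSum k (λ i j → f (suc i) j)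

PolyOps : Ops Poly
PolyOps = record
  { 0# = λ _ → + 0
  ; 1# = λ { zero → + 1 ; (suc _) → + 0 }
  ; _⊕_ = λ p q k → p k +ℤ q k
  ; _⊗_ = λ p q k → convSum k (λ i j → p i *ℤ q j)
  ; ⊖_ = λ p k → -ℤ p k
  }

constP : ℤ → Poly
constP c zero = c
constP c (suc _) = + 0

X : Poly
X (suc zero) = + 1
X _ = + 0

b2z : Bool → ℤ
b2z true = + 1
b2z false = + 0

adjMat : ∀ {n} → Graph n → Fin n → Fin n → ℤ
adjMat H i j = b2z (adj H i j)

sumFin : ∀ {n} → (Fin n → ℤ) → ℤ
sumFin {zero} f = + 0
sumFin {suc n} f = f zero +ℤ sumFin (λ i → f (suc i))

walkVec : ∀ {n} → Graph n → ℕ → Fin n → ℤ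
walkVec H zero i = + 1
walkVec H (suc k) i = sumFin (λ j → adjMat H i j *ℤ walkVec H k j)

walkMat : ∀ {n} → Graph n → Fin n → Fin n → ℤ
walkMat H r c = walkVec H (Data.Fin.toℕ c) r

charPoly : ∀ {n} → Graph n → Poly
charPoly {n} H = Det.det PolyOps M
  where
  M : Fin n → Fin n → Poly
  M i j with i ≟ j
  ... | yes _ = λ k → X k +ℤ -ℤ constP (adjMat H i j) k
  ... | no _ = λ k → -ℤ constP (adjMat H i j) k

-- same spectrum (multiset of adjacency eigenvalues), i.e. equal
-- characteristic polynomials
Cospectral : ∀ {n m} → Graph n → Graph m → Set
Cospectral H H' = ∀ k → charPoly H k ≡ charPoly H' k

DGS : ∀ {n} → Graph n → Set
DGS {n} H = ∀ m (H' : Graph m) →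
  Cospectral H H' → Cospectral (complement H) (complement H') → Iso H H'

isOdd : ℕ → Bool
isOdd zero = false
isOdd (suc k) = not (isOdd k)

Gseq : ∀ {n₀} → Graph n₀ → (i : ℕ) → Graph (i ℕ.+ n₀)
Gseq G₀ zero = G₀
Gseq G₀ (suc i) with isOdd (suc i)
... | true = unionV (Gseq G₀ i)
... | false = joinV (Gseq G₀ i)

Odd : ℕ → Set
Odd c = c % 2 ≡ 1

SquareFree : ℕ → Set
SquareFree c = ∀ d → (d ℕ.* d) ∣ c → d ≡ 1

{-# OPTIONS --safe #-}

-- Up to complementation the G_i are the graphs K_0 = G_0, K_{i+1} = complement (K_i ∪ w), and a
-- graph is determined by its generalized spectrum if and only if its complement is. With walk
-- matrices W, |det W(K_{i+1})| = |det A(K_i)| |det W(K_i)| and |det A(K_{i+2})| = |det A(K_i)|.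
-- As adjacency determinants of odd order are even, the factor 2 enters exactly when ⌊n/2⌋ grows.
-- Hence every K_i meets Wang's criterion: 2^{-⌊n/2⌋} det W is odd and square-free.
--
-- To see that the criterion suffices, let H have the generalized spectrum of G. By Johnson and
-- Newman the walk counts e·A^k e agree, so that Q = W(H) W(G)⁻¹ is orthogonal, fixes e and
-- intertwines the adjacency matrices. Suppose that U = ℓ Q is integral and that a prime p divides ℓ.
-- Each row u of U satisfies p ∣ u·A^k e and p² ∣ u·A^k u for all k, and this forces p ∣ u:
-- * If p is odd, then p² ∤ det W makes the left kernel of W modulo p one-dimensional, so that u is
--   an eigenvector of A modulo p, with eigenvalue λ say, and u ≡ g(A) e with deg g ≤ n - 2. Now
--   (A - λ) g(A) e = p y with y orthogonal to u modulo p; if p ∤ u, replacing the last column of W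
--   by p y shows that p² divides det W.
-- * If p = 2, then u is a sum of walk vectors a_i A^i e over δ ≤ i < δ + ⌊n/2⌋, where δ is the
--   parity of n. Because the e·A^k e with k > 0 are even, 4 ∣ u·A^k u says that the sum of the
--   a_i² e·A^{2i+k} e is divisible by 4, and the Gram matrix of the walk vectors is invertible
--   modulo 2 up to its obvious factors 2. So all a_i are even.
-- Hence ℓ descends to 1 and Q is a permutation matrix.

module Submission where

open import Defs renaming (sym to adj-sym; irrefl to adj-irrefl)
open import Algebra.Bundles using (CommutativeRing)
open import Data.Empty using (⊥; ⊥-elim)
import Data.Fin as Fin
open import Data.Fin using (Fin; zero; suc; toℕ; punchIn; punchOut)
open import Data.Fin.Properties using (suc-injective; punchIn-punchOut; punchInᵢ≢i; punchIn-injective)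
open import Data.Integer using (ℤ; +_; -[1+_])
import Data.Integer as ℤ
import Data.Integer.Properties as ℤₚ
open import Data.Integer.Tactic.RingSolver using (solve-∀)
open import Data.Nat using (ℕ; zero; suc)
import Data.Nat as ℕ
import Data.Nat.Properties as ℕₚ
open import Data.Product using (Σ; _×_; _,_; proj₁; proj₂)
open import Data.Sum using (_⊎_; inj₁; inj₂)
open import Function using (_∘_)
open import Level using (0ℓ)
open import Relation.Binary.PropositionalEquality as ≡ using (_≡_; _≢_)
open import Relation.Binary.Structures using (IsEquivalence)
open import Relation.Nullary using (yes; no; ¬_)

-- All computations stay over the integers. The rational matrix Q is represented by an integral U =
-- ℓ Q together with its level ℓ. The first such U comes from an adjugate, with ℓ the square of det
-- W(G); the primes of ℓ are then divided out one at a time. The condition p² ∣ u·A^k u on the rows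
-- comes from U A^k Uᵀ = ℓ² B^k, where B is the adjacency matrix of H. No field with p elements is
-- formed either: k kernel vectors independent modulo p force p^k ∣ det, and cross multiplication
-- replaces division by a pivot. For the theorem of Johnson and Newman, det(xI - A + J) is up to
-- sign the characteristic polynomial of the complement at -x-1, and it equals det(xI - A) +
-- e·adj(xI - A)e. The coefficients of the last term, together with those of det(xI - A), yield all
-- walk counts by a recursion. The determinant of the statement is a bare first row expansion.
-- Products, transposes and Cramer's rule are derived from the uniqueness of alternating forms, over
-- any commutative ring, since both integer and polynomial matrices occur.

module Expansion {A : Set} (O : Ops A) where

  open Ops O
  open Det O

  Square : ℕ → Set
  Square n = Fin n → Fin n → A

  -- The local function go of Det.det cannot be named outside Defs. Here expand is a
  -- metavariable which the type of expand-spec forces to be go: once the with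
  -- abstraction has made its arguments distinct variables, this is a pattern unification.
  mutual
    expand : ∀ {N} → Square (suc N) → ∀ k → (Fin (suc k) → A) → (Fin (suc k) → Square N) → A
    expand = _

    expand-spec : ∀ n (M : Square (suc (suc (suc n)))) →
      det M ≡ ((M zero zero ⊗ det (λ r c → M (suc r) (punchIn zero c)))
               ⊕ (⊖ ((M zero (suc zero) ⊗ det (λ r c → M (suc r) (punchIn (suc zero) c)))
               ⊕ (⊖ expand M n (λ j → M zero (suc (suc j))) (λ j r c → M (suc r) (punchIn (suc (suc j)) c))))))
    expand-spec n M
      with ℕ.suc (ℕ.suc n)
         | M
         | (λ j → M zero (suc (suc j)))
         | (λ (j : Fin (suc n)) (r c : Fin (suc (suc n))) → M (suc r) (punchIn (suc (suc j)) c))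
         | (M zero zero ⊗ det (λ r c → M (suc r) (punchIn zero c)))
         | (M zero (suc zero) ⊗ det (λ r c → M (suc r) (punchIn (suc zero) c)))
    ... | N | M′ | row | minors | x | y = ≡.refl

module RingIdentities {c ℓ} (R : CommutativeRing c ℓ) where

  open CommutativeRing R
  open import Algebra.Solver.Ring.NaturalCoefficients.Default commutativeSemiring
  open import Algebra.Properties.Ring ring using (-‿distribˡ-*)

  lin-scaleˡ : ∀ s x a y b d → (s * (x * a + y * b)) * d ≈ x * ((s * a) * d) + y * ((s * b) * d)
  lin-scaleˡ = solve 6 (λ s x a y b d →
    (s :* (x :* a :+ y :* b)) :* d := x :* ((s :* a) :* d) :+ y :* ((s :* b) :* d)) refl

  lin-scaleʳ : ∀ s x a y b → s * (x * a + y * b) ≈ x * (s * a) + y * (s * b)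
  lin-scaleʳ = solve 5 (λ s x a y b → s :* (x :* a :+ y :* b) := x :* (s :* a) :+ y :* (s :* b)) refl

  lin-mulʳ : ∀ x a y b s → (x * a + y * b) * s ≈ x * (a * s) + y * (b * s)
  lin-mulʳ = solve 5 (λ x a y b s → (x :* a :+ y :* b) :* s := x :* (a :* s) :+ y :* (b :* s)) refl

  cofactor-shuffle : ∀ m d s f → m * (d * (s * f)) ≈ ((s * m) * d) * f
  cofactor-shuffle = solve 4 (λ m d s f → m :* (d :* (s :* f)) := ((s :* m) :* d) :* f) refl

  mul-left-comm : ∀ a x b → a * (x * b) ≈ x * (a * b)
  mul-left-comm = solve 3 (λ a x b → a :* (x :* b) := x :* (a :* b)) refl

  mul-left-assoc : ∀ v s d → v * (s * d) ≈ (s * v) * d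
  mul-left-assoc = solve 3 (λ v s d → v :* (s :* d) := (s :* v) :* d) refl

  horner-+ : ∀ a b y l m → (a + b) + y * (l + m) ≈ (a + y * l) + (b + y * m)
  horner-+ = solve 5 (λ a b y l m → (a :+ b) :+ y :* (l :+ m) := (a :+ y :* l) :+ (b :+ y :* m)) refl

  horner-*ˡ : ∀ x a y l → x * a + y * (x * l) ≈ x * (a + y * l)
  horner-*ˡ = solve 4 (λ x a y l → x :* a :+ y :* (x :* l) := x :* (a :+ y :* l)) refl

  horner-*ʳ : ∀ a m y l → a * m + y * (l * m) ≈ (a + y * l) * m
  horner-*ʳ = solve 4 (λ a m y l → a :* m :+ y :* (l :* m) := (a :+ y :* l) :* m) refl

  neg-mul₃ : ∀ s a b → - ((s * a) * b) ≈ ((- s) * a) * b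
  neg-mul₃ s a b = trans (-‿distribˡ-* (s * a) b) (*-congʳ (-‿distribˡ-* s a))

-- Determinants over a commutative ring

Adjacent : ∀ {n} → Fin n → Fin n → Set
Adjacent i j = toℕ j ≡ suc (toℕ i)

-- Lets alternation pass to minors: deleting a third column leaves two neighbouring columns next to
-- each other.
punchIn-adjacent : ∀ {n} (k i j : Fin (suc n)) → Adjacent i j → k ≢ i → k ≢ j →
  Σ (Fin n × Fin n) λ { (i′ , j′) → Adjacent i′ j′ × punchIn k i′ ≡ i × punchIn k j′ ≡ j }
punchIn-adjacent zero zero j adj k≢i k≢j = ⊥-elim (k≢i ≡.refl)
punchIn-adjacent zero (suc i) (suc j) adj k≢i k≢j =
  (i , j) , ℕₚ.suc-injective adj , ≡.refl , ≡.refl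
punchIn-adjacent {suc n} (suc zero) zero (suc zero) adj k≢i k≢j = ⊥-elim (k≢j ≡.refl)
punchIn-adjacent {suc (suc n)} (suc (suc k)) zero (suc zero) adj k≢i k≢j =
  (zero , suc zero) , ≡.refl , ≡.refl , ≡.refl
punchIn-adjacent {suc n} (suc k) (suc i) (suc j) adj k≢i k≢j
  with punchIn-adjacent k i j (ℕₚ.suc-injective adj) (k≢i ∘ ≡.cong suc) (k≢j ∘ ≡.cong suc)
... | (i′ , j′) , adj′ , p , q = (suc i′ , suc j′) , ≡.cong suc adj′ , ≡.cong suc p , ≡.cong suc q

-- Whichever of two neighbours is deleted, the survivor sits at the same place. Hence the minors
-- belonging to two equal neighbouring columns coincide.
punchIn-agree : ∀ {n} (i j : Fin (suc n)) → Adjacent i j → ∀ c →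
  (punchIn i c ≡ punchIn j c) ⊎ (punchIn i c ≡ j × punchIn j c ≡ i)
punchIn-agree {suc n} zero (suc zero) adj zero = inj₂ (≡.refl , ≡.refl)
punchIn-agree {suc n} zero (suc zero) adj (suc c) = inj₁ ≡.refl
punchIn-agree {suc n} (suc i) (suc j) adj zero = inj₁ ≡.refl
punchIn-agree {suc n} (suc i) (suc j) adj (suc c) with punchIn-agree i j (ℕₚ.suc-injective adj) c
... | inj₁ p = inj₁ (≡.cong suc p)
... | inj₂ (p , q) = inj₂ (≡.cong suc p , ≡.cong suc q)

module LinearAlgebra {ℓ} (R : CommutativeRing 0ℓ ℓ) where

  open CommutativeRing R hiding (zero)
  open import Data.Vec.Functional using (_∷_; insertAt)
  open RingIdentities R
  open import Algebra.Properties.Ring ring using (-‿distribˡ-*; -‿distribʳ-*; -1*x≈-x; -‿involutive; -0#≈0#)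
  open import Algebra.Properties.AbelianGroup +-abelianGroup using (⁻¹-∙-comm; inverseʳ-unique; x∙y⁻¹≈ε⇒x≈y)
  open import Algebra.Properties.Semiring.Sum semiring
    using (sum; sum-cong-≋; ∑-distrib-+; ∑-comm; *-distribˡ-sum; *-distribʳ-sum; sum-replicate-zero)
  open import Relation.Binary.Reasoning.Setoid setoid

  ops : Ops Carrier
  ops = record { 0# = 0# ; 1# = 1# ; _⊕_ = _+_ ; _⊗_ = _*_ ; ⊖_ = -_ }

  open Det ops public using (det)
  open Expansion ops using (expand)

  Vect : ℕ → Set
  Vect n = Fin n → Carrier

  Mat : ℕ → ℕ → Set
  Mat n m = Fin n → Vect m

  infix 4 _≋_
  _≋_ : ∀ {n m} → Mat n m → Mat n m → Set ℓ
  M ≋ N = ∀ i j → M i j ≈ N i j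

  _ᵀ : ∀ {n m} → Mat n m → Mat m n
  (M ᵀ) i j = M j i

  minor : ∀ {n m} → Fin (suc m) → Mat (suc n) (suc m) → Mat n m
  minor j M r c = M (suc r) (punchIn j c)

  sgn : ∀ {n} → Fin n → Carrier
  sgn zero = 1#
  sgn (suc j) = - sgn j

  sum-zero : ∀ {n} {t : Vect n} → (∀ i → t i ≈ 0#) → sum t ≈ 0#
  sum-zero {n} t≈0 = trans (sum-cong-≋ t≈0) (sum-replicate-zero n)

  sum-neg : ∀ {n} (t : Vect n) → - sum t ≈ sum (λ i → - t i)
  sum-neg {zero} t = -0#≈0#
  sum-neg {suc n} t = begin
    - (t zero + sum (t ∘ suc)) ≈⟨ sym (⁻¹-∙-comm _ _) ⟩
    - t zero + - sum (t ∘ suc) ≈⟨ +-congˡ (sum-neg (t ∘ suc)) ⟩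
    - t zero + sum (λ i → - t (suc i)) ∎

  sum-lin : ∀ {n} x y (s t : Vect n) → sum (λ i → x * s i + y * t i) ≈ x * sum s + y * sum t
  sum-lin x y s t = trans (∑-distrib-+ (λ i → x * s i) (λ i → y * t i))
    (sym (+-cong (*-distribˡ-sum x s) (*-distribˡ-sum y t)))

  sum-cancel : ∀ {n} (t : Vect n) {i j} → Adjacent i j →
    t i + t j ≈ 0# → (∀ k → k ≢ i → k ≢ j → t k ≈ 0#) → sum t ≈ 0#
  sum-cancel t {zero} {suc zero} adj pair rest = begin
    t zero + (t (suc zero) + sum (λ k → t (suc (suc k)))) ≈⟨ sym (+-assoc _ _ _) ⟩
    (t zero + t (suc zero)) + sum (λ k → t (suc (suc k))) ≈⟨ +-cong pair (sum-zero λ k → rest (suc (suc k)) (λ ()) (λ ())) ⟩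
    0# + 0# ≈⟨ +-identityˡ 0# ⟩
    0# ∎
  sum-cancel t {suc i} {suc j} adj pair rest = begin
    t zero + sum (t ∘ suc) ≈⟨ +-cong (rest zero (λ ()) (λ ()))
                                (sum-cancel (t ∘ suc) (ℕₚ.suc-injective adj) pair
                                  (λ k p q → rest (suc k) (p ∘ suc-injective) (q ∘ suc-injective))) ⟩
    0# + 0# ≈⟨ +-identityˡ 0# ⟩
    0# ∎

  expand-sum : ∀ {N} (M : Mat (suc N) (suc N)) k (row : Vect (suc k)) (minors : Fin (suc k) → Mat N N) →
    expand M k row minors ≈ sum (λ j → (sgn j * row j) * det (minors j))
  expand-sum M ℕ.zero row minors = begin
    row zero * det (minors zero) ≈⟨ *-congʳ (sym (*-identityˡ _)) ⟩
    (1# * row zero) * det (minors zero) ≈⟨ sym (+-identityʳ _) ⟩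
    (1# * row zero) * det (minors zero) + 0# ∎
  expand-sum M (suc k) row minors = begin
    row zero * det (minors zero) + - expand M k (row ∘ suc) (minors ∘ suc)
      ≈⟨ +-cong (*-congʳ (sym (*-identityˡ _))) (-‿cong (expand-sum M k (row ∘ suc) (minors ∘ suc))) ⟩
    (1# * row zero) * det (minors zero) + - sum t
      ≈⟨ +-congˡ (trans (sum-neg t) (sum-cong-≋ λ j → neg-mul₃ (sgn j) (row (suc j)) (det (minors (suc j))))) ⟩
    (1# * row zero) * det (minors zero) + sum (λ j → (- sgn j * row (suc j)) * det (minors (suc j))) ∎
    where
    t : Vect (suc k)
    t j = (sgn j * row (suc j)) * det (minors (suc j))

  laplace : ∀ {n} (M : Mat (suc n) (suc n)) →
    det M ≈ sum (λ j → (sgn j * M zero j) * det (minor j M))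
  laplace {n} M = expand-sum M n (M zero) (λ j → minor j M)

  det-cong : ∀ {n} {M N : Mat n n} → M ≋ N → det M ≈ det N
  det-cong {ℕ.zero} M≋N = refl
  det-cong {suc n} {M} {N} M≋N = begin
    det M ≈⟨ laplace M ⟩
    sum (λ j → (sgn j * M zero j) * det (minor j M)) ≈⟨ sum-cong-≋ (λ j → *-cong (*-congˡ {sgn j} (M≋N zero j))
                                                            (det-cong (λ r c → M≋N (suc r) (punchIn j c)))) ⟩
    sum (λ j → (sgn j * N zero j) * det (minor j N)) ≈⟨ sym (laplace N) ⟩
    det N ∎

  -- In the expansion, the term of column `k` is linear through its entry, as its minor omits that
  -- column; every other term is linear through its minor, by induction.
  det-column-linear : ∀ {n} k x y {M N P : Mat n n} →
    (∀ j → j ≢ k → ∀ i → P i j ≈ M i j) → (∀ j → j ≢ k → ∀ i → P i j ≈ N i j) →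
    (∀ i → P i k ≈ x * M i k + y * N i k) → det P ≈ x * det M + y * det N
  det-column-linear {suc n} k x y {M} {N} {P} PM PN Pk = begin
    det P ≈⟨ laplace P ⟩
    sum (λ j → (sgn j * P zero j) * det (minor j P)) ≈⟨ sum-cong-≋ term ⟩
    sum (λ j → x * ((sgn j * M zero j) * det (minor j M)) + y * ((sgn j * N zero j) * det (minor j N)))
      ≈⟨ sum-lin x y (λ j → (sgn j * M zero j) * det (minor j M)) (λ j → (sgn j * N zero j) * det (minor j N)) ⟩
    x * sum (λ j → (sgn j * M zero j) * det (minor j M)) + y * sum (λ j → (sgn j * N zero j) * det (minor j N))
      ≈⟨ sym (+-cong (*-congˡ (laplace M)) (*-congˡ (laplace N))) ⟩
    x * det M + y * det N ∎
    where
    term : ∀ j → (sgn j * P zero j) * det (minor j P) ≈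
                 x * ((sgn j * M zero j) * det (minor j M)) + y * ((sgn j * N zero j) * det (minor j N))
    term j with j Fin.≟ k
    ... | yes ≡.refl = begin
      (sgn j * P zero j) * det (minor j P) ≈⟨ *-congʳ (*-congˡ (Pk zero)) ⟩
      (sgn j * (x * M zero j + y * N zero j)) * det (minor j P) ≈⟨ lin-scaleˡ _ _ _ _ _ _ ⟩
      x * ((sgn j * M zero j) * det (minor j P)) + y * ((sgn j * N zero j) * det (minor j P))
        ≈⟨ +-cong (*-congˡ (*-congˡ (det-cong λ r c → PM _ (punchInᵢ≢i j c) (suc r))))
                  (*-congˡ (*-congˡ (det-cong λ r c → PN _ (punchInᵢ≢i j c) (suc r)))) ⟩
      x * ((sgn j * M zero j) * det (minor j M)) + y * ((sgn j * N zero j) * det (minor j N)) ∎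
    ... | no j≢k = begin
      (sgn j * P zero j) * det (minor j P) ≈⟨ *-congˡ ih ⟩
      (sgn j * P zero j) * (x * det (minor j M) + y * det (minor j N)) ≈⟨ lin-scaleʳ _ _ _ _ _ ⟩
      x * ((sgn j * P zero j) * det (minor j M)) + y * ((sgn j * P zero j) * det (minor j N))
        ≈⟨ +-cong (*-congˡ (*-congʳ (*-congˡ (PM j j≢k zero)))) (*-congˡ (*-congʳ (*-congˡ (PN j j≢k zero)))) ⟩
      x * ((sgn j * M zero j) * det (minor j M)) + y * ((sgn j * N zero j) * det (minor j N)) ∎
      where
      k′ : Fin n
      k′ = punchOut j≢k
      k′-spec : punchIn j k′ ≡ k
      k′-spec = punchIn-punchOut j≢k
      avoid : ∀ {c} → c ≢ k′ → punchIn j c ≢ k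
      avoid c≢k′ p = c≢k′ (punchIn-injective j _ _ (≡.trans p (≡.sym k′-spec)))
      ih : det (minor j P) ≈ x * det (minor j M) + y * det (minor j N)
      ih = det-column-linear k′ x y
        (λ c c≢ r → PM _ (avoid c≢) (suc r)) (λ c c≢ r → PN _ (avoid c≢) (suc r))
        (λ r → ≡.subst (λ z → P (suc r) z ≈ x * M (suc r) z + y * N (suc r) z) (≡.sym k′-spec) (Pk (suc r)))

  sgn-adjacent : ∀ {n} (i j : Fin n) → Adjacent i j → sgn j ≡ - sgn i
  sgn-adjacent zero (suc zero) adj = ≡.refl
  sgn-adjacent (suc i) (suc j) adj = ≡.cong -_ (sgn-adjacent i j (ℕₚ.suc-injective adj))

  -- The terms at `i` and `j` have equal minors and opposite signs; every other minor still contains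
  -- both columns and vanishes by induction.
  det-column-alternating : ∀ {n} (i j : Fin n) → Adjacent i j → {M : Mat n n} →
    (∀ r → M r i ≈ M r j) → det M ≈ 0#
  det-column-alternating {suc n} i j adj {M} M-ij =
    trans (laplace M) (sum-cancel t adj pair rest)
    where
    t : Vect (suc n)
    t k = (sgn k * M zero k) * det (minor k M)
    minors-agree : minor i M ≋ minor j M
    minors-agree r c with punchIn-agree i j adj c
    ... | inj₁ p = reflexive (≡.cong (M (suc r)) p)
    ... | inj₂ (p , q) = begin
      M (suc r) (punchIn i c) ≡⟨ ≡.cong (M (suc r)) p ⟩
      M (suc r) j ≈⟨ sym (M-ij (suc r)) ⟩
      M (suc r) i ≡⟨ ≡.cong (M (suc r)) (≡.sym q) ⟩
      M (suc r) (punchIn j c) ∎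
    pair : t i + t j ≈ 0#
    pair = begin
      t i + t j ≈⟨ +-congˡ (*-cong (*-cong (reflexive (sgn-adjacent i j adj)) (sym (M-ij zero)))
                                   (det-cong λ r c → sym (minors-agree r c))) ⟩
      t i + (- sgn i * M zero i) * det (minor i M) ≈⟨ +-congˡ (sym (neg-mul₃ _ _ _)) ⟩
      t i + - t i ≈⟨ -‿inverseʳ (t i) ⟩
      0# ∎
    rest : ∀ k → k ≢ i → k ≢ j → t k ≈ 0#
    rest k k≢i k≢j with punchIn-adjacent k i j adj k≢i k≢j
    ... | (i′ , j′) , adj′ , p , q = begin
      (sgn k * M zero k) * det (minor k M) ≈⟨ *-congˡ (det-column-alternating i′ j′ adj′ equal) ⟩
      (sgn k * M zero k) * 0# ≈⟨ zeroʳ _ ⟩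
      0# ∎
      where
      equal : ∀ r → minor k M r i′ ≈ minor k M r j′
      equal r = begin
        M (suc r) (punchIn k i′) ≡⟨ ≡.cong (M (suc r)) p ⟩
        M (suc r) i ≈⟨ M-ij (suc r) ⟩
        M (suc r) j ≡⟨ ≡.cong (M (suc r)) (≡.sym q) ⟩
        M (suc r) (punchIn k j′) ∎

  -- The number of rows and their length are independent, so that fixing the first row and forcing a
  -- coordinate to zero give alternating forms again; `form-unique` recurses through both.
  record AlternatingForm (n m : ℕ) : Set ℓ where
    field
      form : Mat n m → Carrier
      form-cong : ∀ {M N} → M ≋ N → form M ≈ form N
      form-linear : ∀ k x y {M N P} →
        (∀ i → i ≢ k → ∀ j → P i j ≈ M i j) → (∀ i → i ≢ k → ∀ j → P i j ≈ N i j) →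
        (∀ j → P k j ≈ x * M k j + y * N k j) → form P ≈ x * form M + y * form N
      form-alternating : ∀ i j → Adjacent i j → ∀ {M} → (∀ c → M i c ≈ M j c) → form M ≈ 0#

  open AlternatingForm

  ∷-≋ : ∀ {n m} {u v : Vect m} {M N : Mat n m} → (∀ j → u j ≈ v j) → M ≋ N → (u ∷ M) ≋ (v ∷ N)
  ∷-≋ u≈v M≋N zero = u≈v
  ∷-≋ u≈v M≋N (suc i) = M≋N i

  ∷-head-tail : ∀ {n m} (M : Mat (suc n) m) → M ≋ (M zero ∷ M ∘ suc)
  ∷-head-tail M zero j = refl
  ∷-head-tail M (suc i) j = refl

  fixFirst : ∀ {n m} → Vect m → AlternatingForm (suc n) m → AlternatingForm n m
  fixFirst v D .form N = form D (v ∷ N)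
  fixFirst v D .form-cong M≋N = form-cong D (∷-≋ (λ _ → refl) M≋N)
  fixFirst v D .form-linear k x y PM PN Pk = form-linear D (suc k) x y
    (λ { zero _ j → refl ; (suc i) p → PM i (p ∘ ≡.cong suc) })
    (λ { zero _ j → refl ; (suc i) p → PN i (p ∘ ≡.cong suc) }) Pk
  fixFirst v D .form-alternating i j adj M-ij = form-alternating D (suc i) (suc j) (≡.cong suc adj) M-ij

  first-linear : ∀ {n m} (D : AlternatingForm (suc n) m) x y (u v : Vect m) (N : Mat n m) →
    form D ((λ j → x * u j + y * v j) ∷ N) ≈ x * form D (u ∷ N) + y * form D (v ∷ N)
  first-linear D x y u v N = form-linear D zero x y
    (λ { zero p → ⊥-elim (p ≡.refl) ; (suc i) _ j → refl })
    (λ { zero p → ⊥-elim (p ≡.refl) ; (suc i) _ j → refl }) (λ j → refl)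

  first-add : ∀ {n m} (D : AlternatingForm (suc n) m) y (u v : Vect m) (N : Mat n m) →
    form D ((λ j → u j + y * v j) ∷ N) ≈ form D (u ∷ N) + y * form D (v ∷ N)
  first-add D y u v N = begin
    form D ((λ j → u j + y * v j) ∷ N) ≈⟨ form-cong D (∷-≋ (λ j → +-congʳ (sym (*-identityˡ (u j)))) (λ _ _ → refl)) ⟩
    form D ((λ j → 1# * u j + y * v j) ∷ N) ≈⟨ first-linear D 1# y u v N ⟩
    1# * form D (u ∷ N) + y * form D (v ∷ N) ≈⟨ +-congʳ (*-identityˡ _) ⟩
    form D (u ∷ N) + y * form D (v ∷ N) ∎

  first-zero : ∀ {n m} (D : AlternatingForm (suc n) m) (N : Mat n m) → form D ((λ _ → 0#) ∷ N) ≈ 0#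
  first-zero D N = begin
    form D ((λ _ → 0#) ∷ N) ≈⟨ form-cong D (∷-≋ (λ _ → sym (trans (+-cong (zeroˡ 0#) (zeroˡ 0#)) (+-identityˡ 0#))) (λ _ _ → refl)) ⟩
    form D ((λ _ → 0# * 0# + 0# * 0#) ∷ N) ≈⟨ first-linear D 0# 0# (λ _ → 0#) (λ _ → 0#) N ⟩
    0# * form D ((λ _ → 0#) ∷ N) + 0# * form D ((λ _ → 0#) ∷ N) ≈⟨ trans (+-cong (zeroˡ _) (zeroˡ _)) (+-identityˡ 0#) ⟩
    0# ∎

  first-sum : ∀ {n m k} (D : AlternatingForm (suc n) m) (x : Vect k) (v : Mat k m) (N : Mat n m) →
    form D ((λ j → sum (λ i → x i * v i j)) ∷ N) ≈ sum (λ i → x i * form D (v i ∷ N))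
  first-sum {k = ℕ.zero} D x v N = first-zero D N
  first-sum {k = suc k} D x v N = begin
    form D ((λ j → x zero * v zero j + rest j) ∷ N) ≈⟨ form-cong D (∷-≋ (λ j → +-comm _ _) (λ _ _ → refl)) ⟩
    form D ((λ j → rest j + x zero * v zero j) ∷ N) ≈⟨ first-add D (x zero) rest (v zero) N ⟩
    form D (rest ∷ N) + x zero * form D (v zero ∷ N) ≈⟨ +-comm _ _ ⟩
    x zero * form D (v zero ∷ N) + form D (rest ∷ N) ≈⟨ +-congˡ (first-sum D (x ∘ suc) (v ∘ suc) N) ⟩
    x zero * form D (v zero ∷ N) + sum (λ i → x (suc i) * form D (v (suc i) ∷ N)) ∎
    where
    rest : Vect _
    rest j = sum (λ i → x (suc i) * v (suc i) j)

  -- Polarisation: the form vanishes with `v + u` in both places, and two of the four terms of its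
  -- expansion vanish as well.
  swap-first : ∀ {n m} (D : AlternatingForm (suc (suc n)) m) (u v : Vect m) (N : Mat n m) →
    form D (u ∷ v ∷ N) ≈ - form D (v ∷ u ∷ N)
  swap-first D u v N = inverseʳ-unique _ _ (begin
    form D (v ∷ u ∷ N) + form D (u ∷ v ∷ N)
      ≈⟨ sym (+-cong (trans (+-cong (equal v) (*-identityˡ _)) (+-identityˡ _)) (trans (+-congˡ (trans (*-identityˡ _) (equal u))) (+-identityʳ _))) ⟩
    (form D (v ∷ v ∷ N) + 1# * form D (v ∷ u ∷ N)) + (form D (u ∷ v ∷ N) + 1# * form D (u ∷ u ∷ N))
      ≈⟨ sym (+-cong (first-add (fixFirst v D) 1# v u N) (trans (*-identityˡ _) (first-add (fixFirst u D) 1# v u N))) ⟩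
    form D (v ∷ w ∷ N) + 1# * form D (u ∷ w ∷ N)
      ≈⟨ sym (first-add D 1# v u (w ∷ N)) ⟩
    form D (w ∷ w ∷ N) ≈⟨ equal w ⟩
    0# ∎)
    where
    w : Vect _
    w j = v j + 1# * u j
    equal : ∀ a → form D (a ∷ a ∷ N) ≈ 0#
    equal a = form-alternating D zero (suc zero) ≡.refl (λ c → refl)

  repeated-first : ∀ {n m} (D : AlternatingForm (suc n) m) (v : Vect m) (N : Mat n m) k →
    (∀ j → N k j ≈ v j) → form D (v ∷ N) ≈ 0#
  repeated-first D v N zero Nk≈v = form-alternating D zero (suc zero) ≡.refl (λ c → sym (Nk≈v c))
  repeated-first D v N (suc k) Nk≈v = begin
    form D (v ∷ N) ≈⟨ form-cong D (∷-≋ (λ _ → refl) (∷-head-tail N)) ⟩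
    form D (v ∷ N zero ∷ N ∘ suc) ≈⟨ swap-first D v (N zero) (N ∘ suc) ⟩
    - form D (N zero ∷ v ∷ N ∘ suc) ≈⟨ -‿cong (repeated-first (fixFirst (N zero) D) v (N ∘ suc) k Nk≈v) ⟩
    - 0# ≈⟨ -0#≈0# ⟩
    0# ∎

  -- The rows are cleaned one after the other; each time, linearity splits off a term that has `v`
  -- itself as a row.
  absorb : ∀ {n m} (D : AlternatingForm n m) (v : Vect m) →
    (∀ N k → (∀ j → N k j ≈ v j) → form D N ≈ 0#) →
    ∀ (x : Vect n) (N : Mat n m) → form D (λ i j → N i j + x i * v j) ≈ form D N
  absorb {ℕ.zero} D v vanish x N = form-cong D (λ ())
  absorb {suc n} D v vanish x N = begin
    form D N′ ≈⟨ form-cong D (∷-head-tail N′) ⟩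
    form D (N′ zero ∷ N′ ∘ suc) ≈⟨ first-add D (x zero) (N zero) v (N′ ∘ suc) ⟩
    form D (N zero ∷ N′ ∘ suc) + x zero * form D (v ∷ N′ ∘ suc) ≈⟨ +-congˡ (trans (*-congˡ (vanish _ zero (λ j → refl))) (zeroʳ _)) ⟩
    form D (N zero ∷ N′ ∘ suc) + 0# ≈⟨ +-identityʳ _ ⟩
    form D (N zero ∷ N′ ∘ suc)
      ≈⟨ absorb (fixFirst (N zero) D) v (λ M k → vanish (N zero ∷ M) (suc k)) (x ∘ suc) (N ∘ suc) ⟩
    form D (N zero ∷ N ∘ suc) ≈⟨ sym (form-cong D (∷-head-tail N)) ⟩
    form D N ∎
    where
    N′ : Mat _ _
    N′ i j = N i j + x i * v j

  move-first : ∀ {n m} (D : AlternatingForm (suc n) m) (v : Mat (suc n) m) j →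
    form D (v j ∷ v ∘ punchIn j) ≈ sgn j * form D v
  move-first D v zero = begin
    form D (v zero ∷ v ∘ suc) ≈⟨ sym (form-cong D (∷-head-tail v)) ⟩
    form D v ≈⟨ sym (*-identityˡ _) ⟩
    1# * form D v ∎
  move-first {suc n} D v (suc j) = begin
    form D (v (suc j) ∷ v ∘ punchIn (suc j)) ≈⟨ form-cong D (∷-≋ (λ _ → refl) (∷-head-tail _)) ⟩
    form D (v (suc j) ∷ v zero ∷ v ∘ suc ∘ punchIn j) ≈⟨ swap-first D _ _ _ ⟩
    - form D (v zero ∷ v (suc j) ∷ v ∘ suc ∘ punchIn j) ≈⟨ -‿cong (move-first (fixFirst (v zero) D) (v ∘ suc) j) ⟩
    - (sgn j * form D (v zero ∷ v ∘ suc)) ≈⟨ -‿cong (*-congˡ (sym (form-cong D (∷-head-tail v)))) ⟩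
    - (sgn j * form D v) ≈⟨ -‿distribˡ-* _ _ ⟩
    - sgn j * form D v ∎

  I : ∀ {n} → Mat n n
  I zero zero = 1#
  I zero (suc j) = 0#
  I (suc i) zero = 0#
  I (suc i) (suc j) = I i j

  sum-I : ∀ {n} (x : Vect n) j → sum (λ i → x i * I i j) ≈ x j
  sum-I x zero = begin
    x zero * 1# + sum (λ i → x (suc i) * 0#) ≈⟨ +-cong (*-identityʳ _) (sum-zero (λ i → zeroʳ (x (suc i)))) ⟩
    x zero + 0# ≈⟨ +-identityʳ _ ⟩
    x zero ∎
  sum-I x (suc j) = begin
    x zero * 0# + sum (λ i → x (suc i) * I i j) ≈⟨ +-cong (zeroʳ _) (sum-I (x ∘ suc) j) ⟩
    0# + x (suc j) ≈⟨ +-identityˡ _ ⟩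
    x (suc j) ∎

  insert-zero : ∀ {n} {x : Vect n} j → (∀ i → x i ≈ 0#) → ∀ c → insertAt x j 0# c ≈ 0#
  insert-zero zero x≈0 zero = refl
  insert-zero zero x≈0 (suc c) = x≈0 c
  insert-zero {suc n} (suc j) x≈0 zero = x≈0 zero
  insert-zero {suc n} (suc j) x≈0 (suc c) = insert-zero j (x≈0 ∘ suc) c

  insert-I : ∀ {n} (j : Fin (suc n)) r c → insertAt (I r) j 0# c ≈ I (punchIn j r) c
  insert-I zero r zero = refl
  insert-I zero r (suc c) = refl
  insert-I (suc j) zero zero = refl
  insert-I (suc j) zero (suc c) = insert-zero j (λ i → refl) c
  insert-I (suc j) (suc r) zero = refl
  insert-I (suc j) (suc r) (suc c) = insert-I j r c

  insert-split : ∀ {n} (x : Vect (suc n)) j c → insertAt (x ∘ punchIn j) j 0# c + x j * I j c ≈ x c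
  insert-split x zero zero = trans (+-identityˡ _) (*-identityʳ _)
  insert-split x zero (suc c) = trans (+-congˡ (zeroʳ _)) (+-identityʳ _)
  insert-split {suc n} x (suc j) zero = trans (+-congˡ (zeroʳ _)) (+-identityʳ _)
  insert-split {suc n} x (suc j) (suc c) = insert-split (x ∘ suc) j c

  insert-lin : ∀ {n} {p u v : Vect n} x y j → (∀ i → p i ≈ x * u i + y * v i) →
    ∀ c → insertAt p j 0# c ≈ x * insertAt u j 0# c + y * insertAt v j 0# c
  insert-lin x y zero eq zero = sym (trans (+-cong (zeroʳ x) (zeroʳ y)) (+-identityˡ 0#))
  insert-lin x y zero eq (suc c) = eq c
  insert-lin {suc n} x y (suc j) eq zero = eq zero
  insert-lin {suc n} x y (suc j) eq (suc c) = insert-lin x y j (eq ∘ suc) c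

  insert-cong : ∀ {n} {u v : Vect n} j → (∀ i → u i ≈ v i) → ∀ c → insertAt u j 0# c ≈ insertAt v j 0# c
  insert-cong zero eq zero = refl
  insert-cong zero eq (suc c) = eq c
  insert-cong {suc n} (suc j) eq zero = eq zero
  insert-cong {suc n} (suc j) eq (suc c) = insert-cong j (eq ∘ suc) c

  restrict : ∀ {n m} → Fin (suc m) → AlternatingForm n (suc m) → AlternatingForm n m
  restrict j D .form N = form D (λ r → insertAt (N r) j 0#)
  restrict j D .form-cong M≋N = form-cong D (λ r → insert-cong j (M≋N r))
  restrict j D .form-linear k x y PM PN Pk = form-linear D k x y
    (λ i p → insert-cong j (PM i p)) (λ i p → insert-cong j (PN i p)) (insert-lin x y j Pk)
  restrict j D .form-alternating i i′ adj M-ii′ = form-alternating D i i′ adj (insert-cong j M-ii′)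

  -- Expand the first row in unit vectors. Below the row `I j` the coordinate `j` can be cleared,
  -- which leaves an alternating form in one dimension less; by induction its value is the minor
  -- times a value at the identity, up to the sign of moving row `j` into place. Transposition and
  -- multiplicativity follow by choosing the form.
  form-unique : ∀ {n} (D : AlternatingForm n n) M → form D M ≈ det M * form D I
  form-unique {ℕ.zero} D M = trans (form-cong D (λ ())) (sym (*-identityˡ _))
  form-unique {suc n} D M = begin
    form D M ≈⟨ form-cong D (∷-head-tail M) ⟩
    form D (M zero ∷ M ∘ suc) ≈⟨ form-cong D (∷-≋ (λ j → sym (sum-I (M zero) j)) (λ _ _ → refl)) ⟩
    form D ((λ j → sum (λ i → M zero i * I i j)) ∷ M ∘ suc) ≈⟨ first-sum D (M zero) I (M ∘ suc) ⟩
    sum (λ j → M zero j * form D (I j ∷ M ∘ suc)) ≈⟨ sum-cong-≋ term ⟩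
    sum (λ j → ((sgn j * M zero j) * det (minor j M)) * form D I)
      ≈⟨ sym (*-distribʳ-sum (form D I) (λ j → (sgn j * M zero j) * det (minor j M))) ⟩
    sum (λ j → (sgn j * M zero j) * det (minor j M)) * form D I ≈⟨ *-congʳ (sym (laplace M)) ⟩
    det M * form D I ∎
    where
    cofactor : ∀ j → form D (I j ∷ M ∘ suc) ≈ det (minor j M) * (sgn j * form D I)
    cofactor j = begin
      form D (I j ∷ M ∘ suc)
        ≈⟨ form-cong D (∷-≋ (λ _ → refl) (λ r c → sym (insert-split (M (suc r)) j c))) ⟩
      form D (I j ∷ (λ r c → insertAt (minor j M r) j 0# c + M (suc r) j * I j c))
        ≈⟨ absorb (fixFirst (I j) D) (I j) (repeated-first D (I j)) (λ r → M (suc r) j) (λ r → insertAt (minor j M r) j 0#) ⟩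
      form D (I j ∷ (λ r → insertAt (minor j M r) j 0#))
        ≈⟨ form-unique (restrict j (fixFirst (I j) D)) (minor j M) ⟩
      det (minor j M) * form D (I j ∷ (λ r → insertAt (I r) j 0#))
        ≈⟨ *-congˡ (form-cong D (∷-≋ (λ _ → refl) (insert-I j))) ⟩
      det (minor j M) * form D (I j ∷ I ∘ punchIn j)
        ≈⟨ *-congˡ (move-first D I j) ⟩
      det (minor j M) * (sgn j * form D I) ∎
    term : ∀ j → M zero j * form D (I j ∷ M ∘ suc) ≈ ((sgn j * M zero j) * det (minor j M)) * form D I
    term j = trans (*-congˡ (cofactor j)) (cofactor-shuffle _ _ _ _)

  det-first-row : ∀ {n} (M : Mat (suc n) (suc n)) → (∀ j → M zero (suc j) ≈ 0#) →
    det M ≈ M zero zero * det (minor zero M)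
  det-first-row M row0 = begin
    det M ≈⟨ laplace M ⟩
    (1# * M zero zero) * det (minor zero M) + sum (λ j → (- sgn j * M zero (suc j)) * det (minor (suc j) M))
      ≈⟨ +-cong (*-congʳ (*-identityˡ _)) (sum-zero λ j → trans (*-congʳ (trans (*-congˡ (row0 j)) (zeroʳ (- sgn j)))) (zeroˡ (det (minor (suc j) M)))) ⟩
    M zero zero * det (minor zero M) + 0# ≈⟨ +-identityʳ _ ⟩
    M zero zero * det (minor zero M) ∎

  product : ∀ {n} → Vect n → Carrier
  product {ℕ.zero} x = 1#
  product {suc n} x = x zero * product (x ∘ suc)

  det-lower-triangular : ∀ {n} (M : Mat n n) → (∀ i j → toℕ i ℕ.< toℕ j → M i j ≈ 0#) →
    det M ≈ product (λ i → M i i)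
  det-lower-triangular {ℕ.zero} M lower = refl
  det-lower-triangular {suc n} M lower = trans
    (det-first-row M (λ j → lower zero (suc j) (ℕ.s≤s ℕ.z≤n)))
    (*-congˡ (det-lower-triangular (minor zero M) (λ i j i<j → lower (suc i) (suc j) (ℕ.s≤s i<j))))

  I-symmetric : ∀ {n} (i j : Fin n) → I i j ≡ I j i
  I-symmetric zero zero = ≡.refl
  I-symmetric zero (suc j) = ≡.refl
  I-symmetric (suc i) zero = ≡.refl
  I-symmetric (suc i) (suc j) = I-symmetric i j

  det-I : ∀ {n} → det (I {n}) ≈ 1#
  det-I {ℕ.zero} = refl
  det-I {suc n} = trans (det-first-row (I {suc n}) (λ j → refl)) (trans (*-identityˡ _) (det-I {n}))

  -- A first row expansion gives direct access to the columns only; this form carries linearity and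
  -- alternation over to the rows.
  transposeForm : ∀ {n} → AlternatingForm n n
  transposeForm .form M = det (M ᵀ)
  transposeForm .form-cong M≋N = det-cong (λ i j → M≋N j i)
  transposeForm .form-linear k x y PM PN Pk = det-column-linear k x y PM PN Pk
  transposeForm .form-alternating i j adj M-ij = det-column-alternating i j adj M-ij

  det-transpose : ∀ {n} (M : Mat n n) → det (M ᵀ) ≈ det M
  det-transpose {n} M = begin
    det (M ᵀ) ≈⟨ form-unique transposeForm M ⟩
    det M * det (I {n} ᵀ) ≈⟨ *-congˡ (trans (det-cong {n} (λ i j → reflexive (I-symmetric j i))) (det-I {n})) ⟩
    det M * 1# ≈⟨ *-identityʳ _ ⟩
    det M ∎

  detForm : ∀ {n} → AlternatingForm n n
  detForm .form = det
  detForm .form-cong = det-cong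
  detForm .form-linear k x y {M} {N} {P} PM PN Pk = begin
    det P ≈⟨ sym (det-transpose P) ⟩
    det (P ᵀ) ≈⟨ det-column-linear k x y PM PN Pk ⟩
    x * det (M ᵀ) + y * det (N ᵀ) ≈⟨ +-cong (*-congˡ (det-transpose M)) (*-congˡ (det-transpose N)) ⟩
    x * det M + y * det N ∎
  detForm .form-alternating i j adj {M} M-ij = trans (sym (det-transpose M)) (det-column-alternating i j adj M-ij)

  -- Products, Cramer's rule and rank one updates

  infixl 7 _·_
  _·_ : ∀ {n m k} → Mat n m → Mat m k → Mat n k
  (M · N) i j = sum (λ k → M i k * N k j)

  productForm : ∀ {n} → Mat n n → AlternatingForm n n
  productForm N .form M = det (M · N)
  productForm N .form-cong M≋M′ = det-cong (λ i j → sum-cong-≋ (λ k → *-congʳ (M≋M′ i k)))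
  productForm N .form-linear k x y {M} {M′} {P} PM PN Pk = form-linear detForm k x y
    (λ i p j → sum-cong-≋ (λ l → *-congʳ (PM i p l))) (λ i p j → sum-cong-≋ (λ l → *-congʳ (PN i p l)))
    (λ j → trans (sum-cong-≋ (λ l → trans (*-congʳ (Pk l)) (lin-mulʳ x (M k l) y (M′ k l) (N l j))))
                 (sum-lin x y (λ l → M k l * N l j) (λ l → M′ k l * N l j)))
  productForm N .form-alternating i j adj M-ij =
    form-alternating detForm i j adj (λ c → sum-cong-≋ (λ l → *-congʳ (M-ij l)))

  I·_ : ∀ {n m} (M : Mat n m) → I · M ≋ M
  (I· M) i j = begin
    sum (λ k → I i k * M k j) ≈⟨ sum-cong-≋ (λ k → trans (*-comm _ _) (*-congˡ (reflexive (I-symmetric i k)))) ⟩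
    sum (λ k → M k j * I k i) ≈⟨ sum-I (λ k → M k j) i ⟩
    M i j ∎

  det-· : ∀ {n} (M N : Mat n n) → det (M · N) ≈ det M * det N
  det-· M N = trans (form-unique (productForm N) M) (*-congˡ (det-cong (I· N)))

  ·-cong : ∀ {n m k} {M M′ : Mat n m} {N N′ : Mat m k} → M ≋ M′ → N ≋ N′ → M · N ≋ M′ · N′
  ·-cong M≋M′ N≋N′ i j = sum-cong-≋ (λ k → *-cong (M≋M′ i k) (N≋N′ k j))

  ·-assoc : ∀ {n m k l} (M : Mat n m) (N : Mat m k) (P : Mat k l) → (M · N) · P ≋ M · (N · P)
  ·-assoc M N P i j = begin
    sum (λ b → sum (λ a → M i a * N a b) * P b j) ≈⟨ sum-cong-≋ (λ b → *-distribʳ-sum (P b j) (λ a → M i a * N a b)) ⟩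
    sum (λ b → sum (λ a → (M i a * N a b) * P b j)) ≈⟨ ∑-comm (λ b a → (M i a * N a b) * P b j) ⟩
    sum (λ a → sum (λ b → (M i a * N a b) * P b j)) ≈⟨ sum-cong-≋ (λ a → sum-cong-≋ (λ b → *-assoc (M i a) (N a b) (P b j))) ⟩
    sum (λ a → sum (λ b → M i a * (N a b * P b j))) ≈⟨ sum-cong-≋ (λ a → sym (*-distribˡ-sum (M i a) (λ b → N a b * P b j))) ⟩
    sum (λ a → M i a * sum (λ b → N a b * P b j)) ∎

  ·-ᵀ : ∀ {n m k} (M : Mat n m) (N : Mat m k) → (M · N) ᵀ ≋ (N ᵀ) · (M ᵀ)
  ·-ᵀ M N i j = sum-cong-≋ (λ k → *-comm (M j k) (N k i))

  infixr 7 _*ₘ_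
  _*ₘ_ : ∀ {n m} → Carrier → Mat n m → Mat n m
  (x *ₘ M) i j = x * M i j

  ·-*ₘ : ∀ {n m k} x (M : Mat n m) (N : Mat m k) → M · (x *ₘ N) ≋ x *ₘ (M · N)
  ·-*ₘ x M N i j = trans (sum-cong-≋ (λ k → mul-left-comm (M i k) x (N k j))) (sym (*-distribˡ-sum x (λ k → M i k * N k j)))

  *ₘ-· : ∀ {n m k} x (M : Mat n m) (N : Mat m k) → (x *ₘ M) · N ≋ x *ₘ (M · N)
  *ₘ-· x M N i j = trans (sum-cong-≋ (λ k → *-assoc x (M i k) (N k j))) (sym (*-distribˡ-sum x (λ k → M i k * N k j)))

  _·I : ∀ {n m} (M : Mat n m) → M · I ≋ M
  (M ·I) i j = sum-I (M i) j

  bordered : ∀ {n m} → Carrier → Vect m → Vect n → Mat n m → Mat (suc n) (suc m)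
  bordered x v b M = (x ∷ v) ∷ (λ i → b i ∷ M i)

  -- Cramer's rule, in the form which the first row expansion of a bordered determinant yields.
  cramer : ∀ {n} → Mat n n → Vect n → Vect n
  cramer M b j = sgn j * det (λ r c → (b r ∷ M r) (punchIn (suc j) c))

  det-bordered : ∀ {n} x (v b : Vect n) (M : Mat n n) →
    det (bordered x v b M) ≈ x * det M + - sum (λ j → v j * cramer M b j)
  det-bordered x v b M = begin
    det (bordered x v b M) ≈⟨ laplace (bordered x v b M) ⟩
    (1# * x) * det M + sum (λ j → (- sgn j * v j) * d j)
      ≈⟨ +-cong (*-congʳ (*-identityˡ x)) (trans (sum-cong-≋ (λ j → sym (trans (-‿cong (mul-left-assoc (v j) (sgn j) (d j))) (neg-mul₃ (sgn j) (v j) (d j)))))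
                                                 (sym (sum-neg (λ j → v j * cramer M b j)))) ⟩
    x * det M + - sum (λ j → v j * cramer M b j) ∎
    where
    d : Vect _
    d j = det (λ r c → (b r ∷ M r) (punchIn (suc j) c))

  -- Bordering by a copy of row `i`, `b i` included, repeats a row; the vanishing of this bordered
  -- determinant is the equation.
  cramer-solves : ∀ {n} (M : Mat n n) (b : Vect n) i → sum (λ j → M i j * cramer M b j) ≈ det M * b i
  cramer-solves M b i = sym (trans (*-comm _ _) (x∙y⁻¹≈ε⇒x≈y _ _ (trans
    (sym (det-bordered (b i) (M i) b M))
    (repeated-first detForm (b i ∷ M i) (λ r → b r ∷ M r) i (λ j → refl)))))

  adjugate : ∀ {n} → Mat n n → Mat n n
  adjugate M i k = cramer M (λ r → I r k) i

  ·-adjugate : ∀ {n} (M : Mat n n) → M · adjugate M ≋ det M *ₘ I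
  ·-adjugate M i k = cramer-solves M (λ r → I r k) i

  leftAdjugate : ∀ {n} → Mat n n → Mat n n
  leftAdjugate M = adjugate (M ᵀ) ᵀ

  leftAdjugate-· : ∀ {n} (M : Mat n n) → leftAdjugate M · M ≋ det M *ₘ I
  leftAdjugate-· M i j = begin
    sum (λ k → adjugate (M ᵀ) k i * M k j) ≈⟨ sum-cong-≋ (λ k → *-comm (adjugate (M ᵀ) k i) (M k j)) ⟩
    ((M ᵀ) · adjugate (M ᵀ)) j i ≈⟨ ·-adjugate (M ᵀ) j i ⟩
    det (M ᵀ) * I j i ≈⟨ *-cong (det-transpose M) (reflexive (I-symmetric j i)) ⟩
    det M * I i j ∎

  -- The matrix determinant lemma with `cramer` in place of an inverse, so that `M` may be singular
  -- or have polynomial entries. The bordered matrices `B` and `U`, the second of determinant 1,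
  -- multiply to a block lower triangular matrix with the updated matrix as its block.
  det-rank-one-update : ∀ {n} (M : Mat n n) (b v : Vect n) →
    det (λ i j → M i j + b i * v j) ≈ det M + sum (λ j → v j * cramer M b j)
  det-rank-one-update {n} M b v = begin
    det (λ i j → M i j + b i * v j) ≈⟨ sym (*-identityˡ _) ⟩
    1# * det (λ i j → M i j + b i * v j) ≈⟨ sym (det-first-row L (λ j → refl)) ⟩
    det L ≈⟨ sym (det-cong BU≋L) ⟩
    det (B · U) ≈⟨ det-· B U ⟩
    det B * det U ≈⟨ *-congˡ det-U ⟩
    det B * 1# ≈⟨ *-identityʳ _ ⟩
    det B ≈⟨ det-bordered 1# (λ j → - v j) b M ⟩
    1# * det M + - sum (λ j → - v j * cramer M b j)
      ≈⟨ +-cong (*-identityˡ _) (trans (sum-neg (λ j → - v j * cramer M b j))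
           (sum-cong-≋ (λ j → trans (-‿cong (sym (-‿distribˡ-* (v j) (cramer M b j)))) (-‿involutive _)))) ⟩
    det M + sum (λ j → v j * cramer M b j) ∎
    where
    B U L : Mat (suc n) (suc n)
    B = bordered 1# (λ j → - v j) b M
    U = bordered 1# v (λ _ → 0#) I
    L = bordered 1# (λ _ → 0#) b (λ i j → M i j + b i * v j)
    det-U : det U ≈ 1#
    det-U = begin
      det U ≈⟨ sym (det-transpose U) ⟩
      det (U ᵀ) ≈⟨ det-first-row (U ᵀ) (λ j → refl) ⟩
      1# * det (I {n} ᵀ) ≈⟨ *-identityˡ _ ⟩
      det (I {n} ᵀ) ≈⟨ det-transpose (I {n}) ⟩
      det (I {n}) ≈⟨ det-I {n} ⟩
      1# ∎
    BU≋L : B · U ≋ L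
    BU≋L zero zero = trans (+-cong (*-identityˡ 1#) (sum-zero (λ k → zeroʳ (- v k)))) (+-identityʳ _)
    BU≋L zero (suc j) = trans (+-cong (*-identityˡ (v j)) (sum-I (λ k → - v k) j)) (-‿inverseʳ (v j))
    BU≋L (suc i) zero = trans (+-cong (*-identityʳ (b i)) (sum-zero (λ k → zeroʳ (M i k)))) (+-identityʳ _)
    BU≋L (suc i) (suc j) = trans (+-congˡ (sum-I (M i) j)) (+-comm _ _)

  det-scale-rows : ∀ {n} (d : Vect n) (M : Mat n n) → det (λ i j → d i * M i j) ≈ product d * det M
  det-scale-rows {n} d M = begin
    det (λ i j → d i * M i j) ≈⟨ det-cong (λ i j → sym (diag· i j)) ⟩
    det (D · M) ≈⟨ det-· D M ⟩
    det D * det M ≈⟨ *-congʳ (trans (det-lower-triangular D lower) (product-cong {n} {λ i → D i i} {d} (λ i → trans (*-congˡ (I-diag i)) (*-identityʳ _)))) ⟩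
    product d * det M ∎
    where
    D : Mat n n
    D i j = d i * I i j
    I-diag : ∀ {k} (i : Fin k) → I i i ≈ 1#
    I-diag zero = refl
    I-diag (suc i) = I-diag i
    I-off : ∀ {k} (i j : Fin k) → toℕ i ℕ.< toℕ j → I i j ≈ 0#
    I-off zero (suc j) _ = refl
    I-off (suc i) (suc j) (ℕ.s≤s p) = I-off i j p
    lower : ∀ i j → toℕ i ℕ.< toℕ j → D i j ≈ 0#
    lower i j p = trans (*-congˡ (I-off i j p)) (zeroʳ _)
    product-cong : ∀ {k} {x y : Vect k} → (∀ i → x i ≈ y i) → product x ≈ product y
    product-cong {ℕ.zero} p = refl
    product-cong {suc k} p = *-cong (p zero) (product-cong (p ∘ suc))
    diag· : D · M ≋ (λ i j → d i * M i j)
    diag· i j = begin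
      sum (λ k → (d i * I i k) * M k j) ≈⟨ sum-cong-≋ (λ k → *-assoc (d i) (I i k) (M k j)) ⟩
      sum (λ k → d i * (I i k * M k j)) ≈⟨ sym (*-distribˡ-sum (d i) (λ k → I i k * M k j)) ⟩
      d i * (I · M) i j ≈⟨ *-congˡ ((I· M) i j) ⟩
      d i * M i j ∎

  det-neg : ∀ {n} (M : Mat n n) → det (λ i j → - M i j) ≈ product {n} (λ _ → - 1#) * det M
  det-neg M = trans (det-cong (λ i j → sym (-1*x≈-x (M i j)))) (det-scale-rows (λ _ → - 1#) M)

  -- The sign (-1)^n squares to 1, so multiplying by it once more removes it, whatever the parity of
  -- n.
  det-neg-cancel : ∀ {n} (M N : Mat n n) → det (λ i j → - M i j) ≈ det (λ i j → - N i j) → det M ≈ det N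
  det-neg-cancel {n} M N eq = begin
    det M ≈⟨ sym (trans (*-congʳ (s*s≈1 n)) (*-identityˡ _)) ⟩
    (s n * s n) * det M ≈⟨ *-assoc _ _ _ ⟩
    s n * (s n * det M) ≈⟨ *-congˡ (trans (sym (det-neg M)) (trans eq (det-neg N))) ⟩
    s n * (s n * det N) ≈⟨ sym (*-assoc _ _ _) ⟩
    (s n * s n) * det N ≈⟨ trans (*-congʳ (s*s≈1 n)) (*-identityˡ _) ⟩
    det N ∎
    where
    s : ℕ → Carrier
    s k = product {k} (λ _ → - 1#)
    s*s≈1 : ∀ k → s k * s k ≈ 1#
    s*s≈1 ℕ.zero = *-identityˡ 1#
    s*s≈1 (suc k) = begin
      (- 1# * s k) * (- 1# * s k) ≈⟨ *-cong (-1*x≈-x (s k)) (-1*x≈-x (s k)) ⟩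
      - s k * - s k ≈⟨ sym (-‿distribˡ-* (s k) (- s k)) ⟩
      - (s k * - s k) ≈⟨ -‿cong (sym (-‿distribʳ-* (s k) (s k))) ⟩
      - - (s k * s k) ≈⟨ -‿involutive _ ⟩
      s k * s k ≈⟨ s*s≈1 k ⟩
      1# ∎

-- Relations preserved by the determinant

module DetRelation {A B : Set} (OA : Ops A) (OB : Ops B)
  (Entry : A → B → Set) (Graded : ℕ → A → B → Set) where

  private
    module 𝔸 = Ops OA
    module 𝔹 = Ops OB
    module EA = Expansion OA
    module EB = Expansion OB
    module DA = Det OA
    module DB = Det OB

  module _
    (one : Graded 0 𝔸.1# 𝔹.1#)
    (mul : ∀ {d a b p q} → Entry a b → Graded d p q → Graded (suc d) (a 𝔸.⊗ p) (b 𝔹.⊗ q))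
    (add : ∀ {d p q p′ q′} → Graded d p q → Graded d p′ q′ → Graded d (p 𝔸.⊕ p′) (q 𝔹.⊕ q′))
    (neg : ∀ {d p q} → Graded d p q → Graded d (𝔸.⊖ p) (𝔹.⊖ q))
    where

    -- A determinant is built from its entries by ring operations alone, so a relation they respect
    -- passes from entries to determinants. The grading counts factors, as statements on degrees
    -- require; substitution and congruence use a constant one.
    det-related : ∀ {n} {M : Fin n → Fin n → A} {N : Fin n → Fin n → B} →
      (∀ i j → Entry (M i j) (N i j)) → Graded n (DA.det M) (DB.det N)
    expand-related : ∀ {n} (M : Fin (suc n) → Fin (suc n) → A) (N : Fin (suc n) → Fin (suc n) → B) k
      {row : Fin (suc k) → A} {row′ : Fin (suc k) → B}
      {ms : Fin (suc k) → Fin n → Fin n → A} {ms′ : Fin (suc k) → Fin n → Fin n → B} →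
      (∀ j → Entry (row j) (row′ j)) → (∀ j r c → Entry (ms j r c) (ms′ j r c)) →
      Graded (suc n) (EA.expand M k row ms) (EB.expand N k row′ ms′)

    det-related {zero} MN = one
    det-related {suc n} {M} {N} MN = expand-related M N n (MN zero) (λ j r c → MN (suc r) (punchIn j c))

    expand-related M N zero p q = mul (p zero) (det-related (q zero))
    expand-related M N (suc k) p q =
      add (mul (p zero) (det-related (q zero))) (neg (expand-related M N k (p ∘ suc) (q ∘ suc)))

-- The ring of integer power series

infix 4 _≐_
_≐_ : Poly → Poly → Set
p ≐ q = ∀ k → p k ≡ q k

open Ops PolyOps using (_⊕_; _⊗_; ⊖_) renaming (0# to 0ₚ; 1# to 1ₚ)

⊗-cong : ∀ {p p′ q q′} → p ≐ p′ → q ≐ q′ → p ⊗ q ≐ p′ ⊗ q′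
⊗-cong pp qq zero = ≡.cong₂ ℤ._*_ (pp 0) (qq 0)
⊗-cong pp qq (suc k) = ≡.cong₂ ℤ._+_ (≡.cong₂ ℤ._*_ (pp 0) (qq (suc k))) (⊗-cong (pp ∘ suc) qq k)

-- `convSum` peels terms off at the front; commutativity requires peeling at the back.
⊗-last : ∀ p q k → (p ⊗ q) (suc k) ≡ p (suc k) ℤ.* q 0 ℤ.+ (p ⊗ (q ∘ suc)) k
⊗-last p q zero = ℤₚ.+-comm (p 0 ℤ.* q 1) (p 1 ℤ.* q 0)
⊗-last p q (suc k) = begin
  p 0 ℤ.* q (suc (suc k)) ℤ.+ ((p ∘ suc) ⊗ q) (suc k)
    ≡⟨ ≡.cong (λ z → p 0 ℤ.* q (suc (suc k)) ℤ.+ z) (⊗-last (p ∘ suc) q k) ⟩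
  p 0 ℤ.* q (suc (suc k)) ℤ.+ (p (suc (suc k)) ℤ.* q 0 ℤ.+ ((p ∘ suc) ⊗ (q ∘ suc)) k)
    ≡⟨ swap (p 0 ℤ.* q (suc (suc k))) (p (suc (suc k)) ℤ.* q 0) (((p ∘ suc) ⊗ (q ∘ suc)) k) ⟩
  p (suc (suc k)) ℤ.* q 0 ℤ.+ (p 0 ℤ.* q (suc (suc k)) ℤ.+ ((p ∘ suc) ⊗ (q ∘ suc)) k) ∎
  where
  open ≡.≡-Reasoning
  swap : ∀ a b c → a ℤ.+ (b ℤ.+ c) ≡ b ℤ.+ (a ℤ.+ c)
  swap = solve-∀

⊗-comm : ∀ p q → p ⊗ q ≐ q ⊗ p
⊗-comm p q zero = ℤₚ.*-comm (p 0) (q 0)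
⊗-comm p q (suc k) = begin
  p 0 ℤ.* q (suc k) ℤ.+ ((p ∘ suc) ⊗ q) k ≡⟨ ≡.cong₂ ℤ._+_ (ℤₚ.*-comm (p 0) (q (suc k))) (⊗-comm (p ∘ suc) q k) ⟩
  q (suc k) ℤ.* p 0 ℤ.+ (q ⊗ (p ∘ suc)) k ≡⟨ ≡.sym (⊗-last q p k) ⟩
  (q ⊗ p) (suc k) ∎
  where open ≡.≡-Reasoning

⊗-distribʳ : ∀ r p q → (p ⊕ q) ⊗ r ≐ (p ⊗ r) ⊕ (q ⊗ r)
⊗-distribʳ r p q zero = ℤₚ.*-distribʳ-+ (r 0) (p 0) (q 0)
⊗-distribʳ r p q (suc k) = ≡.trans
  (≡.cong (λ z → (p 0 ℤ.+ q 0) ℤ.* r (suc k) ℤ.+ z) (⊗-distribʳ r (p ∘ suc) (q ∘ suc) k))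
  (step (p 0) (q 0) (r (suc k)) (((p ∘ suc) ⊗ r) k) (((q ∘ suc) ⊗ r) k))
  where
  step : ∀ a b c x y → (a ℤ.+ b) ℤ.* c ℤ.+ (x ℤ.+ y) ≡ (a ℤ.* c ℤ.+ x) ℤ.+ (b ℤ.* c ℤ.+ y)
  step = solve-∀

⊗-zeroˡ : ∀ q → 0ₚ ⊗ q ≐ 0ₚ
⊗-zeroˡ q zero = ≡.refl
⊗-zeroˡ q (suc k) = ≡.trans (ℤₚ.+-identityˡ _) (⊗-zeroˡ q k)

⊗-scaleˡ : ∀ x p q → (λ k → x ℤ.* p k) ⊗ q ≐ (λ k → x ℤ.* (p ⊗ q) k)
⊗-scaleˡ x p q zero = ℤₚ.*-assoc x (p 0) (q 0)
⊗-scaleˡ x p q (suc k) = ≡.trans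
  (≡.cong (λ z → x ℤ.* p 0 ℤ.* q (suc k) ℤ.+ z) (⊗-scaleˡ x (p ∘ suc) q k))
  (step x (p 0) (q (suc k)) (((p ∘ suc) ⊗ q) k))
  where
  step : ∀ x a b c → x ℤ.* a ℤ.* b ℤ.+ x ℤ.* c ≡ x ℤ.* (a ℤ.* b ℤ.+ c)
  step = solve-∀

⊗-assoc : ∀ p q r → (p ⊗ q) ⊗ r ≐ p ⊗ (q ⊗ r)
⊗-assoc p q r zero = ℤₚ.*-assoc (p 0) (q 0) (r 0)
⊗-assoc p q r (suc k) = begin
  p 0 ℤ.* q 0 ℤ.* r (suc k) ℤ.+ (((λ i → p 0 ℤ.* q (suc i)) ⊕ ((p ∘ suc) ⊗ q)) ⊗ r) k
    ≡⟨ ≡.cong (λ z → p 0 ℤ.* q 0 ℤ.* r (suc k) ℤ.+ z) (⊗-distribʳ r (λ i → p 0 ℤ.* q (suc i)) ((p ∘ suc) ⊗ q) k) ⟩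
  p 0 ℤ.* q 0 ℤ.* r (suc k) ℤ.+ (((λ i → p 0 ℤ.* q (suc i)) ⊗ r) k ℤ.+ (((p ∘ suc) ⊗ q) ⊗ r) k)
    ≡⟨ ≡.cong (λ z → p 0 ℤ.* q 0 ℤ.* r (suc k) ℤ.+ z) (≡.cong₂ ℤ._+_ (⊗-scaleˡ (p 0) (q ∘ suc) r k) (⊗-assoc (p ∘ suc) q r k)) ⟩
  p 0 ℤ.* q 0 ℤ.* r (suc k) ℤ.+ (p 0 ℤ.* ((q ∘ suc) ⊗ r) k ℤ.+ ((p ∘ suc) ⊗ (q ⊗ r)) k)
    ≡⟨ step (p 0) (q 0) (r (suc k)) (((q ∘ suc) ⊗ r) k) (((p ∘ suc) ⊗ (q ⊗ r)) k) ⟩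
  p 0 ℤ.* (q 0 ℤ.* r (suc k) ℤ.+ ((q ∘ suc) ⊗ r) k) ℤ.+ ((p ∘ suc) ⊗ (q ⊗ r)) k ∎
  where
  open ≡.≡-Reasoning
  step : ∀ a b c x y → a ℤ.* b ℤ.* c ℤ.+ (a ℤ.* x ℤ.+ y) ≡ a ℤ.* (b ℤ.* c ℤ.+ x) ℤ.+ y
  step = solve-∀

⊗-constˡ : ∀ x q → constP x ⊗ q ≐ (λ k → x ℤ.* q k)
⊗-constˡ x q zero = ≡.refl
⊗-constˡ x q (suc k) = ≡.trans (≡.cong (λ z → x ℤ.* q (suc k) ℤ.+ z) (⊗-zeroˡ q k)) (ℤₚ.+-identityʳ _)

one≐const : 1ₚ ≐ constP (+ 1)
one≐const zero = ≡.refl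
one≐const (suc k) = ≡.refl

⊗-identityˡ : ∀ q → 1ₚ ⊗ q ≐ q
⊗-identityˡ q k = ≡.trans (⊗-cong {q = q} one≐const (λ _ → ≡.refl) k) (≡.trans (⊗-constˡ (+ 1) q k) (ℤₚ.*-identityˡ (q k)))

≐-isEquivalence : IsEquivalence _≐_
≐-isEquivalence = record
  { refl = λ k → ≡.refl ; sym = λ p k → ≡.sym (p k) ; trans = λ p q k → ≡.trans (p k) (q k) }

polyRing : CommutativeRing 0ℓ 0ℓ
polyRing = record
  { Carrier = Poly ; _≈_ = _≐_ ; _+_ = _⊕_ ; _*_ = _⊗_ ; -_ = ⊖_ ; 0# = 0ₚ ; 1# = 1ₚ
  ; isCommutativeRing = record
    { isRing = record
      { +-isAbelianGroup = record
        { isGroup = record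
          { isMonoid = record
            { isSemigroup = record
              { isMagma = record
                { isEquivalence = ≐-isEquivalence
                ; ∙-cong = λ p q k → ≡.cong₂ ℤ._+_ (p k) (q k) }
              ; assoc = λ p q r k → ℤₚ.+-assoc (p k) (q k) (r k) }
            ; identity = (λ p k → ℤₚ.+-identityˡ (p k)) , (λ p k → ℤₚ.+-identityʳ (p k)) }
          ; inverse = (λ p k → ℤₚ.+-inverseˡ (p k)) , (λ p k → ℤₚ.+-inverseʳ (p k))
          ; ⁻¹-cong = λ p k → ≡.cong ℤ.-_ (p k) }
        ; comm = λ p q k → ℤₚ.+-comm (p k) (q k) }
      ; *-cong = ⊗-cong
      ; *-assoc = ⊗-assoc
      ; *-identity = ⊗-identityˡ , (λ q k → ≡.trans (⊗-comm q 1ₚ k) (⊗-identityˡ q k))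
      ; distrib = (λ p q r k → ≡.trans (⊗-comm p (q ⊕ r) k)
                      (≡.trans (⊗-distribʳ p q r k) (≡.cong₂ ℤ._+_ (⊗-comm q p k) (⊗-comm r p k))))
                , ⊗-distribʳ }
    ; *-comm = ⊗-comm } }

module PL = LinearAlgebra polyRing

-- Substitution into polynomials

module Substitution (Y : Poly) where

  open import Data.List using (List; []; _∷_)
  open CommutativeRing polyRing hiding (zero; _≈_)
  open import Relation.Binary.Reasoning.Setoid setoid
  open import Algebra.Properties.Ring ring using (-‿distribˡ-*; -‿distribʳ-*; -0#≈0#)
  open import Algebra.Properties.AbelianGroup +-abelianGroup using (⁻¹-∙-comm)
  open RingIdentities polyRing using (horner-+; horner-*ˡ; horner-*ʳ)

  coeffs : List ℤ → Poly
  coeffs [] k = + 0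
  coeffs (a ∷ l) zero = a
  coeffs (a ∷ l) (suc k) = coeffs l k

  eval : List ℤ → Poly
  eval [] = 0ₚ
  eval (a ∷ l) = constP a ⊕ (Y ⊗ eval l)

  const-0 : constP (+ 0) ≐ 0ₚ
  const-0 zero = ≡.refl
  const-0 (suc k) = ≡.refl

  const-+ : ∀ a b → constP (a ℤ.+ b) ≐ constP a ⊕ constP b
  const-+ a b zero = ≡.refl
  const-+ a b (suc k) = ≡.refl

  const-* : ∀ a b → constP (a ℤ.* b) ≐ constP a ⊗ constP b
  const-* a b k = ≡.sym (≡.trans (⊗-constˡ a (constP b) k) (lem k))
    where
    lem : (λ k → a ℤ.* constP b k) ≐ constP (a ℤ.* b)
    lem zero = ≡.refl
    lem (suc k) = ℤₚ.*-zeroʳ a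

  -- Lists that differ by trailing zeros represent the same polynomial; this makes the result of a
  -- substitution depend on the polynomial only.
  eval-cong : ∀ l m → coeffs l ≐ coeffs m → eval l ≐ eval m
  eval-cong [] [] eq = refl
  eval-cong [] (b ∷ m) eq = begin
    0ₚ ≈⟨ sym (trans (+-cong const-0 (zeroʳ Y)) (+-identityˡ 0ₚ)) ⟩
    constP (+ 0) ⊕ (Y ⊗ 0ₚ) ≈⟨ +-cong (λ k → ≡.cong (λ z → constP z k) (eq 0)) (*-congˡ {Y} (eval-cong [] m (eq ∘ suc))) ⟩
    constP b ⊕ (Y ⊗ eval m) ∎
  eval-cong (a ∷ l) [] eq = begin
    constP a ⊕ (Y ⊗ eval l) ≈⟨ +-cong (λ k → ≡.cong (λ z → constP z k) (eq 0)) (*-congˡ {Y} (eval-cong l [] (eq ∘ suc))) ⟩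
    constP (+ 0) ⊕ (Y ⊗ 0ₚ) ≈⟨ trans (+-cong const-0 (zeroʳ Y)) (+-identityˡ 0ₚ) ⟩
    0ₚ ∎
  eval-cong (a ∷ l) (b ∷ m) eq =
    +-cong (λ k → ≡.cong (λ z → constP z k) (eq 0)) (*-congˡ {Y} (eval-cong l m (eq ∘ suc)))

  addL : List ℤ → List ℤ → List ℤ
  addL [] m = m
  addL (a ∷ l) [] = a ∷ l
  addL (a ∷ l) (b ∷ m) = (a ℤ.+ b) ∷ addL l m

  scaleL : ℤ → List ℤ → List ℤ
  scaleL x [] = []
  scaleL x (a ∷ l) = (x ℤ.* a) ∷ scaleL x l

  mulL : List ℤ → List ℤ → List ℤ
  mulL [] m = []
  mulL (a ∷ l) m = addL (scaleL a m) (+ 0 ∷ mulL l m)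

  coeffs-add : ∀ l m → coeffs (addL l m) ≐ coeffs l ⊕ coeffs m
  coeffs-add [] m k = ≡.sym (ℤₚ.+-identityˡ _)
  coeffs-add (a ∷ l) [] zero = ≡.sym (ℤₚ.+-identityʳ a)
  coeffs-add (a ∷ l) [] (suc k) = ≡.sym (ℤₚ.+-identityʳ _)
  coeffs-add (a ∷ l) (b ∷ m) zero = ≡.refl
  coeffs-add (a ∷ l) (b ∷ m) (suc k) = coeffs-add l m k

  coeffs-scale : ∀ x l → coeffs (scaleL x l) ≐ (λ k → x ℤ.* coeffs l k)
  coeffs-scale x [] k = ≡.sym (ℤₚ.*-zeroʳ x)
  coeffs-scale x (a ∷ l) zero = ≡.refl
  coeffs-scale x (a ∷ l) (suc k) = coeffs-scale x l k

  coeffs-mul : ∀ l m → coeffs (mulL l m) ≐ coeffs l ⊗ coeffs m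
  coeffs-mul [] m k = ≡.sym (⊗-zeroˡ (coeffs m) k)
  coeffs-mul (a ∷ l) m zero = ≡.trans (coeffs-add (scaleL a m) (+ 0 ∷ mulL l m) 0)
    (≡.trans (ℤₚ.+-identityʳ _) (coeffs-scale a m 0))
  coeffs-mul (a ∷ l) m (suc k) = ≡.trans (coeffs-add (scaleL a m) (+ 0 ∷ mulL l m) (suc k))
    (≡.cong₂ ℤ._+_ (coeffs-scale a m (suc k)) (coeffs-mul l m k))

  eval-add : ∀ l m → eval (addL l m) ≐ eval l ⊕ eval m
  eval-add [] m = sym (+-identityˡ (eval m))
  eval-add (a ∷ l) [] = sym (+-identityʳ (eval (a ∷ l)))
  eval-add (a ∷ l) (b ∷ m) = begin
    constP (a ℤ.+ b) ⊕ (Y ⊗ eval (addL l m)) ≈⟨ +-cong (const-+ a b) (*-congˡ {Y} (eval-add l m)) ⟩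
    (constP a ⊕ constP b) ⊕ (Y ⊗ (eval l ⊕ eval m))
      ≈⟨ horner-+ (constP a) (constP b) Y (eval l) (eval m) ⟩
    (constP a ⊕ (Y ⊗ eval l)) ⊕ (constP b ⊕ (Y ⊗ eval m)) ∎

  eval-scale : ∀ x l → eval (scaleL x l) ≐ constP x ⊗ eval l
  eval-scale x [] = sym (zeroʳ (constP x))
  eval-scale x (a ∷ l) = begin
    constP (x ℤ.* a) ⊕ (Y ⊗ eval (scaleL x l)) ≈⟨ +-cong (const-* x a) (*-congˡ {Y} (eval-scale x l)) ⟩
    (constP x ⊗ constP a) ⊕ (Y ⊗ (constP x ⊗ eval l))
      ≈⟨ horner-*ˡ (constP x) (constP a) Y (eval l) ⟩
    constP x ⊗ (constP a ⊕ (Y ⊗ eval l)) ∎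

  eval-mul : ∀ l m → eval (mulL l m) ≐ eval l ⊗ eval m
  eval-mul [] m = sym (zeroˡ (eval m))
  eval-mul (a ∷ l) m = begin
    eval (addL (scaleL a m) (+ 0 ∷ mulL l m)) ≈⟨ eval-add (scaleL a m) (+ 0 ∷ mulL l m) ⟩
    eval (scaleL a m) ⊕ (constP (+ 0) ⊕ (Y ⊗ eval (mulL l m)))
      ≈⟨ +-cong (eval-scale a m) (trans (+-cong const-0 (*-congˡ {Y} (eval-mul l m))) (+-identityˡ (Y ⊗ (eval l ⊗ eval m)))) ⟩
    (constP a ⊗ eval m) ⊕ (Y ⊗ (eval l ⊗ eval m))
      ≈⟨ horner-*ʳ (constP a) (eval m) Y (eval l) ⟩
    (constP a ⊕ (Y ⊗ eval l)) ⊗ eval m ∎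

  -- q arises from the polynomial p by substituting Y for the variable; the list makes
  -- p a genuine polynomial, as Poly contains all power series.
  Subst : Poly → Poly → Set
  Subst p q = Σ (List ℤ) λ l → (p ≐ coeffs l) × (q ≐ eval l)

  subst-functional : ∀ {p p′ q q′} → p ≐ p′ → Subst p q → Subst p′ q′ → q ≐ q′
  subst-functional {p} {p′} p≐p′ (l , pl , ql) (m , pm , qm) =
    trans ql (trans (eval-cong l m (trans (sym pl) (trans {p} {p′} p≐p′ pm))) (sym qm))

  subst-resp : ∀ {p q q′} → q ≐ q′ → Subst p q → Subst p q′
  subst-resp {q = q} {q′} eq (l , pl , ql) = l , pl , trans {q′} {q} (sym {q} {q′} eq) ql

  subst-const : ∀ a → Subst (constP a) (constP a)
  subst-const a = a ∷ [] , (λ { zero → ≡.refl ; (suc k) → ≡.refl })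
    , sym (trans (+-congˡ {constP a} (zeroʳ Y)) (+-identityʳ (constP a)))

  subst-0 : Subst 0ₚ 0ₚ
  subst-0 = [] , (λ k → ≡.refl) , (λ k → ≡.refl)

  subst-1 : Subst 1ₚ 1ₚ
  subst-1 with subst-const (+ 1)
  ... | l , p , q = l , trans one≐const p , trans one≐const q

  subst-⊕ : ∀ {p q p′ q′} → Subst p q → Subst p′ q′ → Subst (p ⊕ p′) (q ⊕ q′)
  subst-⊕ {p} {q} {p′} {q′} (l , pl , ql) (m , pm , qm) = addL l m
    , trans (+-cong {p} {_} {p′} pl pm) (sym (coeffs-add l m))
    , trans (+-cong {q} {_} {q′} ql qm) (sym (eval-add l m))

  subst-⊗ : ∀ {p q p′ q′} → Subst p q → Subst p′ q′ → Subst (p ⊗ p′) (q ⊗ q′)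
  subst-⊗ {p} {q} {p′} {q′} (l , pl , ql) (m , pm , qm) = mulL l m
    , trans (*-cong {p} {_} {p′} pl pm) (sym (coeffs-mul l m))
    , trans (*-cong {q} {_} {q′} ql qm) (sym (eval-mul l m))

  subst-⊖ : ∀ {p q} → Subst p q → Subst (⊖ p) (⊖ q)
  subst-⊖ {p} {q} (l , pl , ql) = scaleL (ℤ.- (+ 1)) l
    , (λ k → ≡.trans (≡.cong ℤ.-_ (pl k)) (≡.trans (≡.sym (ℤₚ.-1*i≡-i (coeffs l k))) (≡.sym (coeffs-scale (ℤ.- (+ 1)) l k))))
    , (λ k → ≡.trans (≡.cong ℤ.-_ (ql k)) (≡.trans (≡.sym (ℤₚ.-1*i≡-i (eval l k)))
         (≡.sym (≡.trans (eval-scale (ℤ.- (+ 1)) l k) (⊗-constˡ (ℤ.- (+ 1)) (eval l) k)))))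

  subst-X : Subst X Y
  subst-X = + 0 ∷ + 1 ∷ []
    , (λ { zero → ≡.refl ; (suc zero) → ≡.refl ; (suc (suc k)) → ≡.refl })
    , sym (begin
        constP (+ 0) ⊕ (Y ⊗ (constP (+ 1) ⊕ (Y ⊗ 0ₚ)))
          ≈⟨ +-cong const-0 (*-congˡ {Y} (+-cong (sym one≐const) (zeroʳ Y))) ⟩
        0ₚ ⊕ (Y ⊗ (1ₚ ⊕ 0ₚ)) ≈⟨ trans (+-identityˡ (Y ⊗ (1ₚ ⊕ 0ₚ))) (trans (*-congˡ {Y} (+-identityʳ 1ₚ)) (*-identityʳ Y)) ⟩
        Y ∎)

  subst-det : ∀ {n} {M N : Fin n → Fin n → Poly} → (∀ i j → Subst (M i j) (N i j)) → Subst (PL.det M) (PL.det N)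
  subst-det = DetRelation.det-related PolyOps PolyOps Subst (λ _ → Subst) subst-1 subst-⊗ subst-⊕ subst-⊖

module GeneralizedSpectrum where

  open import Algebra.Properties.AbelianGroup ℤₚ.+-0-abelianGroup using (∙-cancelˡ)
  open import Algebra.Properties.Semiring.Sum (CommutativeRing.semiring ℤₚ.+-*-commutativeRing)
    using (sum; sum-cong-≗; ∑-distrib-+; ∑-comm; *-distribˡ-sum; *-distribʳ-sum; sum-init-last; sum-remove)
  open import Algebra.Properties.Semiring.Sum (CommutativeRing.semiring polyRing)
    using () renaming (sum to sumₚ; sum-cong-≋ to sumₚ-cong; ∑-distrib-+ to sumₚ-⊕; *-distribˡ-sum to ⊗-distribˡ-sumₚ)
  open import Data.Bool using (true; false; not)
  open import Data.Bool.Properties using (not-involutive; not-injective)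
  open import Data.Fin using (fromℕ; inject₁)
  open import Data.Fin.Induction using (>-weakInduction)
  import Data.Fin.Properties as Finₚ
  open import Data.Fin.Properties using (all?; ¬∀⟶∃¬; toℕ<n; toℕ-inject₁; toℕ-fromℕ)
  open import Data.Integer using (_+_; _*_; -_; _^_)
  open import Data.Integer.Divisibility.Signed using (_∣_; divides; _∣?_; ∣ᵤ⇒∣; ∣⇒∣ᵤ; ∣-refl; ∣-trans; ∣m∣n⇒∣m+n; ∣m⇒∣-m; ∣m+n∣m⇒∣n; ∣n⇒∣m*n; ∣m⇒∣m*n; *-monoʳ-∣; *-cancelˡ-∣)
  import Data.Integer.DivMod as ℤᵈ
  import Data.List as List
  open import Data.List.Relation.Unary.All as All using (All)
  open import Data.Nat using (_<_; _≤_; _∸_; s≤s; z≤n)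
  import Data.Nat.Divisibility as ℕᵈ
  import Data.Nat.DivMod as ℕᵐ
  import Data.Nat.ListAction as ℕᴸ
  open import Data.Nat.Primality using (Prime; euclidsLemma; prime⇒nonZero; prime⇒nonTrivial; prime[2])
  open import Data.Nat.Primality.Factorisation using (PrimeFactorisation; factorise)
  open import Data.Vec.Functional using (_∷_; insertAt; removeAt)
  open import Function.Bundles using (Inverse; mk↔ₛ′)
  open import Relation.Binary.Bundles using (Setoid)
  open import Relation.Binary.Definitions using (tri<; tri≈; tri>)
  import Relation.Binary.Reasoning.Setoid
  open ≡ using (refl; sym; trans; cong; cong₂; subst; subst₂)
  open ≡.≡-Reasoning

  module ZL = LinearAlgebra ℤₚ.+-*-commutativeRing
  open ZL using (Vect; Mat; _≋_; I; I·_; _·I; _·_; _ᵀ; _*ₘ_; det; sgn; minor; product; adjugate; leftAdjugate; detForm; det-transpose; det-cong; ·-assoc; ·-cong; det-·; ·-*ₘ; sum-zero; sum-I; ·-ᵀ; sum-lin; *ₘ-·; ·-adjugate; leftAdjugate-·; det-first-row; det-I; det-scale-rows; det-lower-triangular; I-symmetric; det-neg; swap-first; repeated-first; first-sum; first-add; first-zero; move-first)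

  -- Walk counts from the resolvent

  sumₚ-coeff : ∀ {n} (t : Fin n → Poly) k → sumₚ t k ≡ sum (λ j → t j k)
  sumₚ-coeff {zero} t k = refl
  sumₚ-coeff {suc n} t k = cong (λ z → t zero k + z) (sumₚ-coeff (t ∘ suc) k)

  sum-neg : ∀ {n} (t : Vect n) → sum (λ i → - t i) ≡ - sum t
  sum-neg t = sym (ZL.sum-neg t)

  X-tail : X ∘ suc ≐ 1ₚ
  X-tail zero = refl
  X-tail (suc k) = refl

  X⊗-suc : ∀ p k → (X ⊗ p) (suc k) ≡ p k
  X⊗-suc p k = begin
    + 0 * p (suc k) + ((X ∘ suc) ⊗ p) k ≡⟨ ℤₚ.+-identityˡ _ ⟩
    ((X ∘ suc) ⊗ p) k ≡⟨ ⊗-cong {q = p} X-tail (λ _ → refl) k ⟩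
    (1ₚ ⊗ p) k ≡⟨ ⊗-identityˡ p k ⟩
    p k ∎

  charMat : ∀ {n} → Mat n n → Fin n → Fin n → Poly
  charMat A i j = (X ⊗ PL.I i j) ⊕ (⊖ constP (A i j))

  charMat-apply : ∀ {n} (A : Mat n n) (g : Fin n → Poly) i →
    sumₚ (λ j → charMat A i j ⊗ g j) ≐ (X ⊗ g i) ⊕ (⊖ (λ k → sum (λ j → A i j * g j k)))
  charMat-apply A g i k = begin
    sumₚ (λ j → charMat A i j ⊗ g j) k
      ≡⟨ sumₚ-cong (λ j k → term j k) k ⟩
    sumₚ (λ j → (X ⊗ (PL.I i j ⊗ g j)) ⊕ (λ k → - (A i j * g j k))) k
      ≡⟨ sumₚ-⊕ (λ j → X ⊗ (PL.I i j ⊗ g j)) (λ j k → - (A i j * g j k)) k ⟩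
    sumₚ (λ j → X ⊗ (PL.I i j ⊗ g j)) k + sumₚ (λ j k → - (A i j * g j k)) k
      ≡⟨ cong₂ _+_ (sym (⊗-distribˡ-sumₚ X (λ j → PL.I i j ⊗ g j) k))
                     (trans (sumₚ-coeff (λ j k → - (A i j * g j k)) k) (sum-neg (λ j → A i j * g j k))) ⟩
    (X ⊗ sumₚ (λ j → PL.I i j ⊗ g j)) k + - sum (λ j → A i j * g j k)
      ≡⟨ cong (λ z → z + - sum (λ j → A i j * g j k))
           (⊗-cong {X} (λ _ → refl) ((PL.I· (λ j (_ : Fin 1) → g j)) i zero) k) ⟩
    (X ⊗ g i) k + - sum (λ j → A i j * g j k) ∎
    where
    term : ∀ j → charMat A i j ⊗ g j ≐ (X ⊗ (PL.I i j ⊗ g j)) ⊕ (λ k → - (A i j * g j k))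
    term j k = begin
      (charMat A i j ⊗ g j) k ≡⟨ ⊗-distribʳ (g j) (X ⊗ PL.I i j) (⊖ constP (A i j)) k ⟩
      ((X ⊗ PL.I i j) ⊗ g j) k + ((⊖ constP (A i j)) ⊗ g j) k
        ≡⟨ cong₂ _+_ (⊗-assoc X (PL.I i j) (g j) k)
             (trans (⊗-cong {⊖ constP (A i j)} {constP (- A i j)} {g j} {g j} (λ { zero → refl ; (suc k) → refl }) (λ _ → refl) k) (trans (⊗-constˡ (- A i j) (g j) k) (sym (ℤₚ.neg-distribˡ-* (A i j) (g j k))))) ⟩
      (X ⊗ (PL.I i j ⊗ g j)) k + - (A i j * g j k) ∎

  -- A bound on the degree rather than the degree itself: `z` may be 0, so that the relation is
  -- closed under sums.
  Leading : ℕ → Poly → ℤ → Set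
  Leading d p z = (∀ k → d < k → p k ≡ + 0) × p d ≡ z

  private
    tail-const : ∀ {p} → (∀ k → 1 < k → p k ≡ + 0) → p ∘ suc ≐ constP (p 1)
    tail-const h zero = refl
    tail-const h (suc k) = h (suc (suc k)) (s≤s (s≤s z≤n))

    linear-⊗ : ∀ {p} → (∀ k → 1 < k → p k ≡ + 0) → ∀ q k → (p ⊗ q) (suc k) ≡ p 0 * q (suc k) + p 1 * q k
    linear-⊗ {p} h q k = cong (λ z → p 0 * q (suc k) + z)
      (trans (⊗-cong {q = q} (tail-const h) (λ _ → refl) k) (⊗-constˡ (p 1) q k))

  leading-⊗ : ∀ {d a y p z} → Leading 1 a y → Leading d p z → Leading (suc d) (a ⊗ p) (y * z)
  leading-⊗ {d} {a} {y} {p} {z} (ha , a1) (hp , pd) = vanish , top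
    where
    vanish : ∀ k → suc d < k → (a ⊗ p) k ≡ + 0
    vanish (suc k) (s≤s d<k) = begin
      (a ⊗ p) (suc k) ≡⟨ linear-⊗ ha p k ⟩
      a 0 * p (suc k) + a 1 * p k ≡⟨ cong₂ (λ u v → a 0 * u + a 1 * v) (hp (suc k) (ℕₚ.m≤n⇒m≤1+n d<k)) (hp k d<k) ⟩
      a 0 * + 0 + a 1 * + 0 ≡⟨ cong₂ _+_ (ℤₚ.*-zeroʳ (a 0)) (ℤₚ.*-zeroʳ (a 1)) ⟩
      + 0 ∎
    top : (a ⊗ p) (suc d) ≡ y * z
    top = begin
      (a ⊗ p) (suc d) ≡⟨ linear-⊗ ha p d ⟩
      a 0 * p (suc d) + a 1 * p d ≡⟨ cong₂ _+_ (trans (cong (a 0 *_) (hp (suc d) ℕₚ.≤-refl)) (ℤₚ.*-zeroʳ (a 0))) (cong₂ _*_ a1 pd) ⟩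
      + 0 + y * z ≡⟨ ℤₚ.+-identityˡ _ ⟩
      y * z ∎

  leading-⊕ : ∀ {d p z p′ z′} → Leading d p z → Leading d p′ z′ → Leading d (p ⊕ p′) (z + z′)
  leading-⊕ (hp , pd) (hp′ , pd′) = (λ k d<k → cong₂ _+_ (hp k d<k) (hp′ k d<k)) , cong₂ _+_ pd pd′

  leading-⊖ : ∀ {d p z} → Leading d p z → Leading d (⊖ p) (- z)
  leading-⊖ (hp , pd) = (λ k d<k → cong -_ (hp k d<k)) , cong -_ pd

  leading-1 : Leading 0 1ₚ (+ 1)
  leading-1 = (λ { (suc k) _ → refl }) , refl

  leading-det : ∀ {n} {M : Fin n → Fin n → Poly} {N : Mat n n} →
    (∀ i j → Leading 1 (M i j) (N i j)) → Leading n (PL.det M) (ZL.det N)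
  leading-det = DetRelation.det-related PolyOps ℤOps (Leading 1) Leading leading-1 leading-⊗ leading-⊕ leading-⊖

  leading-charMat : ∀ {n} (A : Mat n n) i j → Leading 1 (charMat A i j) (I i j)
  leading-charMat A i j = (λ { (suc (suc k)) (s≤s (s≤s _)) → trans (cong (λ z → z + + 0) (trans (X⊗-suc (PL.I i j) (suc k)) (I-coeff-suc i j k))) refl })
    , trans (ℤₚ.+-identityʳ _) (trans (X⊗-suc (PL.I i j) 0) (I-coeff-zero i j))
    where
    I-coeff-suc : ∀ {n} (i j : Fin n) k → PL.I i j (suc k) ≡ + 0
    I-coeff-suc zero zero k = refl
    I-coeff-suc zero (suc j) k = refl
    I-coeff-suc (suc i) zero k = refl
    I-coeff-suc (suc i) (suc j) k = I-coeff-suc i j k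
    I-coeff-zero : ∀ {n} (i j : Fin n) → PL.I i j 0 ≡ I i j
    I-coeff-zero zero zero = refl
    I-coeff-zero zero (suc j) = refl
    I-coeff-zero (suc i) zero = refl
    I-coeff-zero (suc i) (suc j) = I-coeff-zero i j

  φ : ∀ {n} → Mat n n → Poly
  φ A = PL.det (charMat A)

  φ-leading : ∀ {n} (A : Mat n n) → Leading n (φ A) (+ 1)
  φ-leading {n} A with leading-det (leading-charMat A)
  ... | h , top = h , trans top (det-I {n})

  iterate : ∀ {n} → Mat n n → ℕ → Vect n → Vect n
  iterate A zero v = v
  iterate A (suc k) v i = sum (λ j → A i j * iterate A k v j)

  walk : ∀ {n} → Mat n n → ℕ → Vect n
  walk A k = iterate A k (λ _ → + 1)

  walkCount : ∀ {n} → Mat n n → ℕ → ℤ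
  walkCount A k = sum (walk A k)

  Symmetric : ∀ {n} → Mat n n → Set
  Symmetric A = ∀ i j → A i j ≡ A j i

  -- adj(x I - A) e, where e is the all-ones vector.
  resolvent : ∀ {n} → Mat n n → Fin n → Poly
  resolvent A = PL.cramer (charMat A) (λ _ → 1ₚ)

  module Resolvent {n} (A : Mat n n) (A-sym : Symmetric A) where

    g : Fin n → Poly
    g = resolvent A

    -- Cramer's rule for xI - A with right-hand side e, that is (xI - A) g = det(xI - A) e.
    equation : ∀ i → (X ⊗ g i) ⊕ (⊖ (λ k → sum (λ j → A i j * g j k))) ≐ φ A
    equation i k = begin
      (X ⊗ g i) k + - sum (λ j → A i j * g j k) ≡⟨ sym (charMat-apply A g i k) ⟩
      sumₚ (λ j → charMat A i j ⊗ g j) k ≡⟨ PL.cramer-solves (charMat A) (λ _ → 1ₚ) i k ⟩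
      (φ A ⊗ 1ₚ) k ≡⟨ ⊗-comm (φ A) 1ₚ k ⟩
      (1ₚ ⊗ φ A) k ≡⟨ ⊗-identityˡ (φ A) k ⟩
      φ A k ∎

    g-vanish′ : ∀ i k → n < k → g i k ≡ + 0
    g-vanish′ i k n<k = trans (sgn-⊗ i _ k) (trans (cong (sgn i *_) (proj₁ (leading-det {N = λ r c → _} entries) k n<k)) (ℤₚ.*-zeroʳ (sgn i)))
      where
      entries : ∀ r c → Leading 1 ((1ₚ ∷ charMat A r) (punchIn (suc i) c)) ((+ 0 ∷ I r) (punchIn (suc i) c))
      entries r c with punchIn (suc i) c
      ... | zero = (λ { (suc k) _ → refl }) , refl
      ... | suc j = leading-charMat A r j
      sgn-⊗ : ∀ {m} (i : Fin m) p → PL.sgn i ⊗ p ≐ (λ k → sgn i * p k)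
      sgn-⊗ zero p k = trans (⊗-identityˡ p k) (sym (ℤₚ.*-identityˡ (p k)))
      sgn-⊗ (suc i) p k = begin
        ((⊖ PL.sgn i) ⊗ p) k ≡⟨ sym (-‿distribˡ-* (PL.sgn i) p k) ⟩
        - (PL.sgn i ⊗ p) k ≡⟨ cong -_ (sgn-⊗ i p k) ⟩
        - (sgn i * p k) ≡⟨ ℤₚ.neg-distribˡ-* (sgn i) (p k) ⟩
        - sgn i * p k ∎
        where open import Algebra.Properties.Ring (CommutativeRing.ring polyRing) using (-‿distribˡ-*)

    step : ∀ i k → g i k ≡ φ A (suc k) + sum (λ j → A i j * g j (suc k))
    step i k = rearrange _ _ _ (trans (cong (λ z → z + - sum (λ j → A i j * g j (suc k))) (sym (X⊗-suc (g i) k))) (equation i (suc k)))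
      where
      rearrange : ∀ a b c → a + - b ≡ c → a ≡ c + b
      rearrange a b c eq = trans (add-sub a b) (cong (_+ b) eq)
        where
        add-sub : ∀ a b → a ≡ a + - b + b
        add-sub = solve-∀

    -- The degree bound for a determinant of order n only excludes degrees above n, although one
    -- column is constant. The equation x g = φ e + A g gains the missing degree: the coefficient of
    -- x^n in g comes from those of x^(n+1) on the right, which vanish.
    g-vanish : ∀ i → g i n ≡ + 0
    g-vanish i = begin
      g i n ≡⟨ step i n ⟩
      φ A (suc n) + sum (λ j → A i j * g j (suc n))
        ≡⟨ cong₂ _+_ (proj₁ (φ-leading A) (suc n) ℕₚ.≤-refl)
             (sum-zero (λ j → trans (cong (A i j *_) (g-vanish′ j (suc n) ℕₚ.≤-refl)) (ℤₚ.*-zeroʳ (A i j)))) ⟩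
      + 0 ∎

    -- The coefficient of x^l in e · A^k adj(x I - A) e.
    T : ℕ → ℕ → ℤ
    T k l = sum (λ i → walk A k i * g i l)

    T-step : ∀ k l → T (suc k) l ≡ sum (λ i → walk A k i * sum (λ j → A i j * g j l))
    T-step k l = begin
      sum (λ i → sum (λ j → A i j * walk A k j) * g i l)
        ≡⟨ sum-cong-≗ (λ i → *-distribʳ-sum (g i l) (λ j → A i j * walk A k j)) ⟩
      sum (λ i → sum (λ j → A i j * walk A k j * g i l))
        ≡⟨ ∑-comm (λ i j → A i j * walk A k j * g i l) ⟩
      sum (λ j → sum (λ i → A i j * walk A k j * g i l))
        ≡⟨ sum-cong-≗ (λ j → sum-cong-≗ (λ i → trans (cong (λ z → z * walk A k j * g i l) (A-sym i j)) (shuffle (A j i) (walk A k j) (g i l)))) ⟩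
      sum (λ j → sum (λ i → walk A k j * (A j i * g i l)))
        ≡⟨ sum-cong-≗ (λ j → sym (*-distribˡ-sum (walk A k j) (λ i → A j i * g i l))) ⟩
      sum (λ j → walk A k j * sum (λ i → A j i * g i l)) ∎
      where
      shuffle : ∀ a w x → a * w * x ≡ w * (a * x)
      shuffle = solve-∀

    T-zero : ∀ k → T (suc k) 0 ≡ - φ A 0 * walkCount A k
    T-zero k = begin
      T (suc k) 0 ≡⟨ T-step k 0 ⟩
      sum (λ i → walk A k i * sum (λ j → A i j * g j 0)) ≡⟨ sum-cong-≗ (λ i → trans (cong (walk A k i *_) (at0 i)) (ℤₚ.*-comm (walk A k i) (- φ A 0))) ⟩
      sum (λ i → - φ A 0 * walk A k i) ≡⟨ sym (*-distribˡ-sum (- φ A 0) (walk A k)) ⟩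
      - φ A 0 * walkCount A k ∎
      where
      at0 : ∀ i → sum (λ j → A i j * g j 0) ≡ - φ A 0
      at0 i = begin
        sum (λ j → A i j * g j 0) ≡⟨ sym (ℤₚ.neg-involutive _) ⟩
        - (- sum (λ j → A i j * g j 0)) ≡⟨ cong -_ (trans (sym (ℤₚ.+-identityˡ _)) (equation i 0)) ⟩
        - φ A 0 ∎

    -- The coefficient of x^(l+1) in `equation`, paired with A^k e; by the symmetry of A the term A
    -- g is absorbed into the next walk vector.
    T-suc : ∀ k l → T k l ≡ φ A (suc l) * walkCount A k + T (suc k) (suc l)
    T-suc k l = begin
      sum (λ i → walk A k i * g i l)
        ≡⟨ sum-cong-≗ (λ i → trans (cong (walk A k i *_) (step i l)) (expand (walk A k i) (φ A (suc l)) (sum (λ j → A i j * g j (suc l))))) ⟩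
      sum (λ i → φ A (suc l) * walk A k i + walk A k i * sum (λ j → A i j * g j (suc l)))
        ≡⟨ ∑-distrib-+ (λ i → φ A (suc l) * walk A k i) (λ i → walk A k i * sum (λ j → A i j * g j (suc l))) ⟩
      sum (λ i → φ A (suc l) * walk A k i) + sum (λ i → walk A k i * sum (λ j → A i j * g j (suc l)))
        ≡⟨ cong₂ _+_ (sym (*-distribˡ-sum (φ A (suc l)) (walk A k))) (sym (T-step k (suc l))) ⟩
      φ A (suc l) * walkCount A k + T (suc k) (suc l) ∎
      where
      expand : ∀ w f s → w * (f + s) ≡ f * w + w * s
      expand = solve-∀

    T-top : ∀ k → T k n ≡ + 0
    T-top k = sum-zero (λ i → trans (cong (walk A k i *_) (g-vanish i)) (ℤₚ.*-zeroʳ (walk A k i)))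

  walkCount-from-T : ∀ {n} (A : Mat (suc n) (suc n)) (A-sym : Symmetric A) k →
    walkCount A k ≡ Resolvent.T A A-sym k n
  walkCount-from-T {n} A A-sym k = sym (begin
    T k n ≡⟨ T-suc k n ⟩
    φ A (suc n) * walkCount A k + T (suc k) (suc n) ≡⟨ cong₂ _+_ (cong (_* walkCount A k) (proj₂ (φ-leading A))) (T-top (suc k)) ⟩
    + 1 * walkCount A k + + 0 ≡⟨ ℤₚ.+-identityʳ _ ⟩
    + 1 * walkCount A k ≡⟨ ℤₚ.*-identityˡ _ ⟩
    walkCount A k ∎)
    where open Resolvent A A-sym

  -- The numbers `T 0 l` are the coefficients of the resolvent sum. Since φ is monic, the count for
  -- k is the top entry of `T k`, and `T k`, φ and this count give `T (suc k)` through `T-zero` and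
  -- `T-suc`. So both sides run through the same recursion.
  walkCount-determined : ∀ {n} (A B : Mat n n) → Symmetric A → Symmetric B → φ A ≐ φ B →
    sumₚ (resolvent A) ≐ sumₚ (resolvent B) → ∀ k → walkCount A k ≡ walkCount B k
  walkCount-determined {zero} A B _ _ _ _ zero = refl
  walkCount-determined {zero} A B _ _ _ _ (suc k) = refl
  walkCount-determined {suc n} A B A-sym B-sym φ≐ r≐ k =
    trans (walkCount-from-T A A-sym k) (trans (T≡ k n) (sym (walkCount-from-T B B-sym k)))
    where
    module RA = Resolvent A A-sym
    module RB = Resolvent B B-sym
    T≡ : ∀ k l → RA.T k l ≡ RB.T k l
    count≡ : ∀ k → walkCount A k ≡ walkCount B k
    T≡ zero l = begin
      sum (λ i → + 1 * resolvent A i l) ≡⟨ sum-cong-≗ (λ i → ℤₚ.*-identityˡ (resolvent A i l)) ⟩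
      sum (λ i → resolvent A i l) ≡⟨ sym (sumₚ-coeff (resolvent A) l) ⟩
      sumₚ (resolvent A) l ≡⟨ r≐ l ⟩
      sumₚ (resolvent B) l ≡⟨ sumₚ-coeff (resolvent B) l ⟩
      sum (λ i → resolvent B i l) ≡⟨ sum-cong-≗ (λ i → sym (ℤₚ.*-identityˡ (resolvent B i l))) ⟩
      sum (λ i → + 1 * resolvent B i l) ∎
    T≡ (suc k) zero = begin
      RA.T (suc k) 0 ≡⟨ RA.T-zero k ⟩
      - φ A 0 * walkCount A k ≡⟨ cong₂ (λ x y → - x * y) (φ≐ 0) (count≡ k) ⟩
      - φ B 0 * walkCount B k ≡⟨ sym (RB.T-zero k) ⟩
      RB.T (suc k) 0 ∎
    T≡ (suc k) (suc l) = ∙-cancelˡ (φ A (suc l) * walkCount A k) _ _ (begin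
      φ A (suc l) * walkCount A k + RA.T (suc k) (suc l) ≡⟨ sym (RA.T-suc k l) ⟩
      RA.T k l ≡⟨ T≡ k l ⟩
      RB.T k l ≡⟨ RB.T-suc k l ⟩
      φ B (suc l) * walkCount B k + RB.T (suc k) (suc l) ≡⟨ cong₂ (λ x y → x * y + RB.T (suc k) (suc l)) (sym (φ≐ (suc l))) (sym (count≡ k)) ⟩
      φ A (suc l) * walkCount A k + RB.T (suc k) (suc l) ∎)
    count≡ k = trans (walkCount-from-T A A-sym k) (trans (T≡ k n) (sym (walkCount-from-T B B-sym k)))

  -- The theorem of Johnson and Newman

  adjMat-sym : ∀ {n} (H : Graph n) → Symmetric (adjMat H)
  adjMat-sym H i j = cong b2z (adj-sym H i j)

  adjMat-diag : ∀ {n} (H : Graph n) i → adjMat H i i ≡ + 0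
  adjMat-diag H i = cong b2z (adj-irrefl H i)

  Iₚ-diag : ∀ {n} (i : Fin n) → PL.I i i ≐ 1ₚ
  Iₚ-diag zero k = refl
  Iₚ-diag (suc i) k = Iₚ-diag i k

  Iₚ-off : ∀ {n} {i j : Fin n} → i ≢ j → PL.I i j ≐ 0ₚ
  Iₚ-off {i = zero} {zero} i≢j k = ⊥-elim (i≢j refl)
  Iₚ-off {i = zero} {suc j} i≢j k = refl
  Iₚ-off {i = suc i} {zero} i≢j k = refl
  Iₚ-off {i = suc i} {suc j} i≢j k = Iₚ-off (i≢j ∘ cong suc) k

  I-diag : ∀ {n} (i : Fin n) → I i i ≡ + 1
  I-diag zero = refl
  I-diag (suc i) = I-diag i

  I-off : ∀ {n} {i j : Fin n} → i ≢ j → I i j ≡ + 0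
  I-off {i = zero} {zero} i≢j = ⊥-elim (i≢j refl)
  I-off {i = zero} {suc j} i≢j = refl
  I-off {i = suc i} {zero} i≢j = refl
  I-off {i = suc i} {suc j} i≢j = I-off (i≢j ∘ cong suc)

  -- The local matrix of charPoly, named through unification.
  mutual
    charEntry : ∀ {n} → Graph n → Fin n → Fin n → Poly
    charEntry = _

    charPoly-det : ∀ {n} (H : Graph n) → charPoly H ≡ PL.det (charEntry H)
    charPoly-det H = refl

  charEntry≐charMat : ∀ {n} (H : Graph n) i j → charEntry H i j ≐ charMat (adjMat H) i j
  charEntry≐charMat H i j k with i Fin.≟ j
  ... | yes refl = cong (_+ - constP (adjMat H i i) k)
        (sym (trans (⊗-cong {X} (λ _ → refl) (Iₚ-diag i) k) (trans (⊗-comm X 1ₚ k) (⊗-identityˡ X k))))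
  ... | no i≢j = sym (trans (cong (_+ - constP (adjMat H i j) k)
        (trans (⊗-cong {X} (λ _ → refl) (Iₚ-off i≢j) k) (trans (⊗-comm X 0ₚ k) (⊗-zeroˡ X k)))) (ℤₚ.+-identityˡ _))

  charPoly≐φ : ∀ {n} (H : Graph n) → charPoly H ≐ φ (adjMat H)
  charPoly≐φ H = PL.det-cong (charEntry≐charMat H)

  adjMat-complement : ∀ {n} (H : Graph n) i j →
    adjMat (complement H) i j ≡ + 1 + - I i j + - adjMat H i j
  adjMat-complement H i j with i Fin.≟ j
  ... | yes refl = sym (cong₂ (λ x y → + 1 + - x + - y) (I-diag i) (adjMat-diag H i))
  ... | no i≢j = trans (b2z-not (adj H i j)) (sym (cong (λ x → + 1 + - x + - adjMat H i j) (I-off i≢j)))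
    where
    b2z-not : ∀ b → b2z (not b) ≡ + 1 + + 0 + - b2z b
    b2z-not true = refl
    b2z-not false = refl

  -- x I - A(H̄) = -((-x-1) I - A(H) + J) after the substitution x ↦ -x-1.
  Y : Poly
  Y = ⊖ (X ⊕ 1ₚ)

  open Substitution Y

  charMat-complement : ∀ {n} (H : Graph n) i j →
    Subst (charMat (adjMat (complement H)) i j) (⊖ (charMat (adjMat H) i j ⊕ (1ₚ ⊗ 1ₚ)))
  charMat-complement H i j = subst-resp {charMat (adjMat (complement H)) i j} rewrite-image
    (subst-⊕ {X ⊗ PL.I i j} {Y ⊗ PL.I i j} (subst-⊗ {X} {Y} subst-X (subst-I i j)) (subst-⊖ (subst-const (adjMat (complement H) i j))))
    where
    subst-I : ∀ {n} (i j : Fin n) → Subst (PL.I i j) (PL.I i j)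
    subst-I zero zero = subst-1
    subst-I zero (suc j) = subst-0
    subst-I (suc i) zero = subst-0
    subst-I (suc i) (suc j) = subst-I i j
    const-I : ∀ {n} (i j : Fin n) → constP (I i j) ≐ PL.I i j
    const-I zero zero k = sym (one≐const k)
    const-I zero (suc j) = const-0
    const-I (suc i) zero = const-0
    const-I (suc i) (suc j) = const-I i j
    constĀ : ∀ k → constP (adjMat (complement H) i j) k ≡ 1ₚ k + - PL.I i j k + - constP (adjMat H i j) k
    constĀ zero = trans (adjMat-complement H i j) (cong (λ z → + 1 + - z + - adjMat H i j) (const-I i j 0))
    constĀ (suc k) = cong (λ z → + 0 + - z + + 0) (const-I i j (suc k))
    YI : ∀ k → (Y ⊗ PL.I i j) k ≡ - ((X ⊗ PL.I i j) k + PL.I i j k)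
    YI k = begin
      ((⊖ (X ⊕ 1ₚ)) ⊗ PL.I i j) k ≡⟨ sym (-‿distribˡ-* (X ⊕ 1ₚ) (PL.I i j) k) ⟩
      - ((X ⊕ 1ₚ) ⊗ PL.I i j) k ≡⟨ cong -_ (⊗-distribʳ (PL.I i j) X 1ₚ k) ⟩
      - ((X ⊗ PL.I i j) k + (1ₚ ⊗ PL.I i j) k) ≡⟨ cong (λ z → - ((X ⊗ PL.I i j) k + z)) (⊗-identityˡ (PL.I i j) k) ⟩
      - ((X ⊗ PL.I i j) k + PL.I i j k) ∎
      where open import Algebra.Properties.Ring (CommutativeRing.ring polyRing) using (-‿distribˡ-*)
    rewrite-image : (Y ⊗ PL.I i j) ⊕ (⊖ constP (adjMat (complement H) i j)) ≐ ⊖ (charMat (adjMat H) i j ⊕ (1ₚ ⊗ 1ₚ))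
    rewrite-image k = begin
      (Y ⊗ PL.I i j) k + - constP (adjMat (complement H) i j) k
        ≡⟨ cong₂ (λ x y → x + - y) (YI k) (constĀ k) ⟩
      - ((X ⊗ PL.I i j) k + PL.I i j k) + - (1ₚ k + - PL.I i j k + - constP (adjMat H i j) k)
        ≡⟨ linear ((X ⊗ PL.I i j) k) (PL.I i j k) (1ₚ k) (constP (adjMat H i j) k) ⟩
      - (((X ⊗ PL.I i j) k + - constP (adjMat H i j) k) + 1ₚ k)
        ≡⟨ cong (λ z → - (charMat (adjMat H) i j k + z)) (sym (⊗-identityˡ 1ₚ k)) ⟩
      - (charMat (adjMat H) i j k + (1ₚ ⊗ 1ₚ) k) ∎
      where
      linear : ∀ x i o a → - (x + i) + - (o + - i + - a) ≡ - ((x + - a) + o)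
      linear = solve-∀

  -- The characteristic polynomial is monic, and its degree is the order.
  cospectral⇒same-order : ∀ {n m} (G : Graph n) (H : Graph m) → Cospectral G H → n ≡ m
  cospectral⇒same-order {n} {m} G H cosp with ℕₚ.<-cmp n m
  ... | tri≈ _ n≡m _ = n≡m
  ... | tri< n<m _ _ = ⊥-elim (0≢1 (trans (sym (proj₁ (φ-leading (adjMat G)) m n<m))
          (trans (sym (charPoly≐φ G m)) (trans (cosp m) (trans (charPoly≐φ H m) (proj₂ (φ-leading (adjMat H))))))))
    where
    0≢1 : + 0 ≢ + 1
    0≢1 ()
  ... | tri> _ _ m<n = ⊥-elim (1≢0 (trans (sym (proj₂ (φ-leading (adjMat G))))
          (trans (sym (charPoly≐φ G n)) (trans (cosp n) (trans (charPoly≐φ H n) (proj₁ (φ-leading (adjMat H)) n m<n))))))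
    where
    1≢0 : + 1 ≢ + 0
    1≢0 ()

  -- Substituting -x-1 in the polynomial of the complement gives det(xI - A + J) up to a sign that
  -- depends on n only. The rank one update J = e eᵀ contributes e·adj(xI - A)e, so the two spectra
  -- together determine the resolvent sum.
  cospectral⇒walkCount : ∀ {n} (G H : Graph n) → Cospectral G H → Cospectral (complement G) (complement H) →
    ∀ k → walkCount (adjMat G) k ≡ walkCount (adjMat H) k
  cospectral⇒walkCount {n} G H cosp cosp′ =
    walkCount-determined (adjMat G) (adjMat H) (adjMat-sym G) (adjMat-sym H) φ≐ resolvent≐
    where
    φ≐ : φ (adjMat G) ≐ φ (adjMat H)
    φ≐ k = trans (sym (charPoly≐φ G k)) (trans (cosp k) (charPoly≐φ H k))
    φ̄≐ : φ (adjMat (complement G)) ≐ φ (adjMat (complement H))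
    φ̄≐ k = trans (sym (charPoly≐φ (complement G) k)) (trans (cosp′ k) (charPoly≐φ (complement H) k))
    shifted : Graph n → Fin n → Fin n → Poly
    shifted K i j = charMat (adjMat K) i j ⊕ (1ₚ ⊗ 1ₚ)
    det-shifted : PL.det (shifted G) ≐ PL.det (shifted H)
    det-shifted = PL.det-neg-cancel (shifted G) (shifted H)
      (subst-functional φ̄≐ (subst-det (charMat-complement G)) (subst-det (charMat-complement H)))
    rank-one : ∀ K k → PL.det (shifted K) k ≡ φ (adjMat K) k + sumₚ (resolvent (adjMat K)) k
    rank-one K k = trans (PL.det-rank-one-update (charMat (adjMat K)) (λ _ → 1ₚ) (λ _ → 1ₚ) k)
      (cong (λ z → φ (adjMat K) k + z) (sumₚ-cong (λ j → ⊗-identityˡ (resolvent (adjMat K) j)) k))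
    resolvent≐ : sumₚ (resolvent (adjMat G)) ≐ sumₚ (resolvent (adjMat H))
    resolvent≐ k = ∙-cancelˡ (φ (adjMat G) k) _ _ (begin
      φ (adjMat G) k + sumₚ (resolvent (adjMat G)) k ≡⟨ sym (rank-one G k) ⟩
      PL.det (shifted G) k ≡⟨ det-shifted k ⟩
      PL.det (shifted H) k ≡⟨ rank-one H k ⟩
      φ (adjMat H) k + sumₚ (resolvent (adjMat H)) k ≡⟨ cong (λ z → z + sumₚ (resolvent (adjMat H)) k) (sym (φ≐ k)) ⟩
      φ (adjMat G) k + sumₚ (resolvent (adjMat H)) k ∎)

  -- Integer matrices modulo a prime

  ∣-sum : ∀ {n x} (t : Vect n) → (∀ i → x ∣ t i) → x ∣ sum t
  ∣-sum {zero} {x} t h = divides (+ 0) refl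
  ∣-sum {suc n} t h = ∣m∣n⇒∣m+n (h zero) (∣-sum (t ∘ suc) (h ∘ suc))

  ∣-resp : ∀ {x y z : ℤ} → y ≡ z → x ∣ y → x ∣ z
  ∣-resp refl h = h

  ∣0 : ∀ {x} → x ∣ + 0
  ∣0 = divides (+ 0) refl

  infixl 7 _⊛_
  _⊛_ : ∀ {n m} → Vect n → Mat n m → Vect m
  (x ⊛ M) j = sum (λ i → x i * M i j)

  ⊛-assoc : ∀ {n m k} (x : Vect n) (M : Mat n m) (N : Mat m k) j → ((x ⊛ M) ⊛ N) j ≡ (x ⊛ (M · N)) j
  ⊛-assoc x M N j = ·-assoc (λ (_ : Fin 1) → x) M N zero j

  ⊛-adjugate : ∀ {n} (x : Vect n) (M : Mat n n) j → ((x ⊛ M) ⊛ adjugate M) j ≡ det M * x j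
  ⊛-adjugate x M j = begin
    ((x ⊛ M) ⊛ adjugate M) j ≡⟨ ⊛-assoc x M (adjugate M) j ⟩
    sum (λ i → x i * (M · adjugate M) i j) ≡⟨ sum-cong-≗ (λ i → trans (cong (x i *_) (·-adjugate M i j)) (swap (x i) (det M) (I i j))) ⟩
    sum (λ i → det M * (x i * I i j)) ≡⟨ sym (*-distribˡ-sum (det M) (λ i → x i * I i j)) ⟩
    det M * sum (λ i → x i * I i j) ≡⟨ cong (det M *_) (sum-I x j) ⟩
    det M * x j ∎
    where
    swap : ∀ x d i → x * (d * i) ≡ d * (x * i)
    swap = solve-∀

  -- Transports coefficients along an index map, so that a relation between some walk vectors
  -- becomes one between all rows of `krylov`.
  push : ∀ {m n} → (Fin m → Fin n) → Vect m → Vect n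
  push ι a = a ⊛ (I ∘ ι)

  push-sum : ∀ {m n} (ι : Fin m → Fin n) (a : Vect m) (f : Vect n) → sum (λ c → push ι a c * f c) ≡ sum (λ i → a i * f (ι i))
  push-sum ι a f = begin
    ((a ⊛ (I ∘ ι)) ⊛ (λ c (_ : Fin 1) → f c)) zero ≡⟨ ⊛-assoc a (I ∘ ι) (λ c (_ : Fin 1) → f c) zero ⟩
    sum (λ i → a i * sum (λ c → I (ι i) c * f c)) ≡⟨ sum-cong-≗ (λ i → cong (a i *_) ((I· (λ c (_ : Fin 1) → f c)) (ι i) zero)) ⟩
    sum (λ i → a i * f (ι i)) ∎

  push-off : ∀ {m n} (ι : Fin m → Fin n) (a : Vect m) c → (∀ i → ι i ≢ c) → push ι a c ≡ + 0
  push-off ι a c off = sum-zero (λ i → trans (cong (a i *_) (I-off (off i))) (ℤₚ.*-zeroʳ (a i)))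

  push-on : ∀ {m n} (ι : Fin m → Fin n) → (∀ {i j} → ι i ≡ ι j → i ≡ j) → (a : Vect m) → ∀ i → push ι a (ι i) ≡ a i
  push-on {m} ι inj a i = begin
    sum (λ k → a k * I (ι k) (ι i)) ≡⟨ sum-cong-≗ (λ k → cong (a k *_) (I-ι k)) ⟩
    sum (λ k → a k * I k i) ≡⟨ sum-I a i ⟩
    a i ∎
    where
    I-ι : ∀ k → I (ι k) (ι i) ≡ I k i
    I-ι k with k Fin.≟ i
    ... | yes refl = trans (I-diag (ι k)) (sym (I-diag k))
    ... | no k≢i = trans (I-off (k≢i ∘ inj)) (sym (I-off k≢i))

  sum-single : ∀ {n} (t : Vect n) j → (∀ i → i ≢ j → t i ≡ + 0) → sum t ≡ t j
  sum-single {suc n} t j off = begin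
    sum t ≡⟨ sum-remove {i = j} t ⟩
    t j + sum (removeAt t j) ≡⟨ cong (λ z → t j + z) (sum-zero (λ i → off (punchIn j i) (punchInᵢ≢i j i))) ⟩
    t j + + 0 ≡⟨ ℤₚ.+-identityʳ (t j) ⟩
    t j ∎

  -- This is the identity matrix with row `j` replaced by `v` and moved to the front; of the unit
  -- vectors that make up `v`, all but the `j`-th repeat a row.
  det-replace : ∀ {n} (v : Vect (suc n)) j → det (v ∷ I ∘ punchIn j) ≡ v j * sgn j
  det-replace {n} v j = begin
    det (v ∷ I ∘ punchIn j)
      ≡⟨ det-cong {M = v ∷ I ∘ punchIn j} {(λ c → sum (λ i → v i * I i c)) ∷ I ∘ punchIn j} (λ { zero c → sym (sum-I v c) ; (suc r) c → refl }) ⟩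
    det ((λ c → sum (λ i → v i * I i c)) ∷ I ∘ punchIn j)
      ≡⟨ first-sum detForm v I (I ∘ punchIn j) ⟩
    sum (λ i → v i * det (I i ∷ I ∘ punchIn j))
      ≡⟨ sum-single (λ i → v i * det (I i ∷ I ∘ punchIn j)) j (λ i i≢j → trans (cong (v i *_) (repeated i i≢j)) (ℤₚ.*-zeroʳ (v i))) ⟩
    v j * det (I j ∷ I ∘ punchIn j)
      ≡⟨ cong (v j *_) (trans (move-first detForm I j) (trans (cong (sgn j *_) (det-I {suc n})) (ℤₚ.*-identityʳ (sgn j)))) ⟩
    v j * sgn j ∎
    where
    repeated : ∀ i → i ≢ j → det (I i ∷ I ∘ punchIn j) ≡ + 0
    repeated i i≢j = repeated-first detForm (I i) (I ∘ punchIn j) (punchOut (i≢j ∘ sym))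
      (λ c → cong (λ z → I z c) (punchIn-punchOut (i≢j ∘ sym)))

  sgn-square : ∀ {n} (j : Fin n) → sgn j * sgn j ≡ + 1
  sgn-square zero = refl
  sgn-square (suc j) = trans (neg-square (sgn j)) (sgn-square j)
    where
    neg-square : ∀ s → - s * - s ≡ s * s
    neg-square = solve-∀

  -- A submodule of the integer vectors, given by a predicate. With a divisibility condition as
  -- membership, as in `kernelˡ`, it plays the part of a subspace modulo p.
  record Subspace (n : ℕ) : Set₁ where
    field
      member : Vect n → Set
      resp : ∀ {u v} → (∀ j → u j ≡ v j) → member u → member v
      combine : ∀ x y {u v} → member u → member v → member (λ j → x * u j + y * v j)
  open Subspace

  insertSubspace : ∀ {n} → Fin (suc n) → Subspace (suc n) → Subspace n
  insertSubspace j Q .member v = member Q (insertAt v j (+ 0))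
  insertSubspace j Q .resp u≡v = resp Q (ZL.insert-cong j u≡v)
  insertSubspace j Q .combine x y qu qv =
    resp Q (λ c → sym (ZL.insert-lin x y j (λ i → refl) c)) (combine Q x y qu qv)

  module Modulo (p : ℕ) (p-prime : Prime p) where

    P : ℤ
    P = + p

    instance
      p-nonZero : ℕ.NonZero p
      p-nonZero = prime⇒nonZero p-prime

    euclid : ∀ {x y} → P ∣ x * y → P ∣ x ⊎ P ∣ y
    euclid {x} {y} h with euclidsLemma ℤ.∣ x ∣ ℤ.∣ y ∣ p-prime (subst (p ℕᵈ.∣_) (ℤₚ.abs-* x y) (∣⇒∣ᵤ h))
    ... | inj₁ h′ = inj₁ (∣ᵤ⇒∣ h′)
    ... | inj₂ h′ = inj₂ (∣ᵤ⇒∣ h′)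

    ∤-* : ∀ {x y} → ¬ P ∣ x → ¬ P ∣ y → ¬ P ∣ x * y
    ∤-* x∤ y∤ h with euclid h
    ... | inj₁ h′ = x∤ h′
    ... | inj₂ h′ = y∤ h′

    ∤⇒∣ʳ : ∀ {x y} → ¬ P ∣ x → P ∣ x * y → P ∣ y
    ∤⇒∣ʳ x∤ h with euclid h
    ... | inj₁ h′ = ⊥-elim (x∤ h′)
    ... | inj₂ h′ = h′

    ∣-square : ∀ {x} → P ∣ x * x → P ∣ x
    ∣-square h with euclid h
    ... | inj₁ h′ = h′
    ... | inj₂ h′ = h′

    P∤1 : ¬ P ∣ + 1
    P∤1 h = ℕₚ.<⇒≢ (ℕ.nonTrivial⇒n>1 p ⦃ prime⇒nonTrivial p-prime ⦄) (sym (ℕᵈ.∣1⇒≡1 (∣⇒∣ᵤ h)))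

    cancel-P : ∀ {x y} → P * x ∣ P * y → x ∣ y
    cancel-P = *-cancelˡ-∣ P

    power-coprime : ∀ k {x y} → ¬ P ∣ x → P ^ k ∣ x * y → P ^ k ∣ y
    power-coprime zero {y = y} x∤ h = divides y (sym (ℤₚ.*-identityʳ _))
    power-coprime (suc k) {x} {y} x∤ h with ∤⇒∣ʳ x∤ (∣-trans (divides (P ^ k) (ℤₚ.*-comm P (P ^ k))) h)
    ... | divides q refl = ∣-resp (ℤₚ.*-comm P q) (*-monoʳ-∣ P (power-coprime k x∤ (cancel-P (∣-resp (shuffle x q P) h))))
      where
      shuffle : ∀ x q p → x * (q * p) ≡ p * (x * q)
      shuffle = solve-∀

    product-∤ : ∀ {n} (d : Vect n) → (∀ i → ¬ P ∣ d i) → ¬ P ∣ product d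
    product-∤ {zero} d h = P∤1
    product-∤ {suc n} d h = ∤-* (h zero) (product-∤ (d ∘ suc) (h ∘ suc))

    -- Multiplication by the adjugate turns `x ⊛ M` into `det M` times `x`, and p does not divide
    -- `det M`.
    injective-mod : ∀ {n} (M : Mat n n) (x : Vect n) → ¬ P ∣ det M → (∀ j → P ∣ (x ⊛ M) j) → ∀ j → P ∣ x j
    injective-mod M x det∤ xM j = ∤⇒∣ʳ det∤ (∣-resp (⊛-adjugate x M j) (∣-sum _ (λ i → ∣m⇒∣m*n (adjugate M i j) (xM i))))

    injective-modʳ : ∀ {n} (M : Mat n n) (x : Vect n) → ¬ P ∣ det M → (∀ i → P ∣ sum (λ j → M i j * x j)) → ∀ j → P ∣ x j
    injective-modʳ M x det∤ Mx = injective-mod (M ᵀ) x (det∤ ∘ ∣-resp (det-transpose M))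
      (λ i → ∣-resp (sum-cong-≗ (λ j → ℤₚ.*-comm (M i j) (x j))) (Mx i))

    scaled-rows : ∀ {n} (d : Vect n) (M : Mat n n) → (∀ i j → d i ∣ M i j) → product d ∣ det M
    scaled-rows d M h = divides (det N) (begin
      det M ≡⟨ det-cong {N = λ i j → d i * N i j} (λ i j → trans (_∣_.equality (h i j)) (ℤₚ.*-comm (N i j) (d i))) ⟩
      det (λ i j → d i * N i j) ≡⟨ det-scale-rows d N ⟩
      product d * det N ≡⟨ ℤₚ.*-comm (product d) (det N) ⟩
      det N * product d ∎)
      where
      N : Mat _ _
      N i j = _∣_.quotient (h i j)

    first-rows : ∀ {n} k → k ≤ n → (M : Mat n n) → (∀ r → toℕ r < k → ∀ j → P ∣ M r j) → P ^ k ∣ det M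
    first-rows k k≤n M h = ∣-resp refl (subst (_∣ det M) (product-d k k≤n) (scaled-rows (d k) M (λ r → d-∣ k r M h)))
      where
      d : ℕ → ∀ {n} → Vect n
      d zero r = + 1
      d (suc k) zero = P
      d (suc k) (suc r) = d k r
      product-1 : ∀ n → product {n} (λ _ → + 1) ≡ + 1
      product-1 zero = refl
      product-1 (suc n) = trans (ℤₚ.*-identityˡ _) (product-1 n)
      product-d : ∀ {n} k → k ≤ n → product (d k {n}) ≡ P ^ k
      product-d {n} zero _ = product-1 n
      product-d (suc k) (s≤s k≤n) = cong (P *_) (product-d k k≤n)
      d-∣ : ∀ {n m} k (r : Fin n) (M : Mat n m) → (∀ r → toℕ r < k → ∀ j → P ∣ M r j) → ∀ j → d k r ∣ M r j
      d-∣ zero r M h j = divides (M r j) (sym (ℤₚ.*-identityʳ _))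
      d-∣ (suc k) zero M h j = h zero (s≤s z≤n) j
      d-∣ (suc k) (suc r) M h j = d-∣ k r (M ∘ suc) (λ r r<k → h (suc r) (s≤s r<k)) j

    scaleFrom : ℕ → ∀ {n} → Vect n
    scaleFrom zero r = P
    scaleFrom (suc t) zero = + 1
    scaleFrom (suc t) (suc r) = scaleFrom t r

    scaleFrom-cases : ∀ {n} t (r : Fin n) → (t ≤ toℕ r × scaleFrom t r ≡ P) ⊎ scaleFrom t r ≡ + 1
    scaleFrom-cases zero r = inj₁ (z≤n , refl)
    scaleFrom-cases (suc t) zero = inj₂ refl
    scaleFrom-cases (suc t) (suc r) with scaleFrom-cases t r
    ... | inj₁ (t≤r , eq) = inj₁ (s≤s t≤r , eq)
    ... | inj₂ eq = inj₂ eq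

    product-scaleFrom : ∀ {n} t → product (scaleFrom t {n}) ≡ P ^ (n ∸ t)
    product-scaleFrom {zero} zero = refl
    product-scaleFrom {zero} (suc t) = refl
    product-scaleFrom {suc n} zero = cong (P *_) (product-scaleFrom {n} zero)
    product-scaleFrom {suc n} (suc t) = trans (ℤₚ.*-identityˡ _) (product-scaleFrom {n} t)

    scaleFrom-∣ : ∀ {n} t (r : Fin n) {x} → (t ≤ toℕ r → P ∣ x) → scaleFrom t r ∣ x
    scaleFrom-∣ t r {x} h with scaleFrom t r | scaleFrom-cases t r
    ... | _ | inj₁ (t≤r , refl) = h t≤r
    ... | _ | inj₂ refl = divides x (sym (ℤₚ.*-identityʳ x))

    last-rows : ∀ {n} t → (M : Mat n n) → (∀ r → t ≤ toℕ r → ∀ j → P ∣ M r j) → P ^ (n ∸ t) ∣ det M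
    last-rows t M h = subst (_∣ det M) (product-scaleFrom t)
      (scaled-rows (scaleFrom t) M (λ r j → scaleFrom-∣ t r (λ t≤r → h r t≤r j)))

    NonZeroMod : ∀ {n} → Vect n → Set
    NonZeroMod x = Σ _ λ i → ¬ P ∣ x i

    zeroMod? : ∀ {n} (x : Vect n) → (∀ i → P ∣ x i) ⊎ NonZeroMod x
    zeroMod? x with all? (λ i → P ∣? x i)
    ... | yes h = inj₁ h
    ... | no h = inj₂ (¬∀⟶∃¬ _ _ (λ i → P ∣? x i) h)

    Dependent : ∀ {k n} → Mat k n → Set
    Dependent y = Σ (Vect _) λ a → NonZeroMod a × ∀ j → P ∣ (a ⊛ y) j

    -- What independence modulo p is used for. The first k rows of `T` come from combinations of the
    -- given vectors, not from the vectors themselves, which is why membership in `Q` is carried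
    -- along.
    Completable : ∀ {n} → ℕ → Subspace n → Set
    Completable {n} k Q = k ≤ n × Σ (Mat n n) λ T → ¬ P ∣ det T × ∀ r → toℕ r < k → member Q (T r)

    dependent-or-completable : ∀ {k n} (Q : Subspace n) (y : Mat k n) → (∀ i → member Q (y i)) →
      Dependent y ⊎ Completable k Q
    dependent-or-completable {zero} {n} Q y y∈Q =
      inj₂ (z≤n , I , (P∤1 ∘ ∣-resp (det-I {n})) , λ r ())
    dependent-or-completable {suc k} {n} Q y y∈Q with zeroMod? (y zero)
    ... | inj₁ y₀≡0 = inj₁ (((+ 1) ∷ λ _ → + 0) , (zero , P∤1) ,
          λ j → ∣-sum (λ i → ((+ 1) ∷ λ _ → + 0) i * y i j) (λ { zero → ∣n⇒∣m*n (+ 1) (y₀≡0 j) ; (suc i) → ∣0 }))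
    dependent-or-completable {suc k} {suc n} Q y y∈Q | inj₂ (j , π∤)
      with dependent-or-completable (insertSubspace j Q) z z∈Q
      where
      y′ : Mat k (suc n)
      y′ i c = y zero j * y (suc i) c + (- y (suc i) j) * y zero c
      z : Mat k n
      z i = y′ i ∘ punchIn j
      z∈Q : ∀ i → member Q (insertAt (z i) j (+ 0))
      z∈Q i = resp Q (λ c → sym (eq c)) (combine Q (y zero j) (- y (suc i) j) (y∈Q (suc i)) (y∈Q zero))
        where
        pivot : y′ i j ≡ + 0
        pivot = cancel (y zero j) (y (suc i) j)
          where
          cancel : ∀ a b → a * b + (- b) * a ≡ + 0
          cancel = solve-∀
        eq : ∀ c → insertAt (z i) j (+ 0) c ≡ y′ i c
        eq c = trans (sym (trans (cong (λ w → insertAt (z i) j (+ 0) c + w * I j c) pivot) (ℤₚ.+-identityʳ _)))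
                     (ZL.insert-split (y′ i) j c)
    ... | inj₁ (a , (i₀ , a∤) , az) = inj₁ (b , (suc i₀ , ∤-* π∤ a∤) , by)
      where
      b : Vect (suc k)
      -- The relation between the eliminated vectors, rewritten in the original ones; it stays
      -- nontrivial because p divides neither the pivot nor `a i₀`.
      b = (- sum (λ i → a i * y (suc i) j)) ∷ (λ i → y zero j * a i)
      y′ : Mat k (suc n)
      y′ i c = y zero j * y (suc i) c + (- y (suc i) j) * y zero c
      b⊛y : ∀ c → (a ⊛ y′) c ≡ (b ⊛ y) c
      b⊛y c = begin
        sum (λ i → a i * (y zero j * y (suc i) c + (- y (suc i) j) * y zero c))
          ≡⟨ sum-cong-≗ (λ i → split (a i) (y zero j) (y (suc i) c) (y (suc i) j) (y zero c)) ⟩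
        sum (λ i → - y zero c * (a i * y (suc i) j) + y zero j * a i * y (suc i) c)
          ≡⟨ ∑-distrib-+ (λ i → - y zero c * (a i * y (suc i) j)) (λ i → y zero j * a i * y (suc i) c) ⟩
        sum (λ i → - y zero c * (a i * y (suc i) j)) + sum (λ i → y zero j * a i * y (suc i) c)
          ≡⟨ cong (_+ sum (λ i → y zero j * a i * y (suc i) c))
               (trans (sym (*-distribˡ-sum (- y zero c) (λ i → a i * y (suc i) j))) (flip (y zero c) (sum (λ i → a i * y (suc i) j)))) ⟩
        - sum (λ i → a i * y (suc i) j) * y zero c + sum (λ i → y zero j * a i * y (suc i) c) ∎
        where
        split : ∀ a p u v w → a * (p * u + (- v) * w) ≡ - w * (a * v) + p * a * u
        split = solve-∀
        flip : ∀ u s → - u * s ≡ - s * u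
        flip = solve-∀
      by : ∀ c → P ∣ (b ⊛ y) c
      by c with c Fin.≟ j
      ... | yes refl = ∣-resp (b⊛y c) (∣-sum _ (λ i → ∣n⇒∣m*n (a i) (∣-resp (sym (cancel (y zero c) (y (suc i) c))) ∣0)))
        where
        cancel : ∀ a b → a * b + (- b) * a ≡ + 0
        cancel = solve-∀
      ... | no c≢j = ∣-resp (trans (cong (a ⊛ y′) (punchIn-punchOut (c≢j ∘ sym))) (b⊛y c)) (az (punchOut (c≢j ∘ sym)))
    ... | inj₂ (k≤n , T , T∤ , T∈Q) = inj₂ (s≤s k≤n , T′ , T′∤ , T′∈Q)
      where
      T′ : Mat (suc n) (suc n)
      T′ = y zero ∷ (λ r → insertAt (T r) j (+ 0))
      det-T′ : det T′ ≡ det T * (y zero j * sgn j)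
      det-T′ = begin
        det T′ ≡⟨ ZL.form-unique (ZL.restrict j (ZL.fixFirst (y zero) detForm)) T ⟩
        det T * det (y zero ∷ (λ r → insertAt (I r) j (+ 0)))
          ≡⟨ cong (det T *_) (trans (det-cong {M = y zero ∷ (λ r → insertAt (I r) j (+ 0))} {y zero ∷ I ∘ punchIn j} (λ { zero c → refl ; (suc r) c → ZL.insert-I j r c })) (det-replace (y zero) j)) ⟩
        det T * (y zero j * sgn j) ∎
      sgn∤ : ¬ P ∣ sgn j
      sgn∤ h = P∤1 (∣-resp (sgn-square j) (∣m⇒∣m*n (sgn j) h))
      T′∤ : ¬ P ∣ det T′
      T′∤ = ∤-* T∤ (∤-* π∤ sgn∤) ∘ ∣-resp det-T′
      T′∈Q : ∀ r → toℕ r < suc k → member Q (T′ r)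
      T′∈Q zero _ = y∈Q zero
      T′∈Q (suc r) (s≤s r<k) = T∈Q r r<k

    kernelˡ : ∀ {n m} → Mat n m → Subspace n
    kernelˡ M .member x = ∀ j → P ∣ (x ⊛ M) j
    kernelˡ M .resp u≡v h j = ∣-resp (sum-cong-≗ (λ i → cong (_* M i j) (u≡v i))) (h j)
    kernelˡ M .combine x y {u} {v} hu hv j = ∣-resp (sym eq) (∣m∣n⇒∣m+n (∣n⇒∣m*n x (hu j)) (∣n⇒∣m*n y (hv j)))
      where
      eq : ((λ i → x * u i + y * v i) ⊛ M) j ≡ x * (u ⊛ M) j + y * (v ⊛ M) j
      eq = trans (sum-cong-≗ (λ i → RingIdentities.lin-mulʳ ℤₚ.+-*-commutativeRing x (u i) y (v i) (M i j)))
                 (sum-lin x y (λ i → u i * M i j) (λ i → v i * M i j))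

    -- Otherwise a matrix `T` invertible modulo p would have k kernel rows, and the k rows of
    -- `T · M` divisible by p would give p^k ∣ det M.
    kernel-dependent : ∀ {k n} (M : Mat n n) (y : Mat k n) → (∀ i → member (kernelˡ M) (y i)) →
      ¬ P ^ k ∣ det M → Dependent y
    kernel-dependent {k} M y y∈ker ∤ with dependent-or-completable (kernelˡ M) y y∈ker
    ... | inj₁ dep = dep
    ... | inj₂ (k≤n , T , T∤ , T∈ker) = ⊥-elim (∤ (power-coprime k T∤
            (∣-resp (det-· T M) (first-rows k k≤n (T · M) T∈ker))))

    -- Independent vectors would give a matrix invertible modulo p that annihilates `u`.
    orthogonal-dependent : ∀ {n} (u : Vect n) (y : Mat n n) → NonZeroMod u → (∀ i → P ∣ sum (λ j → y i j * u j)) → Dependent y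
    orthogonal-dependent {n} u y (j , u∤) y⊥u with dependent-or-completable (kernelˡ (λ i (_ : Fin 1) → u i)) y (λ i _ → y⊥u i)
    ... | inj₁ dep = dep
    ... | inj₂ (_ , T , T∤ , T∈) = ⊥-elim (u∤ (injective-modʳ T u T∤ (λ r → T∈ r (toℕ<n r) zero) j))

  -- Krylov matrices

  dot : ∀ {n} → Vect n → Vect n → ℤ
  dot u v = sum (λ i → u i * v i)

  apply : ∀ {n} → Mat n n → Vect n → Vect n
  apply A v i = sum (λ j → A i j * v j)

  dot-comm : ∀ {n} (u v : Vect n) → dot u v ≡ dot v u
  dot-comm u v = sum-cong-≗ (λ i → ℤₚ.*-comm (u i) (v i))

  dot-congʳ : ∀ {n} (u : Vect n) {v v′ : Vect n} → (∀ i → v i ≡ v′ i) → dot u v ≡ dot u v′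
  dot-congʳ u eq = sum-cong-≗ (λ i → cong (u i *_) (eq i))

  dot-linʳ : ∀ {n} (u : Vect n) x y (v w : Vect n) → dot u (λ i → x * v i + y * w i) ≡ x * dot u v + y * dot u w
  dot-linʳ u x y v w = trans (sum-cong-≗ (λ i → RingIdentities.lin-scaleʳ ℤₚ.+-*-commutativeRing (u i) x (v i) y (w i)))
    (sum-lin x y (λ i → u i * v i) (λ i → u i * w i))

  apply-cong : ∀ {n} (A : Mat n n) {v v′ : Vect n} → (∀ i → v i ≡ v′ i) → ∀ i → apply A v i ≡ apply A v′ i
  apply-cong A eq i = dot-congʳ (A i) eq

  apply-lin : ∀ {n} (A : Mat n n) x y (v w : Vect n) i →
    apply A (λ i → x * v i + y * w i) i ≡ x * apply A v i + y * apply A w i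
  apply-lin A x y v w i = dot-linʳ (A i) x y v w

  dot-⊛ : ∀ {n m} (a : Vect m) (M : Mat m n) (v : Vect n) → dot (a ⊛ M) v ≡ sum (λ i → a i * dot (M i) v)
  dot-⊛ a M v = ⊛-assoc a M (λ j (_ : Fin 1) → v j) zero

  dot-apply : ∀ {n} (A : Mat n n) → Symmetric A → ∀ u v → dot (apply A u) v ≡ dot u (apply A v)
  dot-apply A A-sym u v = begin
    dot (apply A u) v ≡⟨ sum-cong-≗ (λ i → cong (_* v i) (sum-cong-≗ (λ j → trans (ℤₚ.*-comm (A i j) (u j)) (cong (u j *_) (A-sym i j))))) ⟩
    dot (u ⊛ A) v ≡⟨ dot-⊛ u A v ⟩
    dot u (apply A v) ∎

  apply-⊛ : ∀ {n m} (A : Mat n n) (a : Vect m) (M : Mat m n) r → apply A (a ⊛ M) r ≡ (a ⊛ (λ i → apply A (M i))) r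
  apply-⊛ A a M r = begin
    dot (A r) (a ⊛ M) ≡⟨ dot-comm (A r) (a ⊛ M) ⟩
    dot (a ⊛ M) (A r) ≡⟨ dot-⊛ a M (A r) ⟩
    sum (λ i → a i * dot (M i) (A r)) ≡⟨ sum-cong-≗ (λ i → cong (a i *_) (dot-comm (M i) (A r))) ⟩
    (a ⊛ (λ i → apply A (M i))) r ∎

  iterate-+ : ∀ {n} (A : Mat n n) k l v i → iterate A k (iterate A l v) i ≡ iterate A (k ℕ.+ l) v i
  iterate-+ A zero l v i = refl
  iterate-+ A (suc k) l v i = apply-cong A (iterate-+ A k l v) i

  iterate-cong : ∀ {n} (A : Mat n n) k {v v′ : Vect n} → (∀ i → v i ≡ v′ i) → ∀ i → iterate A k v i ≡ iterate A k v′ i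
  iterate-cong A zero eq = eq
  iterate-cong A (suc k) eq = apply-cong A (iterate-cong A k eq)

  iterate-lin : ∀ {n} (A : Mat n n) k x y (v w : Vect n) i →
    iterate A k (λ i → x * v i + y * w i) i ≡ x * iterate A k v i + y * iterate A k w i
  iterate-lin A zero x y v w i = refl
  iterate-lin A (suc k) x y v w i =
    trans (apply-cong A (iterate-lin A k x y v w) i) (apply-lin A x y (iterate A k v) (iterate A k w) i)

  dot-iterate : ∀ {n} (A : Mat n n) → Symmetric A → ∀ k u v → dot (iterate A k u) v ≡ dot u (iterate A k v)
  dot-iterate A A-sym zero u v = refl
  dot-iterate A A-sym (suc k) u v = begin
    dot (apply A (iterate A k u)) v ≡⟨ dot-apply A A-sym (iterate A k u) v ⟩
    dot (iterate A k u) (apply A v) ≡⟨ dot-iterate A A-sym k u (apply A v) ⟩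
    dot u (iterate A k (iterate A 1 v)) ≡⟨ dot-congʳ u (λ i → trans (iterate-+ A k 1 v i) (cong (λ z → iterate A z v i) (ℕₚ.+-comm k 1))) ⟩
    dot u (iterate A (suc k) v) ∎

  -- By symmetry of A the Gram matrix of the walk vectors is a Hankel matrix of walk counts, and
  -- these are the data shared by G and H.
  dot-walk : ∀ {n} (A : Mat n n) → Symmetric A → ∀ k l → dot (walk A k) (walk A l) ≡ walkCount A (k ℕ.+ l)
  dot-walk A A-sym k l = begin
    dot (walk A k) (walk A l) ≡⟨ dot-iterate A A-sym k (λ _ → + 1) (walk A l) ⟩
    dot (λ _ → + 1) (iterate A k (walk A l)) ≡⟨ sum-cong-≗ (λ i → trans (ℤₚ.*-identityˡ _) (iterate-+ A k l (λ _ → + 1) i)) ⟩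
    walkCount A (k ℕ.+ l) ∎

  -- Row c is A^c e, so that this is the transpose of the walk matrix.
  krylov : ∀ {n} → Mat n n → Mat n n
  krylov A c = walk A (toℕ c)

  -- Multiplication by x on coefficient vectors. The top coefficient falls off, which explains the
  -- condition `b (fromℕ n) ≡ + 0` in `shift-krylov`.
  shift : ∀ {n} → Vect n → Vect n
  shift v zero = + 0
  shift v (suc c) = v (inject₁ c)

  shift-krylov : ∀ {n} (A : Mat (suc n) (suc n)) (b : Vect (suc n)) → b (fromℕ n) ≡ + 0 →
    ∀ r → (shift b ⊛ krylov A) r ≡ apply A (b ⊛ krylov A) r
  shift-krylov {n} A b b-last r = begin
    + 0 * + 1 + sum (λ c → b (inject₁ c) * walk A (suc (toℕ c)) r)
      ≡⟨ ℤₚ.+-identityˡ _ ⟩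
    sum (λ c → b (inject₁ c) * walk A (suc (toℕ c)) r)
      ≡⟨ sum-cong-≗ (λ c → cong (λ z → b (inject₁ c) * walk A (suc z) r) (sym (toℕ-inject₁ c))) ⟩
    sum (λ c → b (inject₁ c) * walk A (suc (toℕ (inject₁ c))) r)
      ≡⟨ sym (ℤₚ.+-identityʳ _) ⟩
    sum (λ c → b (inject₁ c) * walk A (suc (toℕ (inject₁ c))) r) + + 0 * walk A (suc (toℕ (fromℕ n))) r
      ≡⟨ cong (λ z → sum (λ c → b (inject₁ c) * walk A (suc (toℕ (inject₁ c))) r) + z * walk A (suc (toℕ (fromℕ n))) r) (sym b-last) ⟩
    sum (λ c → b (inject₁ c) * walk A (suc (toℕ (inject₁ c))) r) + b (fromℕ n) * walk A (suc (toℕ (fromℕ n))) r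
      ≡⟨ sym (sum-init-last (λ c → b c * walk A (suc (toℕ c)) r)) ⟩
    sum (λ c → b c * walk A (suc (toℕ c)) r)
      ≡⟨ sym (apply-⊛ A b (krylov A) r) ⟩
    apply A (b ⊛ krylov A) r ∎

  shifts : ∀ {n} → ℕ → Vect n → Vect n
  shifts zero b = b
  shifts (suc s) b = shift (shifts s b)

  shifts-support : ∀ {n} t (b : Vect n) → (∀ c → t < toℕ c → b c ≡ + 0) →
    ∀ s c → s ℕ.+ t < toℕ c → shifts s b c ≡ + 0
  shifts-support t b supp zero c h = supp c h
  shifts-support t b supp (suc s) zero h = refl
  shifts-support t b supp (suc s) (suc c) (s≤s h) =
    shifts-support t b supp s (inject₁ c) (subst (s ℕ.+ t <_) (sym (toℕ-inject₁ c)) h)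

  shifts-at : ∀ {n} (b : Vect n) s c c₀ → toℕ c ≡ s ℕ.+ toℕ c₀ → shifts s b c ≡ b c₀
  shifts-at b zero c c₀ eq = cong b (Finₚ.toℕ-injective eq)
  shifts-at b (suc s) (suc c) c₀ eq = shifts-at b s (inject₁ c) c₀ (trans (toℕ-inject₁ c) (ℕₚ.suc-injective eq))

  module KrylovIndependence (p : ℕ) (p-prime : Prime p) where

    open Modulo p p-prime

    private
      truncate : ∀ {n} → ℕ → Vect n → Vect n
      truncate t a c with toℕ c ℕ.≤? t
      ... | yes _ = a c
      ... | no _ = + 0

      truncate-above : ∀ {n} t (a : Vect n) c → t < toℕ c → truncate t a c ≡ + 0
      truncate-above t a c t<c with toℕ c ℕ.≤? t
      ... | yes c≤t = ⊥-elim (ℕₚ.<⇒≱ t<c c≤t)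
      ... | no _ = refl

      truncate-at : ∀ {n} (a : Vect n) c → truncate (toℕ c) a c ≡ a c
      truncate-at a c with toℕ c ℕ.≤? toℕ c
      ... | yes _ = refl
      ... | no c≰c = ⊥-elim (c≰c ℕₚ.≤-refl)

      truncate-⊛ : ∀ {n m} t (a : Vect n) (M : Mat n m) → (∀ c → t < toℕ c → P ∣ a c) →
        ∀ r → P ∣ (a ⊛ M) r → P ∣ (truncate t a ⊛ M) r
      truncate-⊛ t a M high r h = ∣m+n∣m⇒∣n
        (∣-resp (trans (sum-cong-≗ (λ c → split (a c) (truncate t a c) (M c r)))
                       (∑-distrib-+ (λ c → (a c + - truncate t a c) * M c r) (λ c → truncate t a c * M c r))) h)
        (∣-sum (λ c → (a c + - truncate t a c) * M c r) (λ c → ∣m⇒∣m*n (M c r) (difference c)))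
        where
        split : ∀ a b m → a * m ≡ (a + - b) * m + b * m
        split = solve-∀
        difference : ∀ c → P ∣ a c + - truncate t a c
        difference c with toℕ c ℕ.≤? t
        ... | yes _ = ∣-resp (sym (ℤₚ.+-inverseʳ (a c))) ∣0
        ... | no c≰t = ∣-resp (sym (ℤₚ.+-identityʳ (a c))) (high c (ℕₚ.≰⇒> c≰t))

    -- Multiplying by x pushes the relation a up to degree n - 1; this replaces the rows from
    -- t on of the Krylov matrix by multiples of p, at the cost of a factor a_t ^ (n - t).
    krylov-top : ∀ {n} (A : Mat n n) (t : Fin n) → ¬ P ^ (n ∸ toℕ t) ∣ det (krylov A) → (a : Vect n) →
      (∀ c → toℕ t < toℕ c → P ∣ a c) → (∀ r → P ∣ (a ⊛ krylov A) r) → P ∣ a t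
    krylov-top {suc n} A t ∤ a high rel with P ∣? a t
    ... | yes h = h
    ... | no a∤ = ⊥-elim (∤ (power-coprime (suc n ∸ toℕ t) T∤
            (∣-resp (det-· T (krylov A)) (last-rows (toℕ t) (T · krylov A) rows))))
      where
      b : Vect (suc n)
      -- The coefficients above t are multiples of p; replacing them by 0 keeps the relation modulo
      -- p and makes `T` exactly triangular.
      b = truncate (toℕ t) a
      T : Mat (suc n) (suc n)
      T r with toℕ t ℕ.≤? toℕ r
      ... | yes _ = shifts (toℕ r ∸ toℕ t) b
      ... | no _ = I r
      T-lower : ∀ r c → toℕ r < toℕ c → T r c ≡ + 0
      T-lower r c r<c with toℕ t ℕ.≤? toℕ r
      ... | yes t≤r = shifts-support (toℕ t) b (truncate-above (toℕ t) a) (toℕ r ∸ toℕ t) c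
                        (subst (_< toℕ c) (sym (ℕₚ.m∸n+n≡m t≤r)) r<c)
      ... | no _ = I-off {i = r} {c} (λ { refl → ℕₚ.<-irrefl refl r<c })
      T-diag : ∀ r → ¬ P ∣ T r r
      T-diag r with toℕ t ℕ.≤? toℕ r
      ... | yes t≤r = a∤ ∘ ∣-resp (trans (shifts-at b (toℕ r ∸ toℕ t) r t (sym (ℕₚ.m∸n+n≡m t≤r))) (truncate-at a t))
      ... | no _ = P∤1 ∘ ∣-resp (I-diag r)
      T∤ : ¬ P ∣ det T
      T∤ = product-∤ (λ i → T i i) T-diag ∘ ∣-resp (det-lower-triangular T T-lower)
      shifted : ∀ s → s ℕ.+ toℕ t ≤ n → ∀ j → P ∣ (shifts s b ⊛ krylov A) j
      shifted zero _ j = truncate-⊛ (toℕ t) a (krylov A) high j (rel j)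
      shifted (suc s) h j = ∣-resp (sym (shift-krylov A (shifts s b)
          (shifts-support (toℕ t) b (truncate-above (toℕ t) a) s (fromℕ n) (subst (s ℕ.+ toℕ t <_) (sym (toℕ-fromℕ n)) h)) j))
        (∣-sum _ (λ i → ∣n⇒∣m*n (A j i) (shifted s (ℕₚ.<⇒≤ h) i)))
      rows : ∀ r → toℕ t ≤ toℕ r → ∀ j → P ∣ (T · krylov A) r j
      rows r t≤r j with toℕ t ℕ.≤? toℕ r
      ... | yes t≤r = shifted (toℕ r ∸ toℕ t) (subst (_≤ n) (sym (ℕₚ.m∸n+n≡m t≤r)) (ℕₚ.≤-pred (toℕ<n r))) j
      ... | no t≰r = ⊥-elim (t≰r t≤r)

    -- The coefficients are removed from the top. A relation with top index t - 1 has n - t + 1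
    -- shifts, itself included, each of which would contribute a factor p to the determinant;
    -- smaller top indices would contribute even more.
    krylov-independent : ∀ {n} (A : Mat n n) t → t ≤ n → ¬ P ^ suc (n ∸ t) ∣ det (krylov A) → (a : Vect n) →
      (∀ c → t ≤ toℕ c → P ∣ a c) → (∀ r → P ∣ (a ⊛ krylov A) r) → ∀ c → P ∣ a c
    krylov-independent A zero _ ∤ a high rel c = high c z≤n
    krylov-independent {n} A (suc t) t<n ∤ a high rel =
      krylov-independent A t (ℕₚ.<⇒≤ t<n) (λ h → ∤ (∣-trans (divides P refl) (subst (λ z → P ^ suc z ∣ det (krylov A)) (sym suc-∸) h))) a high′ rel
      where
      suc-∸ : suc (n ∸ suc t) ≡ n ∸ t
      suc-∸ = sym (ℕₚ.+-∸-assoc 1 t<n)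
      t′ : Fin n
      t′ = Fin.fromℕ< t<n
      t′≡ : toℕ t′ ≡ t
      t′≡ = Finₚ.toℕ-fromℕ< t<n
      high′ : ∀ c → t ≤ toℕ c → P ∣ a c
      high′ c t≤c with toℕ c ℕ.≟ t
      ... | yes c≡t = subst (λ z → P ∣ a z) (Finₚ.toℕ-injective (trans t′≡ (sym c≡t)))
            (krylov-top A t′ (∤ ∘ subst (λ z → P ^ z ∣ det (krylov A)) (trans (cong (n ∸_) t′≡) (sym suc-∸))) a
              (λ d t<d → high d (subst (_< toℕ d) t′≡ t<d)) rel)
      ... | no c≢t = high c (ℕₚ.≤∧≢⇒< t≤c (c≢t ∘ sym))

  -- Odd primes

  module OddPrime (p : ℕ) (p-prime : Prime p) where

    open Modulo p p-prime
    open KrylovIndependence p p-prime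

    kernel-vector-vanishes : ∀ {n} (A : Mat n n) → Symmetric A → ¬ P ^ 2 ∣ det (krylov A) → (u : Vect n) →
      (∀ k → P ∣ dot u (walk A k)) → (∀ k → P * P ∣ dot u (iterate A k u)) → ∀ r → P ∣ u r
    kernel-vector-vanishes {zero} A A-sym ∤ u uw uu ()
    kernel-vector-vanishes {suc n} A A-sym ∤ u uw uu with zeroMod? u
    ... | inj₁ u≡0 = u≡0
    ... | inj₂ u≢0 = ⊥-elim (contradiction eigen combination)
      where
      Au : Vect (suc n)
      Au = apply A u

      scalar∤ : ∀ {x} → (∀ r → P ∣ x * u r) → P ∣ x
      scalar∤ {x} h with P ∣? x
      ... | yes x≡0 = x≡0
      ... | no x∤ = ⊥-elim (proj₂ u≢0 (∤⇒∣ʳ x∤ (h (proj₁ u≢0))))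

      pair : Mat 2 (suc n)
      pair zero = u
      pair (suc i) = Au

      pair-kernel : ∀ i c → P ∣ dot (pair i) (walk A (toℕ c))
      pair-kernel zero c = uw (toℕ c)
      pair-kernel (suc i) c = subst (P ∣_) (sym (dot-apply A A-sym u (walk A (toℕ c)))) (uw (suc (toℕ c)))

      -- The eigenvalue is -α/β modulo p, kept as a fraction so that nothing is inverted.
      Eigen : Set
      Eigen = Σ ℤ λ α → Σ ℤ λ β → ¬ P ∣ β × ∀ r → P ∣ α * u r + β * Au r

      eigen : Eigen
      eigen = extract dependent
        where
        dependent : Dependent pair
        dependent = kernel-dependent {2} (krylov A ᵀ) pair pair-kernel (λ d → ∤ (subst (P ^ 2 ∣_) (det-transpose (krylov A)) d))
        extract : Dependent pair → Eigen
        extract (a , (i , a∤) , rel) = α , β , β∤ , rel′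
         where
          α β : ℤ
          α = a zero
          β = a (suc zero)
          rel′ : ∀ r → P ∣ α * u r + β * Au r
          rel′ r = ∣-resp (cong (λ z → α * u r + z) (ℤₚ.+-identityʳ (β * Au r))) (rel r)
          β∤ : ¬ P ∣ β
          β∤ β≡0 = a∤ (all-zero i)
            where
            all-zero : ∀ i → P ∣ a i
            all-zero zero = scalar∤ (λ r → ∣m+n∣m⇒∣n (∣-resp (ℤₚ.+-comm (α * u r) (β * Au r)) (rel′ r)) (∣m⇒∣m*n (Au r) β≡0))
            all-zero (suc zero) = β≡0

      lowerWalks : Mat n (suc n)
      lowerWalks i = krylov A (punchIn (fromℕ n) i)

      Combination : Set
      Combination = Σ ℤ λ κ → Σ (Vect n) λ g → ¬ P ∣ κ × ∀ r → P ∣ κ * u r + (g ⊛ lowerWalks) r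

      -- The vector u and all walk vectors but the last are orthogonal to u modulo p (u to itself by
      -- `uu 0`), and there are as many of them as the order, so they are dependent. The walk
      -- vectors alone are independent, whence κ is prime to p.
      combination : Combination
      combination with orthogonal-dependent u (u ∷ lowerWalks) u≢0
                         (λ { zero → ∣-trans (divides P refl) (uu 0)
                            ; (suc i) → ∣-resp (dot-comm u (lowerWalks i)) (uw (toℕ (punchIn (fromℕ n) i))) })
      ... | a , (i , a∤) , rel = a zero , a ∘ suc , κ∤ , rel
        where
        ĝ : Vect (suc n)
        ĝ = push (punchIn (fromℕ n)) (a ∘ suc)
        κ∤ : ¬ P ∣ a zero
        κ∤ κ≡0 = a∤ (all-zero i)
          where
          ĝ≡0 : ∀ c → P ∣ ĝ c
          ĝ≡0 = krylov-independent A n (ℕₚ.n≤1+n n) (∤ ∘ subst (λ z → P ^ suc z ∣ det (krylov A)) (ℕₚ.m+n∸n≡m 1 n)) ĝ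
            (λ c n≤c → ∣-resp (sym (push-off (punchIn (fromℕ n)) (a ∘ suc) c (λ i eq → punchInᵢ≢i (fromℕ n) i (trans eq (top c n≤c))))) ∣0)
            (λ r → ∣-resp (sym (push-sum (punchIn (fromℕ n)) (a ∘ suc) (λ c → krylov A c r)))
                     (∣m+n∣m⇒∣n (rel r) (∣m⇒∣m*n (u r) κ≡0)))
            where
            top : ∀ c → n ≤ toℕ c → c ≡ fromℕ n
            top c n≤c = Finₚ.toℕ-injective (trans (ℕₚ.≤-antisym (ℕₚ.≤-pred (toℕ<n c)) n≤c) (sym (toℕ-fromℕ n)))
          all-zero : ∀ i → P ∣ a i
          all-zero zero = κ≡0
          all-zero (suc i) = ∣-resp (push-on (punchIn (fromℕ n)) (Finₚ.punchIn-injective (fromℕ n) _ _) (a ∘ suc) i)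
            (ĝ≡0 (punchIn (fromℕ n) i))

      contradiction : Eigen → Combination → ⊥
      contradiction (α , β , β∤ , αβ) (κ , g , κ∤ , κg) = κ∤ (scalar∤ κu)
        where
        last : Fin (suc n)
        last = fromℕ n
        γ v : Vect (suc n)
        γ r = _∣_.quotient (αβ r)
        v r = _∣_.quotient (κg r)
        γ-eq : ∀ r → α * u r + β * Au r ≡ P * γ r
        γ-eq r = trans (_∣_.equality (αβ r)) (ℤₚ.*-comm (γ r) P)
        v-eq : ∀ r → κ * u r + (g ⊛ lowerWalks) r ≡ P * v r
        v-eq r = trans (_∣_.equality (κg r)) (ℤₚ.*-comm (v r) P)

        dot-γ : ∀ x → α * dot x u + β * dot x Au ≡ P * dot x γ
        dot-γ x = trans (sym (dot-linʳ x α β u Au)) (trans (dot-congʳ x γ-eq) (trans (sum-cong-≗ (λ i → swap (x i) P (γ i))) (sym (*-distribˡ-sum P (λ i → x i * γ i)))))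
          where
          swap : ∀ x p g → x * (p * g) ≡ p * (x * g)
          swap = solve-∀

        -- Divisibility of u·u and u·Au by p² is used in full: one factor p is spent on the p in
        -- front of γ.
        γ⊥u : P ∣ dot u γ
        γ⊥u = cancel-P (∣-resp (dot-γ u) (∣m∣n⇒∣m+n (∣n⇒∣m*n α (uu 0)) (∣n⇒∣m*n β (uu 1))))

        -- h is (βx + α) g. Since g(A)e = p v - κ u and (βA + α)u = p γ, the vector h(A)e is p y
        -- with y = (βA + α)v - κ γ.
        ĝ h y : Vect (suc n)
        ĝ = push (punchIn last) g
        h c = β * shift ĝ c + α * ĝ c
        y r = β * apply A v r + (α * v r + - (κ * γ r))

        ĝ-last : ĝ last ≡ + 0
        ĝ-last = push-off (punchIn last) g last (punchInᵢ≢i last)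

        ĝ⊛ : ∀ r → (ĝ ⊛ krylov A) r ≡ P * v r + - κ * u r
        ĝ⊛ r = trans (push-sum (punchIn last) g (λ c → krylov A c r)) (trans (solve-for (κ * u r) ((g ⊛ lowerWalks) r)) (trans (cong (_+ - (κ * u r)) (v-eq r)) (cong (λ z → P * v r + z) (ℤₚ.neg-distribˡ-* κ (u r)))))
          where
          solve-for : ∀ a b → b ≡ (a + b) + - a
          solve-for = solve-∀

        h⊛ : ∀ r → (h ⊛ krylov A) r ≡ P * y r
        h⊛ r = begin
          (h ⊛ krylov A) r
            ≡⟨ trans (sum-cong-≗ (λ c → RingIdentities.lin-mulʳ ℤₚ.+-*-commutativeRing β (shift ĝ c) α (ĝ c) (krylov A c r)))
                     (sum-lin β α (λ c → shift ĝ c * krylov A c r) (λ c → ĝ c * krylov A c r)) ⟩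
          β * (shift ĝ ⊛ krylov A) r + α * (ĝ ⊛ krylov A) r
            ≡⟨ cong₂ (λ a b → β * a + α * b)
                 (trans (shift-krylov A ĝ ĝ-last r) (trans (apply-cong A ĝ⊛ r) (apply-lin A P (- κ) v u r))) (ĝ⊛ r) ⟩
          β * (P * apply A v r + - κ * Au r) + α * (P * v r + - κ * u r)
            ≡⟨ collect β P (apply A v r) κ (Au r) α (v r) (u r) ⟩
          P * (β * apply A v r + α * v r) + - κ * (α * u r + β * Au r)
            ≡⟨ cong (λ z → P * (β * apply A v r + α * v r) + - κ * z) (γ-eq r) ⟩
          P * (β * apply A v r + α * v r) + - κ * (P * γ r)
            ≡⟨ collect′ P (β * apply A v r) (α * v r) κ (γ r) ⟩
          P * y r ∎
          where
          collect : ∀ b p av k au a v u → b * (p * av + - k * au) + a * (p * v + - k * u) ≡ p * (b * av + a * v) + - k * (a * u + b * au)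
          collect = solve-∀
          collect′ : ∀ p x y k g → p * (x + y) + - k * (p * g) ≡ p * (x + (y + - (k * g)))
          collect′ = solve-∀

        -- Symmetry moves βA + α from v to u, where it produces p γ; the remaining term is a
        -- multiple of u·γ.
        y⊥u : P ∣ dot y u
        y⊥u = ∣-resp (sym eq) (∣m∣n⇒∣m+n (∣m⇒∣m*n (dot v γ) ∣-refl) (∣m⇒∣-m (∣n⇒∣m*n κ γ⊥u)))
          where
          eq : dot y u ≡ P * dot v γ + - (κ * dot u γ)
          eq = begin
            dot y u ≡⟨ dot-comm y u ⟩
            dot u y ≡⟨ trans (sum-cong-≗ (λ i → expand (u i) β (apply A v i) α (v i) κ (γ i)))
                             (∑-distrib-+ (λ i → u i * (β * apply A v i + α * v i)) (λ i → - κ * (u i * γ i))) ⟩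
            dot u (λ i → β * apply A v i + α * v i) + sum (λ i → - κ * (u i * γ i))
              ≡⟨ cong₂ _+_ (dot-linʳ u β α (apply A v) v) (sym (*-distribˡ-sum (- κ) (λ i → u i * γ i))) ⟩
            β * dot u (apply A v) + α * dot u v + - κ * dot u γ
              ≡⟨ cong₂ _+_ (trans (ℤₚ.+-comm (β * dot u (apply A v)) (α * dot u v))
                   (cong₂ (λ a b → α * a + β * b) (dot-comm u v) (trans (sym (dot-apply A A-sym u v)) (dot-comm Au v)))) (sym (ℤₚ.neg-distribˡ-* κ (dot u γ))) ⟩
            α * dot v u + β * dot v Au + - (κ * dot u γ) ≡⟨ cong (_+ - (κ * dot u γ)) (dot-γ v) ⟩
            P * dot v γ + - (κ * dot u γ) ∎
            where
            expand : ∀ u b av a v k g → u * (b * av + (a * v + - (k * g))) ≡ u * (b * av + a * v) + - k * (u * g)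
            expand = solve-∀

        -- All rows are orthogonal modulo p to u, which is nonzero modulo p.
        det-N : P ∣ det (y ∷ lowerWalks)
        det-N with P ∣? det (y ∷ lowerWalks)
        ... | yes d = d
        ... | no d∤ = ⊥-elim (proj₂ u≢0 (injective-modʳ (y ∷ lowerWalks) u d∤
                (λ { zero → y⊥u ; (suc i) → ∣-resp (dot-comm u (lowerWalks i)) (uw (toℕ (punchIn last i))) }) (proj₁ u≢0)))

        det-hK : h last * sgn last * det (krylov A) ≡ P * det (y ∷ lowerWalks)
        det-hK = begin
          h last * sgn last * det (krylov A) ≡⟨ cong (_* det (krylov A)) (sym (det-replace h last)) ⟩
          det (h ∷ I ∘ punchIn last) * det (krylov A) ≡⟨ sym (det-· (h ∷ I ∘ punchIn last) (krylov A)) ⟩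
          det ((h ∷ I ∘ punchIn last) · krylov A)
            ≡⟨ det-cong {M = (h ∷ I ∘ punchIn last) · krylov A} {(λ r → + 0 + P * y r) ∷ lowerWalks}
                 (λ { zero r → trans (h⊛ r) (sym (ℤₚ.+-identityˡ (P * y r))) ; (suc i) r → (I· krylov A) (punchIn last i) r }) ⟩
          det ((λ r → + 0 + P * y r) ∷ lowerWalks) ≡⟨ first-add detForm P (λ _ → + 0) y lowerWalks ⟩
          det ((λ _ → + 0) ∷ lowerWalks) + P * det (y ∷ lowerWalks) ≡⟨ cong (_+ P * det (y ∷ lowerWalks)) (first-zero detForm lowerWalks) ⟩
          + 0 + P * det (y ∷ lowerWalks) ≡⟨ ℤₚ.+-identityˡ _ ⟩
          P * det (y ∷ lowerWalks) ∎

        -- Exchanging the last walk vector for h(A)e = p y multiplies the determinant by `h last` up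
        -- to sign. The result is divisible by p², one factor from p y and one from `det-N`, but det
        -- W is not.
        h-last : P ∣ h last
        h-last with P ∣? h last
        ... | yes d = d
        ... | no h∤ = ⊥-elim (∤ (power-coprime 2 (∤-* h∤ (λ s → P∤1 (∣-resp (sgn-square last) (∣m⇒∣m*n (sgn last) s))))
                (∣-resp (sym det-hK) (∣-resp refl (subst (_∣ P * det (y ∷ lowerWalks)) (cong (P *_) (sym (ℤₚ.*-identityʳ P))) (*-monoʳ-∣ P det-N))))))

        h≡0 : ∀ c → P ∣ h c
        h≡0 = krylov-independent A n (ℕₚ.n≤1+n n) (∤ ∘ subst (λ z → P ^ suc z ∣ det (krylov A)) (ℕₚ.m+n∸n≡m 1 n)) h
          (λ c n≤c → subst (λ z → P ∣ h z) (sym (Finₚ.toℕ-injective (trans (ℕₚ.≤-antisym (ℕₚ.≤-pred (toℕ<n c)) n≤c) (sym (toℕ-fromℕ n))))) h-last)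
          (λ r → ∣-resp (sym (h⊛ r)) (∣m⇒∣m*n (y r) ∣-refl))

        -- h = (βx + α) g vanishes modulo p, and β is prime to p: the coefficients of g are peeled
        -- off downwards from `ĝ last`, which is 0. What is left of the combination is κ u, a
        -- contradiction.
        ĝ≡0 : ∀ c → P ∣ ĝ c
        ĝ≡0 = >-weakInduction (λ c → P ∣ ĝ c) (∣-resp (sym ĝ-last) ∣0)
          (λ c d → ∤⇒∣ʳ β∤ (∣m+n∣m⇒∣n (∣-resp (ℤₚ.+-comm (β * ĝ (inject₁ c)) (α * ĝ (suc c))) (h≡0 (suc c))) (∣n⇒∣m*n α d)))

        κu : ∀ r → P ∣ κ * u r
        κu r = ∣m+n∣m⇒∣n (∣-resp (ℤₚ.+-comm (κ * u r) ((g ⊛ lowerWalks) r)) (κg r))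
          (∣-resp (push-sum (punchIn last) g (λ c → krylov A c r)) (∣-sum _ (λ c → ∣m⇒∣m*n (krylov A c r) (ĝ≡0 c))))

  -- The prime 2

  ∣-difference : ∀ {n x} (s t : Vect n) → (∀ i → x ∣ s i + - t i) → x ∣ sum s + - sum t
  ∣-difference {x = x} s t h = ∣-resp (trans (∑-distrib-+ s (λ i → - t i)) (cong (λ z → sum s + z) (sum-neg t))) (∣-sum (λ i → s i + - t i) h)

  -- Off-diagonal entries come in equal pairs, which gains a factor 2 over the entries themselves.
  symmetric-sum : ∀ {n} x (f : Mat n n) → Symmetric f → (∀ i j → x ∣ f i j) →
    + 2 * x ∣ sum (λ i → sum (f i)) + - sum (λ i → f i i)
  symmetric-sum {zero} x f f-sym xf = divides (+ 0) refl
  symmetric-sum {suc n} x f f-sym xf = ∣-resp (sym eq)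
    (∣m∣n⇒∣m+n (*-monoʳ-∣ (+ 2) x∣s)
               (symmetric-sum x (λ i j → f (suc i) (suc j)) (λ i j → f-sym (suc i) (suc j)) (λ i j → xf (suc i) (suc j))))
    where
    s D R : ℤ
    s = sum (λ j → f zero (suc j))
    D = sum (λ i → f (suc i) (suc i))
    R = sum (λ i → sum (λ j → f (suc i) (suc j)))
    x∣s : x ∣ s
    x∣s = ∣-sum _ (λ j → xf zero (suc j))
    eq : f zero zero + s + sum (λ i → f (suc i) zero + sum (λ j → f (suc i) (suc j))) + - (f zero zero + D)
       ≡ + 2 * s + (R + - D)
    eq = trans (cong (λ z → f zero zero + s + z + - (f zero zero + D))
           (trans (∑-distrib-+ (λ i → f (suc i) zero) (λ i → sum (λ j → f (suc i) (suc j))))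
                  (cong (_+ R) (sum-cong-≗ (λ i → f-sym (suc i) zero)))))
         (rearrange (f zero zero) s R D)
      where
      rearrange : ∀ a s r d → a + s + (s + r) + - (a + d) ≡ + 2 * s + (r + - d)
      rearrange = solve-∀

  2∣x*x-x : ∀ x → + 2 ∣ x * x + - x
  2∣x*x-x x with x ℤ.%ℕ 2 | ℤᵈ.n%ℕd<d x 2 | ℤᵈ.a≡a%ℕn+[a/ℕn]*n x 2
  ... | zero | _ | eq = subst (λ z → + 2 ∣ z * z + - z) (sym eq) (divides ((x ℤ./ℕ 2) * (x ℤ./ℕ 2) * + 2 + - (x ℤ./ℕ 2)) (even (x ℤ./ℕ 2)))
    where
    even : ∀ q → (+ 0 + q * + 2) * (+ 0 + q * + 2) + - (+ 0 + q * + 2) ≡ (q * q * + 2 + - q) * + 2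
    even = solve-∀
  ... | suc zero | _ | eq = subst (λ z → + 2 ∣ z * z + - z) (sym eq) (divides ((x ℤ./ℕ 2) * (x ℤ./ℕ 2) * + 2 + (x ℤ./ℕ 2)) (odd (x ℤ./ℕ 2)))
    where
    odd : ∀ q → (+ 1 + q * + 2) * (+ 1 + q * + 2) + - (+ 1 + q * + 2) ≡ (q * q * + 2 + q) * + 2
    odd = solve-∀
  ... | suc (suc _) | s≤s (s≤s ()) | _

  dot-self-even : ∀ {n} (A : Mat n n) → Symmetric A → (∀ i → A i i ≡ + 0) → ∀ v → + 2 ∣ dot v (apply A v)
  dot-self-even A A-sym A-diag v = ∣-resp eq (symmetric-sum (+ 1) f (λ i j → trans (cong (λ z → v i * (z * v j)) (A-sym i j)) (swap (v i) (A j i) (v j))) (λ i j → divides (f i j) (sym (ℤₚ.*-identityʳ (f i j)))))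
    where
    f : Mat _ _
    f i j = v i * (A i j * v j)
    swap : ∀ x a y → x * (a * y) ≡ y * (a * x)
    swap = solve-∀
    eq : sum (λ i → sum (f i)) + - sum (λ i → f i i) ≡ dot v (apply A v)
    eq = begin
      sum (λ i → sum (f i)) + - sum (λ i → f i i)
        ≡⟨ cong (λ z → sum (λ i → sum (f i)) + - z) (sum-zero (λ i → trans (cong (λ z → v i * (z * v i)) (A-diag i)) (ℤₚ.*-zeroʳ (v i)))) ⟩
      sum (λ i → sum (f i)) + + 0 ≡⟨ ℤₚ.+-identityʳ _ ⟩
      sum (λ i → sum (f i)) ≡⟨ sum-cong-≗ (λ i → sym (*-distribˡ-sum (v i) (λ j → A i j * v j))) ⟩
      dot v (apply A v) ∎

  half : ∀ k → Σ ℕ λ j → (k ≡ j ℕ.+ j) ⊎ (k ≡ suc (j ℕ.+ j))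
  half zero = zero , inj₁ refl
  half (suc k) with half k
  ... | j , inj₁ eq = j , inj₂ (cong suc eq)
  ... | j , inj₂ eq = suc j , inj₁ (trans (cong suc eq) (cong suc (sym (ℕₚ.+-suc j j))))

  -- For k = 2j + 1 the count is the value at A^j e of the quadratic form of A, which is even as the
  -- diagonal is zero. For k = 2j it is the sum of the squares of the entries of A^j e, hence
  -- congruent modulo 2 to the count for j.
  walkCount-even : ∀ {n} (A : Mat n n) → Symmetric A → (∀ i → A i i ≡ + 0) → ∀ k → 1 ≤ k → + 2 ∣ walkCount A k
  walkCount-even A A-sym A-diag k 1≤k = go k k ℕₚ.≤-refl 1≤k
    where
    -- Halving k is not structural, so the recursion runs on a bound `b`.
    go : ∀ b k → k ≤ b → 1 ≤ k → + 2 ∣ walkCount A k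
    go b k k≤b 1≤k with half k
    ... | j , inj₂ refl = ∣-resp (trans (dot-walk A A-sym j (suc j)) (cong (walkCount A) (ℕₚ.+-suc j j))) (dot-self-even A A-sym A-diag (walk A j))
    go (suc b) k k≤b 1≤k | suc j , inj₁ refl =
      ∣m+n∣m⇒∣n (∣-resp (recombine (walkCount A (suc j ℕ.+ suc j)) (walkCount A (suc j))) (∣m∣n⇒∣m+n square (go b (suc j) j≤b (s≤s z≤n)))) ∣0
      where
      j≤b : suc j ≤ b
      j≤b = ℕₚ.≤-trans (ℕₚ.m≤n+m (suc j) j) (ℕₚ.≤-pred k≤b)
      square : + 2 ∣ walkCount A (suc j ℕ.+ suc j) + - walkCount A (suc j)
      square = ∣-resp (cong (_+ - walkCount A (suc j)) (dot-walk A A-sym (suc j) (suc j)))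
        (∣-difference (λ i → walk A (suc j) i * walk A (suc j) i) (walk A (suc j)) (λ i → 2∣x*x-x (walk A (suc j) i)))
      recombine : ∀ a b → a + - b + b ≡ + 0 + a
      recombine = solve-∀

  walkCount-zero : ∀ {n} (A : Mat n n) → walkCount A 0 ≡ + n
  walkCount-zero {zero} A = refl
  walkCount-zero {suc n} A = cong (λ z → + 1 + z) (walkCount-zero {n} (λ i j → A (suc i) (suc j)))

  module EvenPrime where

    open Modulo 2 prime[2]
    open KrylovIndependence 2 prime[2]

    kernel-vector-vanishes : ∀ {n} (A : Mat n n) → Symmetric A → (∀ i → A i i ≡ + 0) →
      ∀ δ m c → δ ≤ 1 → n ≡ δ ℕ.+ (m ℕ.+ m) → det (krylov A) ≡ P ^ m * c → ¬ P ∣ c → (u : Vect n) →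
      (∀ k → P ∣ dot u (walk A k)) → (∀ k → P * P ∣ dot u (iterate A k u)) → ∀ r → P ∣ u r
    kernel-vector-vanishes {n} A A-sym A-diag δ m c δ≤1 n≡ det≡ c∤ u uw uu = conclude dependent
      where
      τ : ℕ → ℤ
      τ = walkCount A

      -- `τ 0` is the order, which is even precisely for δ = 0. This is why the walk vectors in use
      -- start at A^δ e.
      τ-even : ∀ k → δ ≤ k → P ∣ τ k
      τ-even (suc k) _ = walkCount-even A A-sym A-diag (suc k) (s≤s z≤n)
      τ-even zero z≤n = ∣-resp (trans (cong +_ (trans (double m) (sym n≡))) (sym (walkCount-zero A))) (∣ᵤ⇒∣ (ℕᵈ.divides m refl))
        where
        double : ∀ m → m ℕ.* 2 ≡ m ℕ.+ m
        double m = trans (ℕₚ.*-comm m 2) (cong (m ℕ.+_) (ℕₚ.+-identityʳ m))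

      P^-nonZero : ∀ k → ℤ.NonZero (P ^ k)
      P^-nonZero zero = _
      P^-nonZero (suc k) = ℤₚ.i*j≢0 P (P ^ k) ⦃ _ ⦄ ⦃ P^-nonZero k ⦄

      ∤-det : ¬ P ^ suc m ∣ det (krylov A)
      ∤-det h = c∤ (*-cancelˡ-∣ (P ^ m) ⦃ P^-nonZero m ⦄ (∣-resp det≡ (subst (_∣ det (krylov A)) (ℤₚ.*-comm P (P ^ m)) h)))

      upper : Mat m n
      upper i = walk A (δ ℕ.+ toℕ i)

      vectors : Mat (suc m) n
      vectors = u ∷ upper

      vectors-kernel : ∀ i c → P ∣ dot (vectors i) (walk A (toℕ c))
      vectors-kernel zero c = uw (toℕ c)
      vectors-kernel (suc i) c = ∣-resp (sym (dot-walk A A-sym (δ ℕ.+ toℕ i) (toℕ c)))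
        (τ-even _ (ℕₚ.≤-trans (ℕₚ.m≤m+n δ (toℕ i)) (ℕₚ.m≤m+n _ (toℕ c))))

      -- The m vectors `upper` and u lie in the left kernel of W modulo 2, and m + 1 independent
      -- ones would force 2^(m+1) ∣ det W.
      dependent : Dependent vectors
      dependent = kernel-dependent {suc m} (krylov A ᵀ) vectors vectors-kernel
        (λ d → ∤-det (subst (P ^ suc m ∣_) (det-transpose (krylov A)) d))

      position : Fin m → Fin n
      position i = Fin.fromℕ< {δ ℕ.+ toℕ i} (subst (δ ℕ.+ toℕ i <_) (sym n≡) (ℕₚ.+-monoʳ-< δ (ℕₚ.≤-trans (toℕ<n i) (ℕₚ.m≤m+n m m))))

      toℕ-position : ∀ i → toℕ (position i) ≡ δ ℕ.+ toℕ i
      toℕ-position i = Finₚ.toℕ-fromℕ< _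

      position-injective : ∀ {i j} → position i ≡ position j → i ≡ j
      position-injective {i} {j} eq = Finₚ.toℕ-injective
        (ℕₚ.+-cancelˡ-≡ δ _ _ (trans (sym (toℕ-position i)) (trans (cong toℕ eq) (toℕ-position j))))

      -- In the diagonal sum a_i² is multiplied by a Gram entry in column 2(δ + i). The largest such
      -- index, 2(δ + m - 1), lies below n = δ + 2m because δ ≤ 1.
      doubled : Fin m → Fin n
      doubled i = Fin.fromℕ< {(δ ℕ.+ toℕ i) ℕ.+ (δ ℕ.+ toℕ i)} (subst (_ <_) (sym n≡) bound)
        where
        bound : (δ ℕ.+ toℕ i) ℕ.+ (δ ℕ.+ toℕ i) < δ ℕ.+ (m ℕ.+ m)
        bound = subst (_< δ ℕ.+ (m ℕ.+ m)) (sym (ℕₚ.+-assoc δ (toℕ i) (δ ℕ.+ toℕ i)))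
          (ℕₚ.+-monoʳ-< δ (ℕₚ.+-mono-<-≤ (toℕ<n i) (ℕₚ.≤-trans (ℕₚ.+-monoˡ-≤ (toℕ i) δ≤1) (toℕ<n i))))

      toℕ-doubled : ∀ i → toℕ (doubled i) ≡ (δ ℕ.+ toℕ i) ℕ.+ (δ ℕ.+ toℕ i)
      toℕ-doubled i = Finₚ.toℕ-fromℕ< _

      doubled-injective : ∀ {i j} → doubled i ≡ doubled j → i ≡ j
      doubled-injective {i} {j} eq = Finₚ.toℕ-injective (ℕₚ.+-cancelˡ-≡ δ _ _ (halve _ _ (trans (sym (toℕ-doubled i)) (trans (cong toℕ eq) (toℕ-doubled j)))))
        where
        halve : ∀ a b → a ℕ.+ a ≡ b ℕ.+ b → a ≡ b
        halve a b eq = ℕₚ.*-cancelˡ-≡ a b 2 (trans (cong (a ℕ.+_) (ℕₚ.+-identityʳ a)) (trans eq (cong (b ℕ.+_) (sym (ℕₚ.+-identityʳ b)))))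

      upper-independent : ∀ a → (∀ r → P ∣ (a ⊛ upper) r) → ∀ i → P ∣ a i
      upper-independent a rel i = ∣-resp (push-on position position-injective a i)
        (krylov-independent A (δ ℕ.+ m) δ+m≤n
          (λ d → ∤-det (subst (λ z → P ^ suc z ∣ det (krylov A)) n∸ d))
          (push position a)
          (λ c h → ∣-resp (sym (push-off position a c (λ j eq → ℕₚ.<⇒≱ (ℕₚ.+-monoʳ-< δ (toℕ<n j)) (subst (δ ℕ.+ m ≤_) (trans (cong toℕ (sym eq)) (toℕ-position j)) h)))) ∣0)
          (λ r → ∣-resp (sym (trans (push-sum position a (λ c → krylov A c r)) (sum-cong-≗ (λ j → cong (λ z → a j * walk A z r) (toℕ-position j))))) (rel r))
          (position i))
        where
        δ+m≤n : δ ℕ.+ m ≤ n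
        δ+m≤n = subst (δ ℕ.+ m ≤_) (sym n≡) (ℕₚ.+-monoʳ-≤ δ (ℕₚ.m≤m+n m m))
        n∸ : n ∸ (δ ℕ.+ m) ≡ m
        n∸ = trans (cong (_∸ (δ ℕ.+ m)) (trans n≡ (sym (ℕₚ.+-assoc δ m m)))) (ℕₚ.m+n∸m≡n (δ ℕ.+ m) m)

      -- Removing the factor 2 of each row from δ on leaves a Gram matrix of odd determinant.
      gram : Mat n n
      gram i j = τ (toℕ i ℕ.+ toℕ j)

      gram-rows : ∀ i j → scaleFrom δ i ∣ gram i j
      gram-rows i j = scaleFrom-∣ δ i (λ δ≤i → τ-even _ (ℕₚ.≤-trans δ≤i (ℕₚ.m≤m+n (toℕ i) (toℕ j))))

      reduced : Mat n n
      reduced i j = _∣_.quotient (gram-rows i j)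

      gram-reduced : ∀ i j → gram i j ≡ scaleFrom δ i * reduced i j
      gram-reduced i j = trans (_∣_.equality (gram-rows i j)) (ℤₚ.*-comm (reduced i j) (scaleFrom δ i))

      -- Exactly n - δ = 2m rows lose a factor 2, and the Gram determinant is (det W)² = 2^(2m) c².
      reduced-odd : ¬ P ∣ det reduced
      reduced-odd d = ∤-* c∤ c∤ (subst (P ∣_) square d)
        where
        square : det reduced ≡ c * c
        square = ℤₚ.*-cancelˡ-≡ (P ^ m * P ^ m) (det reduced) (c * c) ⦃ ℤₚ.i*j≢0 (P ^ m) (P ^ m) ⦃ P^-nonZero m ⦄ ⦃ P^-nonZero m ⦄ ⦄ (begin
          P ^ m * P ^ m * det reduced ≡⟨ cong (_* det reduced) (sym scale≡) ⟩
          product (scaleFrom δ {n}) * det reduced ≡⟨ sym (det-scale-rows (scaleFrom δ {n}) reduced) ⟩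
          det (λ i j → scaleFrom δ i * reduced i j) ≡⟨ det-cong (λ i j → trans (sym (gram-reduced i j)) (sym (dot-walk A A-sym (toℕ i) (toℕ j)))) ⟩
          det (krylov A · (krylov A ᵀ)) ≡⟨ trans (det-· (krylov A) (krylov A ᵀ)) (cong (det (krylov A) *_) (det-transpose (krylov A))) ⟩
          det (krylov A) * det (krylov A) ≡⟨ cong₂ _*_ det≡ det≡ ⟩
          P ^ m * c * (P ^ m * c) ≡⟨ regroup (P ^ m) c ⟩
          P ^ m * P ^ m * (c * c) ∎)
          where
          scale≡ : product (scaleFrom δ {n}) ≡ P ^ m * P ^ m
          scale≡ = trans (product-scaleFrom {n} δ) (trans (cong (P ^_) (trans (cong (_∸ δ) n≡) (ℕₚ.m+n∸m≡n δ (m ℕ.+ m)))) (ℤₚ.^-distribˡ-+-* P m m))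
          regroup : ∀ x c → x * c * (x * c) ≡ x * x * (c * c)
          regroup = solve-∀

      combination-vanishes : ∀ a → (∀ k → P * P ∣ dot (a ⊛ upper) (iterate A k (a ⊛ upper))) → ∀ i → P ∣ a i
      combination-vanishes a h i = ∣-square (∣-resp (push-on doubled doubled-injective a² i)
          (injective-modʳ reduced ζ reduced-odd reduced-kernel (doubled i)))
        where
        a² : Vect m
        a² i = a i * a i
        ζ : Vect n
        ζ = push doubled a²
        form : ∀ k → dot (a ⊛ upper) (iterate A k (a ⊛ upper)) ≡ sum (λ i → sum (λ j → a i * (a j * τ (k ℕ.+ (δ ℕ.+ toℕ i) ℕ.+ (δ ℕ.+ toℕ j)))))
        form k = begin
          dot (a ⊛ upper) (iterate A k (a ⊛ upper))
            ≡⟨ dot-⊛ a upper (iterate A k (a ⊛ upper)) ⟩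
          sum (λ i → a i * dot (upper i) (iterate A k (a ⊛ upper)))
            ≡⟨ sum-cong-≗ (λ i → cong (a i *_) (begin
                 dot (upper i) (iterate A k (a ⊛ upper)) ≡⟨ sym (dot-iterate A A-sym k (upper i) (a ⊛ upper)) ⟩
                 dot (iterate A k (upper i)) (a ⊛ upper) ≡⟨ dot-comm (iterate A k (upper i)) (a ⊛ upper) ⟩
                 dot (a ⊛ upper) (iterate A k (upper i)) ≡⟨ dot-⊛ a upper (iterate A k (upper i)) ⟩
                 sum (λ j → a j * dot (upper j) (iterate A k (upper i)))
                   ≡⟨ sum-cong-≗ (λ j → cong (a j *_) (trans (dot-comm (upper j) (iterate A k (upper i)))
                        (trans (sum-cong-≗ (λ r → cong (_* upper j r) (iterate-+ A k (δ ℕ.+ toℕ i) (λ _ → + 1) r)))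
                               (dot-walk A A-sym (k ℕ.+ (δ ℕ.+ toℕ i)) (δ ℕ.+ toℕ j))))) ⟩
                 sum (λ j → a j * τ (k ℕ.+ (δ ℕ.+ toℕ i) ℕ.+ (δ ℕ.+ toℕ j))) ∎)) ⟩
          sum (λ i → a i * sum (λ j → a j * τ (k ℕ.+ (δ ℕ.+ toℕ i) ℕ.+ (δ ℕ.+ toℕ j))))
            ≡⟨ sum-cong-≗ (λ i → *-distribˡ-sum (a i) (λ j → a j * τ (k ℕ.+ (δ ℕ.+ toℕ i) ℕ.+ (δ ℕ.+ toℕ j)))) ⟩
          sum (λ i → sum (λ j → a i * (a j * τ (k ℕ.+ (δ ℕ.+ toℕ i) ℕ.+ (δ ℕ.+ toℕ j))))) ∎
        -- The cross terms a_i a_j τ occur twice, and τ is even.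
        diagonal : ∀ k → P * P ∣ sum (λ i → a i * (a i * τ (k ℕ.+ (δ ℕ.+ toℕ i) ℕ.+ (δ ℕ.+ toℕ i))))
        diagonal k = ∣-resp (cancel (sum (λ i → sum (f i))) (sum (λ i → f i i)))
          (∣m∣n⇒∣m+n (∣-resp (form k) (h k)) (∣m⇒∣-m (symmetric-sum P f f-sym f-even)))
          where
          f : Mat m m
          f i j = a i * (a j * τ (k ℕ.+ (δ ℕ.+ toℕ i) ℕ.+ (δ ℕ.+ toℕ j)))
          f-sym : Symmetric f
          f-sym i j = trans (cong (λ z → a i * (a j * τ z)) (exchange k (δ ℕ.+ toℕ i) (δ ℕ.+ toℕ j))) (swap (a i) (a j) (τ (k ℕ.+ (δ ℕ.+ toℕ j) ℕ.+ (δ ℕ.+ toℕ i))))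
            where
            exchange : ∀ k x y → k ℕ.+ x ℕ.+ y ≡ k ℕ.+ y ℕ.+ x
            exchange k x y = trans (ℕₚ.+-assoc k x y) (trans (cong (k ℕ.+_) (ℕₚ.+-comm x y)) (sym (ℕₚ.+-assoc k y x)))
            swap : ∀ x y t → x * (y * t) ≡ y * (x * t)
            swap = solve-∀
          f-even : ∀ i j → P ∣ f i j
          f-even i j = ∣n⇒∣m*n (a i) (∣n⇒∣m*n (a j) (τ-even _ (ℕₚ.≤-trans (ℕₚ.m≤m+n δ (toℕ j)) (ℕₚ.m≤n+m (δ ℕ.+ toℕ j) (k ℕ.+ (δ ℕ.+ toℕ i))))))
          cancel : ∀ s d → s + - (s + - d) ≡ d
          cancel = solve-∀
        gram-kernel : ∀ r → P * P ∣ sum (λ j → gram r j * ζ j)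
        gram-kernel r = ∣-resp (sym (begin
          sum (λ j → gram r j * ζ j) ≡⟨ sum-cong-≗ (λ j → ℤₚ.*-comm (gram r j) (ζ j)) ⟩
          sum (λ j → ζ j * gram r j) ≡⟨ push-sum doubled a² (gram r) ⟩
          sum (λ i → a² i * gram r (doubled i))
            ≡⟨ sum-cong-≗ (λ i → trans (ℤₚ.*-assoc (a i) (a i) _) (cong (λ z → a i * (a i * τ z))
                 (trans (cong (toℕ r ℕ.+_) (toℕ-doubled i)) (sym (ℕₚ.+-assoc (toℕ r) _ _))))) ⟩
          sum (λ i → a i * (a i * τ (toℕ r ℕ.+ (δ ℕ.+ toℕ i) ℕ.+ (δ ℕ.+ toℕ i)))) ∎)) (diagonal (toℕ r))
        -- Of the factor 4 in `gram-kernel`, a row from δ on spends one 2 on its scale; a row before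
        -- δ has scale 1 and keeps both.
        reduced-kernel : ∀ r → P ∣ sum (λ j → reduced r j * ζ j)
        reduced-kernel r = descale (scaleFrom-cases δ r)
          where
          scaled : scaleFrom δ r * sum (λ j → reduced r j * ζ j) ≡ sum (λ j → gram r j * ζ j)
          scaled = trans (*-distribˡ-sum (scaleFrom δ r) (λ j → reduced r j * ζ j))
            (sum-cong-≗ (λ j → trans (sym (ℤₚ.*-assoc (scaleFrom δ r) (reduced r j) (ζ j))) (cong (_* ζ j) (sym (gram-reduced r j)))))
          descale : (δ ≤ toℕ r × scaleFrom δ r ≡ P) ⊎ scaleFrom δ r ≡ + 1 → P ∣ sum (λ j → reduced r j * ζ j)
          descale (inj₁ (_ , eq)) = cancel-P (∣-resp (trans (sym scaled) (cong (_* sum (λ j → reduced r j * ζ j)) eq)) (gram-kernel r))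
          descale (inj₂ eq) = ∣-trans (divides P refl) (∣-resp (trans (sym scaled) (trans (cong (_* sum (λ j → reduced r j * ζ j)) eq) (ℤₚ.*-identityˡ _))) (gram-kernel r))

      conclude : Dependent vectors → ∀ r → P ∣ u r
      conclude (a , (i , a∤) , rel) r = ∤⇒∣ʳ α∤ (∣m+n∣m⇒∣n (∣-resp (ℤₚ.+-comm (α * u r) (x r)) (rel r)) (∣-sum _ (λ j → ∣m⇒∣m*n (upper j r) (b≡0 j))))
        where
        α : ℤ
        α = a zero
        b : Vect m
        b = a ∘ suc
        x v : Vect n
        x = b ⊛ upper
        v r = _∣_.quotient (rel r)
        α∤ : ¬ P ∣ α
        α∤ α≡0 = a∤ (all-zero i)
          where
          all-zero : ∀ i → P ∣ a i
          all-zero zero = α≡0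
          all-zero (suc i) = upper-independent b (λ r → ∣m+n∣m⇒∣n (rel r) (∣m⇒∣m*n (u r) α≡0)) i
        x≡ : ∀ r → x r ≡ P * v r + - α * u r
        x≡ r = trans (solve-for (α * u r) (x r)) (trans (cong (_+ - (α * u r)) (trans (_∣_.equality (rel r)) (ℤₚ.*-comm (v r) P))) (cong (λ z → P * v r + z) (ℤₚ.neg-distribˡ-* α (u r))))
          where
          solve-for : ∀ a b → b ≡ (a + b) + - a
          solve-for = solve-∀
        -- x agrees with -α u only modulo 2, yet the quadratic forms agree modulo 4: the cross term
        -- carries one 2 from 2v and another from its double occurrence, by symmetry of A.
        x-form : ∀ k → dot x (iterate A k x) ≡ P * P * (dot v (iterate A k v) + - α * dot v (iterate A k u)) + α * α * dot u (iterate A k u)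
        x-form k = begin
          dot x (iterate A k x)
            ≡⟨ trans (sum-cong-≗ (λ r → cong₂ _*_ (x≡ r) (trans (iterate-cong A k x≡ r) (iterate-lin A k P (- α) v u r))))
                 (trans (dot-comm (λ r → P * v r + - α * u r) y) (dot-linʳ y P (- α) v u)) ⟩
          P * dot y v + - α * dot y u
            ≡⟨ cong₂ (λ s t → P * s + - α * t) (trans (dot-comm y v) (dot-linʳ v P (- α) (iterate A k v) (iterate A k u)))
                                             (trans (dot-comm y u) (dot-linʳ u P (- α) (iterate A k v) (iterate A k u))) ⟩
          P * (P * dot v (iterate A k v) + - α * dot v (iterate A k u)) + - α * (P * dot u (iterate A k v) + - α * dot u (iterate A k u))
            ≡⟨ cong (λ z → P * (P * dot v (iterate A k v) + - α * dot v (iterate A k u)) + - α * (P * z + - α * dot u (iterate A k u)))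
                 (trans (sym (dot-iterate A A-sym k u v)) (dot-comm (iterate A k u) v)) ⟩
          P * (P * dot v (iterate A k v) + - α * dot v (iterate A k u)) + - α * (P * dot v (iterate A k u) + - α * dot u (iterate A k u))
            ≡⟨ collect (dot v (iterate A k v)) (dot v (iterate A k u)) (dot u (iterate A k u)) α ⟩
          P * P * (dot v (iterate A k v) + - α * dot v (iterate A k u)) + α * α * dot u (iterate A k u) ∎
          where
          y : Vect n
          y r = P * iterate A k v r + - α * iterate A k u r
          collect : ∀ vv vu uu α → + 2 * (+ 2 * vv + - α * vu) + - α * (+ 2 * vu + - α * uu) ≡ + 2 * + 2 * (vv + - α * vu) + α * α * uu
          collect = solve-∀
        b≡0 : ∀ j → P ∣ b j
        b≡0 = combination-vanishes b (λ k → ∣-resp (sym (x-form k)) (∣m∣n⇒∣m+n (∣m⇒∣m*n (dot v (iterate A k v) + - α * dot v (iterate A k u)) ∣-refl) (∣n⇒∣m*n (α * α) (uu k))))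

  -- Rational orthogonal matrices

  Gram≡ : ∀ {n} → Mat n n → Mat n n → Set
  Gram≡ A B = ∀ k → walkCount A k ≡ walkCount B k

  -- U = ℓ Q for a rational orthogonal Q with Q A = B Q and Q A^k e = B^k e. At level 1 it is a
  -- permutation matrix.
  record Isometry {n} (A B : Mat n n) (ℓ : ℤ) (U : Mat n n) : Set where
    field
      walks : ∀ k i → dot (U i) (walk A k) ≡ ℓ * walk B k i
      intertwines : ∀ i j → (U · A) i j ≡ (B · U) i j
      rows : ∀ i j → (U · (U ᵀ)) i j ≡ ℓ * ℓ * I i j
      columns : ∀ i j → ((U ᵀ) · U) i j ≡ ℓ * ℓ * I i j
  open Isometry

  ≋-setoid : ℕ → ℕ → Setoid 0ℓ 0ℓ
  ≋-setoid n m = record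
    { Carrier = Mat n m ; _≈_ = ZL._≋_
    ; isEquivalence = record { refl = λ i j → refl ; sym = λ p i j → sym (p i j) ; trans = λ p q i j → trans (p i j) (q i j) } }

  ·-scalarI : ∀ {n m} x (M : Mat n m) → M · (x *ₘ I) ≋ x *ₘ M
  ·-scalarI x M i j = trans (·-*ₘ x M I i j) (cong (x *_) ((M ·I) i j))

  scalarI-· : ∀ {n m} x (M : Mat n m) → (x *ₘ I) · M ≋ x *ₘ M
  scalarI-· x M i j = trans (*ₘ-· x I M i j) (cong (x *_) ((I· M) i j))

  ·-cancelʳ : ∀ {n m} (X Y : Mat m n) (C : Mat n n) → det C ≢ + 0 → X · C ≋ Y · C → X ≋ Y
  ·-cancelʳ X Y C C≢0 eq i j = ℤₚ.*-cancelˡ-≡ (det C) (X i j) (Y i j) ⦃ ℤ.≢-nonZero C≢0 ⦄ (begin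
    det C * X i j ≡⟨ sym (·-scalarI (det C) X i j) ⟩
    (X · (det C *ₘ I)) i j ≡⟨ ·-cong {M = X} {X} (λ _ _ → refl) (λ a b → sym (·-adjugate C a b)) i j ⟩
    (X · (C · adjugate C)) i j ≡⟨ sym (·-assoc X C (adjugate C) i j) ⟩
    ((X · C) · adjugate C) i j ≡⟨ ·-cong {N = adjugate C} {adjugate C} eq (λ _ _ → refl) i j ⟩
    ((Y · C) · adjugate C) i j ≡⟨ ·-assoc Y C (adjugate C) i j ⟩
    (Y · (C · adjugate C)) i j ≡⟨ ·-cong {M = Y} {Y} (λ _ _ → refl) (·-adjugate C) i j ⟩
    (Y · (det C *ₘ I)) i j ≡⟨ ·-scalarI (det C) Y i j ⟩
    det C * Y i j ∎)

  ·-cancelˡ : ∀ {n m} (C : Mat n n) (X Y : Mat n m) → det C ≢ + 0 → C · X ≋ C · Y → X ≋ Y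
  ·-cancelˡ C X Y C≢0 eq i j = ·-cancelʳ (X ᵀ) (Y ᵀ) (C ᵀ) (C≢0 ∘ trans (sym (det-transpose C)))
    (λ a b → trans (sym (·-ᵀ C X a b)) (trans (eq b a) (·-ᵀ C Y a b))) j i

  module InitialIsometry {n} (A B : Mat n n) (A-sym : Symmetric A) (B-sym : Symmetric B)
    (gram≡ : Gram≡ A B) (A≢0 : det (krylov A) ≢ + 0) where

    C D Q : Mat n n
    C = krylov A ᵀ
    D = krylov B ᵀ

    N : ℤ
    N = det C

    -- This is W(H) W(G)⁻¹ multiplied by N = det W(G).
    Q = D · leftAdjugate C

    gramEq : (C ᵀ) · C ≋ (D ᵀ) · D
    gramEq i j = trans (dot-walk A A-sym (toℕ i) (toℕ j)) (trans (gram≡ (toℕ i ℕ.+ toℕ j)) (sym (dot-walk B B-sym (toℕ i) (toℕ j))))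

    gramEq₁ : (C ᵀ) · (A · C) ≋ (D ᵀ) · (B · D)
    gramEq₁ i j = trans (dot-walk A A-sym (toℕ i) (suc (toℕ j))) (trans (gram≡ (toℕ i ℕ.+ suc (toℕ j))) (sym (dot-walk B B-sym (toℕ i) (suc (toℕ j)))))

    C≢0 : det C ≢ + 0
    C≢0 = A≢0 ∘ trans (sym (det-transpose (krylov A)))

    Cᵀ≢0 : det (C ᵀ) ≢ + 0
    Cᵀ≢0 = A≢0

    Dᵀ≢0 : det (D ᵀ) ≢ + 0
    Dᵀ≢0 eq with ℤₚ.i*j≡0⇒i≡0∨j≡0 (det (C ᵀ)) {det C} (begin
      det (C ᵀ) * det C ≡⟨ sym (det-· (C ᵀ) C) ⟩
      det ((C ᵀ) · C) ≡⟨ det-cong gramEq ⟩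
      det ((D ᵀ) · D) ≡⟨ det-· (D ᵀ) D ⟩
      det (D ᵀ) * det D ≡⟨ cong (_* det D) eq ⟩
      + 0 ∎)
    ... | inj₁ c = Cᵀ≢0 c
    ... | inj₂ c = C≢0 c

    D≢0 : det D ≢ + 0
    D≢0 = Dᵀ≢0 ∘ trans (det-transpose D)

    module _ where
      private module ≋R {k m} = Relation.Binary.Reasoning.Setoid (≋-setoid k m)
      open ≋R renaming (begin_ to begin≋_; _∎ to _∎≋)

      QC : Q · C ≋ N *ₘ D
      QC = begin≋
        Q · C ≈⟨ ·-assoc D (leftAdjugate C) C ⟩
        D · (leftAdjugate C · C) ≈⟨ ·-cong {M = D} {D} (λ _ _ → refl) (leftAdjugate-· C) ⟩
        D · (N *ₘ I) ≈⟨ ·-scalarI N D ⟩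
        N *ₘ D ∎≋

      QᵀD : (Q ᵀ) · D ≋ N *ₘ C
      QᵀD = ·-cancelˡ (C ᵀ) ((Q ᵀ) · D) (N *ₘ C) Cᵀ≢0 (begin≋
        (C ᵀ) · ((Q ᵀ) · D) ≈⟨ (λ i j → sym (·-assoc (C ᵀ) (Q ᵀ) D i j)) ⟩
        ((C ᵀ) · (Q ᵀ)) · D ≈⟨ ·-cong {N = D} {D} (λ i j → trans (sym (·-ᵀ Q C i j)) (QC j i)) (λ _ _ → refl) ⟩
        (N *ₘ (D ᵀ)) · D ≈⟨ *ₘ-· N (D ᵀ) D ⟩
        N *ₘ ((D ᵀ) · D) ≈⟨ (λ i j → cong (N *_) (sym (gramEq i j))) ⟩
        N *ₘ ((C ᵀ) · C) ≈⟨ (λ i j → sym (·-*ₘ N (C ᵀ) C i j)) ⟩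
        (C ᵀ) · (N *ₘ C) ∎≋)

      QᵀQ : (Q ᵀ) · Q ≋ (N * N) *ₘ I
      QᵀQ = ·-cancelʳ ((Q ᵀ) · Q) ((N * N) *ₘ I) C C≢0 (begin≋
        ((Q ᵀ) · Q) · C ≈⟨ ·-assoc (Q ᵀ) Q C ⟩
        (Q ᵀ) · (Q · C) ≈⟨ ·-cong {M = Q ᵀ} {Q ᵀ} (λ _ _ → refl) QC ⟩
        (Q ᵀ) · (N *ₘ D) ≈⟨ ·-*ₘ N (Q ᵀ) D ⟩
        N *ₘ ((Q ᵀ) · D) ≈⟨ (λ i j → trans (cong (N *_) (QᵀD i j)) (sym (ℤₚ.*-assoc N N (C i j)))) ⟩
        (N * N) *ₘ C ≈⟨ (λ i j → sym (scalarI-· (N * N) C i j)) ⟩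
        ((N * N) *ₘ I) · C ∎≋)

      QQᵀ : Q · (Q ᵀ) ≋ (N * N) *ₘ I
      QQᵀ = ·-cancelʳ (Q · (Q ᵀ)) ((N * N) *ₘ I) D D≢0 (begin≋
        (Q · (Q ᵀ)) · D ≈⟨ ·-assoc Q (Q ᵀ) D ⟩
        Q · ((Q ᵀ) · D) ≈⟨ ·-cong {M = Q} {Q} (λ _ _ → refl) QᵀD ⟩
        Q · (N *ₘ C) ≈⟨ ·-*ₘ N Q C ⟩
        N *ₘ (Q · C) ≈⟨ (λ i j → trans (cong (N *_) (QC i j)) (sym (ℤₚ.*-assoc N N (D i j)))) ⟩
        (N * N) *ₘ D ≈⟨ (λ i j → sym (scalarI-· (N * N) D i j)) ⟩
        ((N * N) *ₘ I) · D ∎≋)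

      -- Between Dᵀ and C the intertwining relation reduces to the equality of the counts
      -- e·A^(i+j+1)e, so A^n e need not be written in terms of the lower walk vectors.
      QAC : Q · (A · C) ≋ N *ₘ (B · D)
      QAC = ·-cancelˡ (D ᵀ) (Q · (A · C)) (N *ₘ (B · D)) Dᵀ≢0 (begin≋
        (D ᵀ) · (Q · (A · C)) ≈⟨ (λ i j → sym (·-assoc (D ᵀ) Q (A · C) i j)) ⟩
        ((D ᵀ) · Q) · (A · C) ≈⟨ ·-cong {N = A · C} {A · C} (λ i j → trans (sym (·-ᵀ (Q ᵀ) D i j)) (QᵀD j i)) (λ _ _ → refl) ⟩
        (N *ₘ (C ᵀ)) · (A · C) ≈⟨ *ₘ-· N (C ᵀ) (A · C) ⟩
        N *ₘ ((C ᵀ) · (A · C)) ≈⟨ (λ i j → cong (N *_) (gramEq₁ i j)) ⟩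
        N *ₘ ((D ᵀ) · (B · D)) ≈⟨ (λ i j → sym (·-*ₘ N (D ᵀ) (B · D) i j)) ⟩
        (D ᵀ) · (N *ₘ (B · D)) ∎≋)

      QA : Q · A ≋ B · Q
      QA = ·-cancelʳ (Q · A) (B · Q) C C≢0 (begin≋
        (Q · A) · C ≈⟨ ·-assoc Q A C ⟩
        Q · (A · C) ≈⟨ QAC ⟩
        N *ₘ (B · D) ≈⟨ (λ i j → sym (·-*ₘ N B D i j)) ⟩
        B · (N *ₘ D) ≈⟨ ·-cong {M = B} {B} (λ _ _ → refl) (λ i j → sym (QC i j)) ⟩
        B · (Q · C) ≈⟨ (λ i j → sym (·-assoc B Q C i j)) ⟩
        (B · Q) · C ∎≋)

    Q-walks : ∀ k i → dot (Q i) (walk A k) ≡ N * walk B k i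
    Q-walks zero i = first-column (index-zero i)
      where
      index-zero : ∀ {n} → Fin n → Σ (Fin n) λ c → toℕ c ≡ 0
      index-zero {suc n} _ = zero , refl
      first-column : (Σ (Fin n) λ c → toℕ c ≡ 0) → dot (Q i) (walk A 0) ≡ N * walk B 0 i
      first-column (c , c≡0) = subst (λ z → dot (Q i) (walk A z) ≡ N * walk B z i) c≡0 (QC i c)
    Q-walks (suc k) i = begin
      dot (Q i) (apply A (walk A k)) ≡⟨ sym (dot-apply A A-sym (Q i) (walk A k)) ⟩
      dot (apply A (Q i)) (walk A k) ≡⟨ sum-cong-≗ (λ j → cong (_* walk A k j) (row j)) ⟩
      dot (B i ⊛ Q) (walk A k) ≡⟨ dot-⊛ (B i) Q (walk A k) ⟩
      sum (λ s → B i s * dot (Q s) (walk A k)) ≡⟨ sum-cong-≗ (λ s → trans (cong (B i s *_) (Q-walks k s)) (swap (B i s) N (walk B k s))) ⟩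
      sum (λ s → N * (B i s * walk B k s)) ≡⟨ sym (*-distribˡ-sum N (λ s → B i s * walk B k s)) ⟩
      N * walk B (suc k) i ∎
      where
      row : ∀ j → apply A (Q i) j ≡ (B i ⊛ Q) j
      row j = trans (sum-cong-≗ (λ s → trans (ℤₚ.*-comm (A j s) (Q i s)) (cong (Q i s *_) (A-sym j s)))) (QA i j)
      swap : ∀ b n w → b * (n * w) ≡ n * (b * w)
      swap = solve-∀

    -- The second factor N makes the level positive whatever the sign of N, hence a product of
    -- primes.
    isometry : Isometry A B (N * N) (N *ₘ Q)
    isometry .walks k i = trans (sum-cong-≗ (λ j → ℤₚ.*-assoc N (Q i j) (walk A k j)))
      (trans (sym (*-distribˡ-sum N (λ j → Q i j * walk A k j))) (trans (cong (N *_) (Q-walks k i)) (sym (ℤₚ.*-assoc N N (walk B k i)))))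
    isometry .intertwines i j = trans (*ₘ-· N Q A i j) (trans (cong (N *_) (QA i j)) (sym (·-*ₘ N B Q i j)))
    isometry .rows i j = trans (sum-cong-≗ (λ s → regroup N (Q i s) (Q j s)))
      (trans (sym (*-distribˡ-sum (N * N) (λ s → Q i s * Q j s))) (trans (cong (N * N *_) (QQᵀ i j)) (sym (ℤₚ.*-assoc (N * N) (N * N) (I i j)))))
      where
      regroup : ∀ n x y → n * x * (n * y) ≡ n * n * (x * y)
      regroup = solve-∀
    isometry .columns i j = trans (sum-cong-≗ (λ s → regroup N (Q s i) (Q s j)))
      (trans (sym (*-distribˡ-sum (N * N) (λ s → Q s i * Q s j))) (trans (cong (N * N *_) (QᵀQ i j)) (sym (ℤₚ.*-assoc (N * N) (N * N) (I i j)))))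
      where
      regroup : ∀ n x y → n * x * (n * y) ≡ n * n * (x * y)
      regroup = solve-∀

  -- The numerical hypothesis of Wang's theorem: 2^{-⌊n/2⌋} det W is odd and square-free.
  record Criterion {n} (A : Mat n n) : Set where
    field
      δ m : ℕ
      c : ℤ
      δ≤1 : δ ≤ 1
      order : n ≡ δ ℕ.+ (m ℕ.+ m)
      det≡ : det (krylov A) ≡ (+ 2) ^ m * c
      odd : ¬ + 2 ∣ c
      square-free : ∀ d → + d * + d ∣ c → d ≡ 1

  module _ {n} {A : Mat n n} (crit : Criterion A) where

    open Criterion crit

    criterion-nonZero : det (krylov A) ≢ + 0
    criterion-nonZero eq with ℤₚ.i*j≡0⇒i≡0∨j≡0 ((+ 2) ^ m) (trans (sym det≡) eq)
    ... | inj₁ 2^m≡0 = power≢0 m 2^m≡0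
      where
      power≢0 : ∀ k → (+ 2) ^ k ≢ + 0
      power≢0 (suc k) eq with ℤₚ.i*j≡0⇒i≡0∨j≡0 (+ 2) eq
      ... | inj₂ eq′ = power≢0 k eq′
    ... | inj₂ c≡0 = odd (subst (+ 2 ∣_) (sym c≡0) ∣0)

    vanishing : Symmetric A → (∀ i → A i i ≡ + 0) → ∀ p → Prime p → (u : Vect n) →
      (∀ k → + p ∣ dot u (walk A k)) → (∀ k → + p * + p ∣ dot u (iterate A k u)) → ∀ r → + p ∣ u r
    vanishing A-sym A-diag p p-prime with p ℕ.≟ 2
    ... | yes refl = EvenPrime.kernel-vector-vanishes A A-sym A-diag δ m c δ≤1 order det≡ odd
    ... | no p≢2 = OddPrime.kernel-vector-vanishes p p-prime A A-sym p²∤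
      where
      open Modulo p p-prime
      p∤2 : ¬ P ∣ + 2
      p∤2 h = p≢2 (ℕₚ.≤-antisym (ℕᵈ.∣⇒≤ (∣⇒∣ᵤ h)) (ℕ.nonTrivial⇒n>1 p ⦃ prime⇒nonTrivial p-prime ⦄))
      p∤2^ : ∀ k → ¬ P ∣ (+ 2) ^ k
      p∤2^ zero = P∤1
      p∤2^ (suc k) = ∤-* p∤2 (p∤2^ k)
      p²∤ : ¬ P ^ 2 ∣ det (krylov A)
      p²∤ h = ℕₚ.<⇒≢ (ℕ.nonTrivial⇒n>1 p ⦃ prime⇒nonTrivial p-prime ⦄) (sym (square-free p
        (subst (_∣ c) (cong (P *_) (ℤₚ.*-identityʳ P)) (power-coprime 2 (p∤2^ m) (subst (P ^ 2 ∣_) det≡ h)))))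

  module Descent {n} (A B : Mat n n) (A-sym : Symmetric A) (A-diag : ∀ i → A i i ≡ + 0) (B-sym : Symmetric B)
    (crit : Criterion A) where

    intertwine-iterate : ∀ {ℓ U} → Isometry A B ℓ U → ∀ k (x : Vect n) r → iterate A k (x ⊛ U) r ≡ (iterate B k x ⊛ U) r
    intertwine-iterate iso zero x r = refl
    intertwine-iterate {U = U} iso (suc k) x r = begin
      apply A (iterate A k (x ⊛ U)) r ≡⟨ apply-cong A (intertwine-iterate iso k x) r ⟩
      apply A (y ⊛ U) r ≡⟨ dot-comm (A r) (y ⊛ U) ⟩
      dot (y ⊛ U) (A r) ≡⟨ sum-cong-≗ (λ s → cong ((y ⊛ U) s *_) (A-sym r s)) ⟩
      ((y ⊛ U) ⊛ A) r ≡⟨ ⊛-assoc y U A r ⟩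
      (y ⊛ (U · A)) r ≡⟨ sum-cong-≗ (λ s → cong (y s *_) (intertwines iso s r)) ⟩
      (y ⊛ (B · U)) r ≡⟨ sym (⊛-assoc y B U r) ⟩
      ((y ⊛ B) ⊛ U) r ≡⟨ sum-cong-≗ (λ s → cong (_* U s r) (trans (dot-comm y (λ t → B t s)) (sum-cong-≗ (λ t → cong (_* y t) (B-sym t s))))) ⟩
      (apply B y ⊛ U) r ∎
      where
      y : Vect n
      y = iterate B k x

    -- A diagonal entry of U A^k Uᵀ = B^k U Uᵀ = ℓ² B^k. A prime dividing ℓ therefore divides these
    -- numbers twice.
    row-form : ∀ {ℓ U} → Isometry A B ℓ U → ∀ i k → dot (U i) (iterate A k (U i)) ≡ ℓ * ℓ * iterate B k (I i) i
    row-form {ℓ} {U} iso i k = begin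
      dot (U i) (iterate A k (U i)) ≡⟨ dot-congʳ (U i) (λ r → trans (iterate-cong A k (λ s → sym ((I· U) i s)) r) (intertwine-iterate iso k (I i) r)) ⟩
      dot (U i) (y ⊛ U) ≡⟨ dot-comm (U i) (y ⊛ U) ⟩
      dot (y ⊛ U) (U i) ≡⟨ dot-⊛ y U (U i) ⟩
      sum (λ s → y s * dot (U s) (U i)) ≡⟨ sum-cong-≗ (λ s → trans (cong (y s *_) (rows iso s i)) (swap (y s) (ℓ * ℓ) (I s i))) ⟩
      sum (λ s → ℓ * ℓ * (y s * I s i)) ≡⟨ sym (*-distribˡ-sum (ℓ * ℓ) (λ s → y s * I s i)) ⟩
      ℓ * ℓ * sum (λ s → y s * I s i) ≡⟨ cong (ℓ * ℓ *_) (sum-I y i) ⟩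
      ℓ * ℓ * y i ∎
      where
      y : Vect n
      y = iterate B k (I i)
      swap : ∀ y l i → y * (l * i) ≡ l * (y * i)
      swap = solve-∀

    module Divide (p : ℕ) (p-prime : Prime p) (ℓ : ℤ) (U : Mat n n) (iso : Isometry A B (+ p * ℓ) U) where

      open Modulo p p-prime

      entries : ∀ i j → P ∣ U i j
      entries i = vanishing crit A-sym A-diag p p-prime (U i)
        (λ k → ∣-resp (sym (trans (walks iso k i) (ℤₚ.*-assoc P ℓ (walk B k i)))) (∣m⇒∣m*n (ℓ * walk B k i) ∣-refl))
        (λ k → ∣-resp (sym (trans (row-form iso i k) (regroup P ℓ (iterate B k (I i) i)))) (∣m⇒∣m*n (ℓ * ℓ * iterate B k (I i) i) ∣-refl))
        where
        regroup : ∀ p l x → p * l * (p * l) * x ≡ p * p * (l * l * x)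
        regroup = solve-∀

      V : Mat n n
      V i j = _∣_.quotient (entries i j)

      U≡ : ∀ i j → U i j ≡ P * V i j
      U≡ i j = trans (_∣_.equality (entries i j)) (ℤₚ.*-comm (V i j) P)

      scale-sum : ∀ x (f g : Vect n) → (∀ i → f i ≡ x * g i) → sum f ≡ x * sum g
      scale-sum x f g eq = trans (sum-cong-≗ eq) (sym (*-distribˡ-sum x g))

      regroup : ∀ n x y → n * x * (n * y) ≡ n * n * (x * y)
      regroup = solve-∀

      expand : ∀ p l x → p * l * (p * l) * x ≡ p * (p * (l * l * x))
      expand = solve-∀

      cancel : ∀ {x y} → P * x ≡ P * y → x ≡ y
      cancel {x} {y} = ℤₚ.*-cancelˡ-≡ P x y

      divided : Isometry A B ℓ V
      divided .walks k i = cancel (trans (sym (scale-sum P (λ j → U i j * walk A k j) (λ j → V i j * walk A k j)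
          (λ j → trans (cong (_* walk A k j) (U≡ i j)) (ℤₚ.*-assoc P (V i j) (walk A k j)))))
        (trans (walks iso k i) (ℤₚ.*-assoc P ℓ (walk B k i))))
      divided .intertwines i j = cancel (trans (sym (scale-sum P (λ s → U i s * A s j) (λ s → V i s * A s j)
          (λ s → trans (cong (_* A s j) (U≡ i s)) (ℤₚ.*-assoc P (V i s) (A s j)))))
        (trans (intertwines iso i j) (scale-sum P (λ s → B i s * U s j) (λ s → B i s * V s j)
          (λ s → trans (cong (B i s *_) (U≡ s j)) (swap (B i s) P (V s j))))))
        where
        swap : ∀ b p v → b * (p * v) ≡ p * (b * v)
        swap = solve-∀
      divided .rows i j = cancel (cancel (trans (sym (ℤₚ.*-assoc P P (sum (λ s → V i s * V j s)))) (trans (sym (scale-sum (P * P) (λ s → U i s * U j s) (λ s → V i s * V j s)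
          (λ s → trans (cong₂ _*_ (U≡ i s) (U≡ j s)) (regroup P (V i s) (V j s)))))
        (trans (rows iso i j) (expand P ℓ (I i j))))))
      divided .columns i j = cancel (cancel (trans (sym (ℤₚ.*-assoc P P (sum (λ s → V s i * V s j)))) (trans (sym (scale-sum (P * P) (λ s → U s i * U s j) (λ s → V s i * V s j)
          (λ s → trans (cong₂ _*_ (U≡ s i) (U≡ s j)) (regroup P (V s i) (V s j)))))
        (trans (columns iso i j) (expand P ℓ (I i j))))))

    descend : ∀ ps → All Prime ps → (U : Mat n n) → Isometry A B (+ ℕᴸ.product ps) U → Σ (Mat n n) (Isometry A B (+ 1))
    descend List.[] _ U iso = U , iso
    descend (p List.∷ ps) (p-prime All.∷ ps-prime) U iso =
      descend ps ps-prime (Divide.V p p-prime (+ ℕᴸ.product ps) U iso′) (Divide.divided p p-prime (+ ℕᴸ.product ps) U iso′)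
      where
      iso′ : Isometry A B (+ p * + ℕᴸ.product ps) U
      iso′ = subst (λ z → Isometry A B z U) (ℤₚ.pos-* p (ℕᴸ.product ps)) iso

    integral : Gram≡ A B → Σ (Mat n n) (Isometry A B (+ 1))
    integral gram≡ = descend factors factorsPrime (N *ₘ Q) (subst (λ z → Isometry A B z (N *ₘ Q)) level isometry)
      where
      open InitialIsometry A B A-sym B-sym gram≡ (criterion-nonZero crit)
      instance
        N-nonZero : ℤ.NonZero N
        N-nonZero = ℤ.≢-nonZero C≢0
        level-nonZero : ℕ.NonZero (ℤ.∣ N ∣ ℕ.* ℤ.∣ N ∣)
        level-nonZero = ℕₚ.m*n≢0 ℤ.∣ N ∣ ℤ.∣ N ∣
      open PrimeFactorisation (factorise (ℤ.∣ N ∣ ℕ.* ℤ.∣ N ∣))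
      level : N * N ≡ + ℕᴸ.product factors
      level = trans (square N) (cong +_ isFactorisation)
        where
        square : ∀ x → x * x ≡ + (ℤ.∣ x ∣ ℕ.* ℤ.∣ x ∣)
        square (+ x) = sym (ℤₚ.pos-* x x)
        square -[1+ x ] = refl

  -- Permutation matrices

  sumSquares : ∀ {n} → Vect n → ℕ
  sumSquares {zero} x = 0
  sumSquares {suc n} x = ℤ.∣ x zero ∣ ℕ.* ℤ.∣ x zero ∣ ℕ.+ sumSquares (x ∘ suc)

  dot-self : ∀ {n} (x : Vect n) → dot x x ≡ + sumSquares x
  dot-self {zero} x = refl
  dot-self {suc n} x = trans (cong₂ _+_ (square (x zero)) (dot-self (x ∘ suc))) (sym (ℤₚ.pos-+ (ℤ.∣ x zero ∣ ℕ.* ℤ.∣ x zero ∣) (sumSquares (x ∘ suc))))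
    where
    square : ∀ x → x * x ≡ + (ℤ.∣ x ∣ ℕ.* ℤ.∣ x ∣)
    square (+ x) = sym (ℤₚ.pos-* x x)
    square -[1+ x ] = refl

  sumSquares≡0 : ∀ {n} (x : Vect n) → sumSquares x ≡ 0 → ∀ i → x i ≡ + 0
  sumSquares≡0 {suc n} x eq zero = ℤₚ.∣i∣≡0⇒i≡0 (square≡0 ℤ.∣ x zero ∣ (ℕₚ.m+n≡0⇒m≡0 _ eq))
    where
    square≡0 : ∀ a → a ℕ.* a ≡ 0 → a ≡ 0
    square≡0 zero _ = refl
  sumSquares≡0 {suc n} x eq (suc i) = sumSquares≡0 (x ∘ suc) (ℕₚ.m+n≡0⇒n≡0 (ℤ.∣ x zero ∣ ℕ.* ℤ.∣ x zero ∣) eq) i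

  -- Squares of integers that add up to 1 leave a single entry 1 or -1; the sum decides the sign.
  unit-vector : ∀ {n} (x : Vect n) → sumSquares x ≡ 1 → sum x ≡ + 1 → Σ (Fin n) λ j → ∀ i → x i ≡ I j i
  unit-vector {suc n} x sq≡1 sum≡1 = split ℤ.∣ x zero ∣ refl
    where
    split : ∀ a → ℤ.∣ x zero ∣ ≡ a → Σ (Fin (suc n)) λ j → ∀ i → x i ≡ I j i
    split zero eq with unit-vector (x ∘ suc)
        (trans (cong (λ z → z ℕ.* z ℕ.+ sumSquares (x ∘ suc)) (sym eq)) sq≡1)
        (trans (sym (ℤₚ.+-identityˡ _)) (trans (cong (λ z → z + sum (x ∘ suc)) {+ 0} {x zero} (sym (ℤₚ.∣i∣≡0⇒i≡0 eq))) sum≡1))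
    ... | j , xj = suc j , λ { zero → ℤₚ.∣i∣≡0⇒i≡0 eq ; (suc i) → xj i }
    split (suc zero) eq = zero , λ { zero → trans (sym (trans (cong (λ z → x zero + z) (sum-zero tail≡0)) (ℤₚ.+-identityʳ (x zero)))) sum≡1
                                   ; (suc i) → tail≡0 i }
      where
      tail≡0 : ∀ i → x (suc i) ≡ + 0
      tail≡0 = sumSquares≡0 (x ∘ suc) (ℕₚ.suc-injective (trans (cong (λ z → z ℕ.* z ℕ.+ sumSquares (x ∘ suc)) (sym eq)) sq≡1))
    split (suc (suc a)) eq = ⊥-elim (impossible (trans (cong (λ z → z ℕ.* z ℕ.+ sumSquares (x ∘ suc)) (sym eq)) sq≡1))
      where
      impossible : suc (suc a) ℕ.* suc (suc a) ℕ.+ sumSquares (x ∘ suc) ≢ 1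
      impossible ()

  module Permutation {n} (A B : Mat n n) (R : Mat n n) (iso : Isometry A B (+ 1) R) where

    row-norm : ∀ i → sumSquares (R i) ≡ 1
    row-norm i = ℤₚ.+-injective (trans (sym (dot-self (R i))) (trans (rows iso i i) (cong (λ z → + 1 * z) (I-diag i))))

    column-norm : ∀ j → sumSquares (λ i → R i j) ≡ 1
    column-norm j = ℤₚ.+-injective (trans (sym (dot-self (λ i → R i j))) (trans (columns iso j j) (cong (λ z → + 1 * z) (I-diag j))))

    row-sum : ∀ i → sum (R i) ≡ + 1
    row-sum i = trans (sum-cong-≗ (λ j → sym (ℤₚ.*-identityʳ (R i j)))) (walks iso 0 i)

    -- From R e = e and Rᵀ R = I one gets Rᵀ e = Rᵀ R e = e.
    column-sum : ∀ j → sum (λ i → R i j) ≡ + 1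
    column-sum j = begin
      sum (λ i → R i j) ≡⟨ sum-cong-≗ (λ i → trans (sym (ℤₚ.*-identityʳ (R i j))) (cong (R i j *_) (sym (row-sum i)))) ⟩
      sum (λ i → R i j * sum (R i)) ≡⟨ sum-cong-≗ (λ i → *-distribˡ-sum (R i j) (R i)) ⟩
      sum (λ i → sum (λ k → R i j * R i k)) ≡⟨ ∑-comm (λ i k → R i j * R i k) ⟩
      sum (λ k → sum (λ i → R i j * R i k)) ≡⟨ sum-cong-≗ (λ k → trans (columns iso j k) (cong (λ z → + 1 * z) (I-symmetric j k))) ⟩
      sum (λ k → + 1 * I k j) ≡⟨ sum-I (λ _ → + 1) j ⟩
      + 1 ∎

    -- σ is read off the rows and ρ off the columns; both locate the same entries 1, which makes
    -- them mutually inverse.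
    σ : Fin n → Fin n
    σ i = proj₁ (unit-vector (R i) (row-norm i) (row-sum i))

    σ-spec : ∀ i j → R i j ≡ I (σ i) j
    σ-spec i = proj₂ (unit-vector (R i) (row-norm i) (row-sum i))

    ρ : Fin n → Fin n
    ρ j = proj₁ (unit-vector (λ i → R i j) (column-norm j) (column-sum j))

    ρ-spec : ∀ j i → R i j ≡ I (ρ j) i
    ρ-spec j = proj₂ (unit-vector (λ i → R i j) (column-norm j) (column-sum j))

    I≡1 : ∀ {n} (i j : Fin n) → I i j ≡ + 1 → i ≡ j
    I≡1 i j eq with i Fin.≟ j
    ... | yes i≡j = i≡j
    ... | no i≢j = ⊥-elim (0≢1 (trans (sym (I-off i≢j)) eq))
      where
      0≢1 : + 0 ≢ + 1
      0≢1 ()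

    ρσ : ∀ i → ρ (σ i) ≡ i
    ρσ i = I≡1 (ρ (σ i)) i (trans (sym (ρ-spec (σ i) i)) (trans (σ-spec i (σ i)) (I-diag (σ i))))

    σρ : ∀ j → σ (ρ j) ≡ j
    σρ j = I≡1 (σ (ρ j)) j (trans (sym (σ-spec (ρ j) j)) (trans (ρ-spec j (ρ j)) (I-diag (ρ j))))

    permuted : ∀ i j → A i j ≡ B (ρ i) (ρ j)
    permuted i j = begin
      A i j ≡⟨ cong (λ z → A z j) (sym (σρ i)) ⟩
      A (σ (ρ i)) j ≡⟨ sym ((I· A) (σ (ρ i)) j) ⟩
      (I · A) (σ (ρ i)) j ≡⟨ sum-cong-≗ (λ s → cong (_* A s j) (sym (σ-spec (ρ i) s))) ⟩
      (R · A) (ρ i) j ≡⟨ intertwines iso (ρ i) j ⟩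
      (B · R) (ρ i) j ≡⟨ sum-cong-≗ (λ s → cong (B (ρ i) s *_) (trans (ρ-spec j s) (I-symmetric (ρ j) s))) ⟩
      (B · I) (ρ i) (ρ j) ≡⟨ (B ·I) (ρ i) (ρ j) ⟩
      B (ρ i) (ρ j) ∎

  b2z-injective : ∀ {x y} → b2z x ≡ b2z y → x ≡ y
  b2z-injective {false} {false} _ = refl
  b2z-injective {true} {true} _ = refl

  criterion⇒DGS : ∀ {n} (G : Graph n) → Criterion (adjMat G) → DGS G
  criterion⇒DGS {n} G crit m H cosp cosp′ with cospectral⇒same-order G H cosp
  ... | refl = mk↔ₛ′ ρ σ ρσ σρ , λ i j → b2z-injective (permuted i j)
    where
    integral : Σ (Mat n n) (Isometry (adjMat G) (adjMat H) (+ 1))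
    integral = Descent.integral (adjMat G) (adjMat H) (adjMat-sym G) (adjMat-diag G) (adjMat-sym H) crit
      (cospectral⇒walkCount G H cosp cosp′)
    open Permutation (adjMat G) (adjMat H) (proj₁ integral) (proj₂ integral)

  -- The graph sequence

  -- Graphs contain functions and proofs, so they are compared by their adjacencies, and `DGS` is
  -- transported by `DGS-resp`.
  infix 4 _≗ᴳ_
  _≗ᴳ_ : ∀ {n} → Graph n → Graph n → Set
  G ≗ᴳ H = ∀ i j → adj G i j ≡ adj H i j

  ≗ᴳ-trans : ∀ {n} {G H K : Graph n} → G ≗ᴳ H → H ≗ᴳ K → G ≗ᴳ K
  ≗ᴳ-trans p q i j = trans (p i j) (q i j)

  complement-cong : ∀ {n} {G H : Graph n} → G ≗ᴳ H → complement G ≗ᴳ complement H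
  complement-cong G≗H i j with i Fin.≟ j
  ... | yes _ = refl
  ... | no _ = cong not (G≗H i j)

  unionV-cong : ∀ {n} {G H : Graph n} → G ≗ᴳ H → unionV G ≗ᴳ unionV H
  unionV-cong G≗H zero zero = refl
  unionV-cong G≗H zero (suc j) = refl
  unionV-cong G≗H (suc i) zero = refl
  unionV-cong G≗H (suc i) (suc j) = G≗H i j

  joinV-cong : ∀ {n} {G H : Graph n} → G ≗ᴳ H → joinV G ≗ᴳ joinV H
  joinV-cong G≗H zero zero = refl
  joinV-cong G≗H zero (suc j) = refl
  joinV-cong G≗H (suc i) zero = refl
  joinV-cong G≗H (suc i) (suc j) = G≗H i j

  complement-off : ∀ {n} (G : Graph n) {i j} → i ≢ j → adj (complement G) i j ≡ not (adj G i j)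
  complement-off G {i} {j} i≢j with i Fin.≟ j
  ... | yes i≡j = ⊥-elim (i≢j i≡j)
  ... | no _ = refl

  ≗ᴳ-offDiagonal : ∀ {n} (G H : Graph n) → (∀ {i j} → i ≢ j → adj G i j ≡ adj H i j) → G ≗ᴳ H
  ≗ᴳ-offDiagonal G H off i j with i Fin.≟ j
  ... | yes refl = trans (adj-irrefl G i) (sym (adj-irrefl H i))
  ... | no i≢j = off i≢j

  complement-involutive : ∀ {n} (G : Graph n) → complement (complement G) ≗ᴳ G
  complement-involutive G = ≗ᴳ-offDiagonal (complement (complement G)) G λ {i} {j} i≢j →
    trans (complement-off (complement G) i≢j) (trans (cong not (complement-off G i≢j)) (not-involutive (adj G i j)))

  complement-unionV : ∀ {n} (G : Graph n) → complement (unionV G) ≗ᴳ joinV (complement G)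
  complement-unionV G = ≗ᴳ-offDiagonal (complement (unionV G)) (joinV (complement G)) λ {i} {j} i≢j →
    trans (complement-off (unionV G) i≢j) (off i j i≢j)
    where
    off : ∀ i j → i ≢ j → not (adj (unionV G) i j) ≡ adj (joinV (complement G)) i j
    off zero zero i≢j = ⊥-elim (i≢j refl)
    off zero (suc j) _ = refl
    off (suc i) zero _ = refl
    off (suc i) (suc j) i≢j = sym (complement-off G (i≢j ∘ cong suc))

  charPoly-cong : ∀ {n} {G H : Graph n} → G ≗ᴳ H → Cospectral G H
  charPoly-cong {G = G} {H} G≗H k = trans (charPoly≐φ G k) (trans
    (PL.det-cong (λ i j k → cong (λ z → charMat (λ _ _ → z) i j k) (cong b2z (G≗H i j))) k) (sym (charPoly≐φ H k)))

  DGS-resp : ∀ {n} (G G′ : Graph n) → G ≗ᴳ G′ → DGS G → DGS G′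
  DGS-resp G G′ G≗G′ dgs m H cosp cosp′
    with dgs m H (λ k → trans (charPoly-cong {G = G} {G′} G≗G′ k) (cosp k))
                 (λ k → trans (charPoly-cong {G = complement G} {complement G′} (complement-cong {G = G} {G′} G≗G′) k) (cosp′ k))
  ... | f , f-adj = f , λ i j → trans (sym (G≗G′ i j)) (f-adj i j)

  -- The generalized spectrum treats a graph and its complement alike, and an isomorphism of the
  -- complements is one of the graphs.
  DGS-complement : ∀ {n} (G : Graph n) → DGS (complement G) → DGS G
  DGS-complement G dgs m H cosp cosp′
    with dgs m (complement H) cosp′ (λ k → trans (charPoly-cong {G = complement (complement G)} {G} (complement-involutive G) k)
                                       (trans (cosp k) (sym (charPoly-cong {G = complement (complement H)} {H} (complement-involutive H) k))))
  ... | f , f-adj = f , preserves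
    where
    open Inverse f using (to; from; strictlyInverseʳ)
    injective : ∀ {i j} → to i ≡ to j → i ≡ j
    injective eq = trans (sym (strictlyInverseʳ _)) (trans (cong from eq) (strictlyInverseʳ _))
    preserves : ∀ i j → adj G i j ≡ adj H (to i) (to j)
    preserves i j with i Fin.≟ j
    ... | yes refl = trans (adj-irrefl G i) (sym (adj-irrefl H (to i)))
    ... | no i≢j = not-injective (trans (sym (complement-off G i≢j)) (trans (f-adj i j) (complement-off H (i≢j ∘ injective))))

  complement-DGS : ∀ {n} (G : Graph n) → DGS G → DGS (complement G)
  complement-DGS G dgs = DGS-complement (complement G) (DGS-resp G (complement (complement G)) (λ i j → sym (complement-involutive G i j)) dgs)

  -- Complementing the odd members turns both steps of Gseq into the single step K ↦ complement (K ∪ w).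
  stepV : ∀ {n} → Graph n → Graph (suc n)
  stepV G = complement (unionV G)

  iterateStep : ∀ {n} → Graph n → (i : ℕ) → Graph (i ℕ.+ n)
  iterateStep G zero = G
  iterateStep G (suc i) = stepV (iterateStep G i)

  Gseq-iterateStep : ∀ {n} (G : Graph n) i →
    (isOdd i ≡ false × Gseq G i ≗ᴳ iterateStep G i) ⊎ (isOdd i ≡ true × Gseq G i ≗ᴳ complement (iterateStep G i))
  Gseq-iterateStep G zero = inj₁ (refl , λ i j → refl)
  Gseq-iterateStep G (suc i) with isOdd i | Gseq-iterateStep G i
  ... | false | inj₁ (_ , eq) = inj₂ (refl , ≗ᴳ-trans {G = unionV (Gseq G i)} {unionV K} {complement (stepV K)}
          (unionV-cong {G = Gseq G i} {K} eq) (λ a b → sym (complement-involutive (unionV K) a b)))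
    where
    K : Graph (i ℕ.+ _)
    K = iterateStep G i
  ... | true | inj₂ (_ , eq) = inj₁ (refl , ≗ᴳ-trans {G = joinV (Gseq G i)} {joinV (complement K)} {stepV K}
          (joinV-cong {G = Gseq G i} {complement K} eq) (λ a b → sym (complement-unionV K a b)))
    where
    K : Graph (i ℕ.+ _)
    K = iterateStep G i

  Gseq-DGS : ∀ {n} (G : Graph n) i → DGS (iterateStep G i) → DGS (Gseq G i)
  Gseq-DGS G i dgs with Gseq-iterateStep G i
  ... | inj₁ (_ , eq) = DGS-resp (iterateStep G i) (Gseq G i) (λ a b → sym (eq a b)) dgs
  ... | inj₂ (_ , eq) = DGS-resp (complement (iterateStep G i)) (Gseq G i) (λ a b → sym (eq a b)) (complement-DGS (iterateStep G i) dgs)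

  iterate-cong₂ : ∀ {n} {A B : Mat n n} → (∀ i j → A i j ≡ B i j) → ∀ k v i → iterate A k v i ≡ iterate B k v i
  iterate-cong₂ A≡B zero v i = refl
  iterate-cong₂ A≡B (suc k) v i = sum-cong-≗ (λ j → cong₂ _*_ (A≡B i j) (iterate-cong₂ A≡B k v j))

  -- Determinants along the sequence

  -- The isolated vertex contributes the row (1, 0, ..., 0) to the walk matrix. Deleting this row
  -- and the first column leaves the vectors A^(k+1) e, that is A W(G).
  det-krylov-unionV : ∀ {n} (G : Graph n) →
    det (krylov (adjMat (unionV G))) ≡ det (krylov (adjMat G)) * det (adjMat G)
  det-krylov-unionV {n} G = begin
    det (krylov U) ≡⟨ sym (det-transpose (krylov U)) ⟩
    det (krylov U ᵀ) ≡⟨ det-first-row (krylov U ᵀ) (λ c → walk-new (toℕ c)) ⟩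
    + 1 * det (minor zero (krylov U ᵀ)) ≡⟨ ℤₚ.*-identityˡ _ ⟩
    det (minor zero (krylov U ᵀ)) ≡⟨ det-cong {M = minor zero (krylov U ᵀ)} {(krylov A · A) ᵀ} (λ r c → minor≡ r c) ⟩
    det ((krylov A · A) ᵀ) ≡⟨ det-transpose (krylov A · A) ⟩
    det (krylov A · A) ≡⟨ det-· (krylov A) A ⟩
    det (krylov A) * det A ∎
    where
    A : Mat n n
    A = adjMat G
    U : Mat (suc n) (suc n)
    U = adjMat (unionV G)
    walk-new : ∀ k → walk U (suc k) zero ≡ + 0
    walk-new k = sum-zero {t = λ j → U zero j * walk U k j} (λ { zero → refl ; (suc j) → refl })
    walk-old : ∀ k r → walk U k (suc r) ≡ walk A k r
    walk-old zero r = refl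
    walk-old (suc k) r = trans (ℤₚ.+-identityˡ _) (sum-cong-≗ (λ j → cong (A r j *_) (walk-old k j)))
    minor≡ : ∀ r c → walk U (suc (toℕ c)) (suc r) ≡ (krylov A · A) c r
    minor≡ r c = trans (walk-old (suc (toℕ c)) r)
      (sum-cong-≗ (λ s → trans (ℤₚ.*-comm (A r s) (walk A (toℕ c) s)) (cong (walk A (toℕ c) s *_) (adjMat-sym G r s))))

  abs-product : ∀ {n} (d : Vect n) → (∀ i → ℤ.∣ d i ∣ ≡ 1) → ℤ.∣ product d ∣ ≡ 1
  abs-product {zero} d h = refl
  abs-product {suc n} d h = trans (ℤₚ.abs-* (d zero) (product (d ∘ suc))) (cong₂ ℕ._*_ (h zero) (abs-product (d ∘ suc) (h ∘ suc)))

  -- J maps every vector to a multiple of e, so the k-th walk vector of the complement is A^k e up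
  -- to sign, plus a combination of lower walk vectors. The transition matrix is triangular with
  -- diagonal entries 1 and -1.
  abs-det-krylov-complement : ∀ {n} (G : Graph n) →
    ℤ.∣ det (krylov (adjMat (complement G))) ∣ ≡ ℤ.∣ det (krylov (adjMat G)) ∣
  abs-det-krylov-complement {zero} G = refl
  abs-det-krylov-complement {suc n} G = begin
    ℤ.∣ det (krylov Ā) ∣ ≡⟨ cong ℤ.∣_∣ (det-cong {M = krylov Ā} {T · krylov A} (λ c r → sym (expansion (toℕ c) (ℕₚ.≤-pred (toℕ<n c)) r))) ⟩
    ℤ.∣ det (T · krylov A) ∣ ≡⟨ cong ℤ.∣_∣ (det-· T (krylov A)) ⟩
    ℤ.∣ det T * det (krylov A) ∣ ≡⟨ ℤₚ.abs-* (det T) (det (krylov A)) ⟩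
    ℤ.∣ det T ∣ ℕ.* ℤ.∣ det (krylov A) ∣
      ≡⟨ cong (ℕ._* ℤ.∣ det (krylov A) ∣) (trans (cong ℤ.∣_∣ (det-lower-triangular T (λ r c r<c → coeff-support (toℕ r) c r<c)))
           (abs-product (λ i → T i i) (λ i → coeff-diagonal (toℕ i) i refl))) ⟩
    1 ℕ.* ℤ.∣ det (krylov A) ∣ ≡⟨ ℕₚ.*-identityˡ _ ⟩
    ℤ.∣ det (krylov A) ∣ ∎
    where
    A Ā : Mat (suc n) (suc n)
    A = adjMat G
    Ā = adjMat (complement G)
    -- As Ā = J - I - A, these are the coordinates of Ā^k e with respect to e, A e, A² e, ...
    coeff : ℕ → Vect (suc n)
    coeff zero = I zero
    coeff (suc k) c = walkCount Ā k * I zero c + - (coeff k c + shift (coeff k) c)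
    T : Mat (suc n) (suc n)
    T c = coeff (toℕ c)
    coeff-support : ∀ k c → k < toℕ c → coeff k c ≡ + 0
    coeff-support zero (suc c) _ = refl
    coeff-support (suc k) (suc c) (s≤s k<c) = trans
      (cong₂ (λ x y → walkCount Ā k * + 0 + - (x + y)) (coeff-support k (suc c) (ℕₚ.m≤n⇒m≤1+n k<c))
        (coeff-support k (inject₁ c) (subst (k <_) (sym (toℕ-inject₁ c)) k<c)))
      (cong (_+ + 0) (ℤₚ.*-zeroʳ (walkCount Ā k)))
    coeff-diagonal : ∀ k c → toℕ c ≡ k → ℤ.∣ coeff k c ∣ ≡ 1
    coeff-diagonal zero zero _ = refl
    coeff-diagonal (suc k) (suc c) eq = begin
      ℤ.∣ walkCount Ā k * + 0 + - (coeff k (suc c) + coeff k (inject₁ c)) ∣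
        ≡⟨ cong₂ (λ x y → ℤ.∣ x + - (y + coeff k (inject₁ c)) ∣) (ℤₚ.*-zeroʳ (walkCount Ā k)) (coeff-support k (suc c) (ℕₚ.≤-reflexive (sym eq))) ⟩
      ℤ.∣ + 0 + - (+ 0 + coeff k (inject₁ c)) ∣
        ≡⟨ cong ℤ.∣_∣ (zeros (coeff k (inject₁ c))) ⟩
      ℤ.∣ - coeff k (inject₁ c) ∣ ≡⟨ ℤₚ.∣-i∣≡∣i∣ (coeff k (inject₁ c)) ⟩
      ℤ.∣ coeff k (inject₁ c) ∣ ≡⟨ coeff-diagonal k (inject₁ c) (trans (toℕ-inject₁ c) (ℕₚ.suc-injective eq)) ⟩
      1 ∎
      where
      zeros : ∀ x → + 0 + - (+ 0 + x) ≡ - x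
      zeros = solve-∀
    applyĀ : ∀ v r → apply Ā v r ≡ sum v + - (v r + apply A v r)
    applyĀ v r = begin
      sum (λ j → Ā r j * v j)
        ≡⟨ sum-cong-≗ (λ j → trans (cong (_* v j) (adjMat-complement G r j)) (split (I r j) (A r j) (v j))) ⟩
      sum (λ j → v j + - (I r j * v j + A r j * v j))
        ≡⟨ trans (∑-distrib-+ v (λ j → - (I r j * v j + A r j * v j))) (cong (λ z → sum v + z) (sum-neg (λ j → I r j * v j + A r j * v j))) ⟩
      sum v + - sum (λ j → I r j * v j + A r j * v j)
        ≡⟨ cong (λ z → sum v + - z) (trans (∑-distrib-+ (λ j → I r j * v j) (λ j → A r j * v j))
             (cong (_+ apply A v r) ((I· (λ j (_ : Fin 1) → v j)) r zero))) ⟩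
      sum v + - (v r + apply A v r) ∎
      where
      split : ∀ i a v → (+ 1 + - i + - a) * v ≡ v + - (i * v + a * v)
      split = solve-∀
    expansion : ∀ k → k ≤ n → ∀ r → (coeff k ⊛ krylov A) r ≡ walk Ā k r
    expansion zero _ r = (I· krylov A) zero r
    expansion (suc k) k<n r = begin
      sum (λ c → (walkCount Ā k * I zero c + - (coeff k c + shift (coeff k) c)) * krylov A c r)
        ≡⟨ sum-cong-≗ (λ c → distribute (walkCount Ā k) (I zero c) (coeff k c) (shift (coeff k) c) (krylov A c r)) ⟩
      sum (λ c → walkCount Ā k * (I zero c * krylov A c r) + - + 1 * (coeff k c * krylov A c r + shift (coeff k) c * krylov A c r))
        ≡⟨ sum-lin (walkCount Ā k) (- + 1) (λ c → I zero c * krylov A c r) (λ c → coeff k c * krylov A c r + shift (coeff k) c * krylov A c r) ⟩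
      walkCount Ā k * (I · krylov A) zero r + - + 1 * sum (λ c → coeff k c * krylov A c r + shift (coeff k) c * krylov A c r)
        ≡⟨ cong₂ (λ x y → walkCount Ā k * x + - + 1 * y) ((I· krylov A) zero r)
             (trans (∑-distrib-+ (λ c → coeff k c * krylov A c r) (λ c → shift (coeff k) c * krylov A c r))
                    (cong₂ _+_ ih (trans (shift-krylov A (coeff k) last≡0 r) (apply-cong A (expansion k (ℕₚ.<⇒≤ k<n)) r)))) ⟩
      walkCount Ā k * + 1 + - + 1 * (walk Ā k r + apply A (walk Ā k) r)
        ≡⟨ cong₂ _+_ (ℤₚ.*-identityʳ (walkCount Ā k)) (ℤₚ.-1*i≡-i _) ⟩
      walkCount Ā k + - (walk Ā k r + apply A (walk Ā k) r) ≡⟨ sym (applyĀ (walk Ā k) r) ⟩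
      apply Ā (walk Ā k) r ∎
      where
      ih : (coeff k ⊛ krylov A) r ≡ walk Ā k r
      ih = expansion k (ℕₚ.<⇒≤ k<n) r
      last≡0 : coeff k (fromℕ n) ≡ + 0
      last≡0 = coeff-support k (fromℕ n) (subst (k <_) (sym (toℕ-fromℕ n)) k<n)
      distribute : ∀ s i b t m → (s * i + - (b + t)) * m ≡ s * (i * m) + - + 1 * (b * m + t * m)
      distribute = solve-∀

  abs-det-krylov-stepV : ∀ {n} (G : Graph n) →
    ℤ.∣ det (krylov (adjMat (stepV G))) ∣ ≡ ℤ.∣ det (adjMat G) ∣ ℕ.* ℤ.∣ det (krylov (adjMat G)) ∣
  abs-det-krylov-stepV G = begin
    ℤ.∣ det (krylov (adjMat (stepV G))) ∣ ≡⟨ abs-det-krylov-complement (unionV G) ⟩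
    ℤ.∣ det (krylov (adjMat (unionV G))) ∣ ≡⟨ cong ℤ.∣_∣ (det-krylov-unionV G) ⟩
    ℤ.∣ det (krylov (adjMat G)) * det (adjMat G) ∣ ≡⟨ ℤₚ.abs-* (det (krylov (adjMat G))) (det (adjMat G)) ⟩
    ℤ.∣ det (krylov (adjMat G)) ∣ ℕ.* ℤ.∣ det (adjMat G) ∣ ≡⟨ ℕₚ.*-comm ℤ.∣ det (krylov (adjMat G)) ∣ ℤ.∣ det (adjMat G) ∣ ⟩
    ℤ.∣ det (adjMat G) ∣ ℕ.* ℤ.∣ det (krylov (adjMat G)) ∣ ∎

  -- The vertex isolated in the union becomes pendant at the joined one. Its row and its column each
  -- have a single entry 1, and expanding along both removes the two vertices; the sign comes from
  -- one exchange of rows.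
  det-joinV-unionV : ∀ {n} (G : Graph n) → det (adjMat (joinV (unionV G))) ≡ - det (adjMat G)
  det-joinV-unionV {n} G = begin
    det M ≡⟨ det-cong {M = M} {M zero ∷ M (suc zero) ∷ rest}
                                                                      (λ { zero c → refl ; (suc zero) c → refl ; (suc (suc r)) c → refl }) ⟩
    det (M zero ∷ M (suc zero) ∷ rest) ≡⟨ swap-first detForm (M zero) (M (suc zero)) (rest) ⟩
    - det M′ ≡⟨ cong -_ (det-first-row M′ (λ { zero → refl ; (suc j) → refl })) ⟩
    - (+ 1 * det M″) ≡⟨ cong -_ (trans (ℤₚ.*-identityˡ _) (sym (det-transpose M″))) ⟩
    - det (M″ ᵀ) ≡⟨ cong -_ (det-first-row (M″ ᵀ) (λ j → refl)) ⟩
    - (+ 1 * det (adjMat G ᵀ)) ≡⟨ cong -_ (trans (ℤₚ.*-identityˡ _) (det-transpose (adjMat G))) ⟩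
    - det (adjMat G) ∎
    where
    M : Mat (suc (suc n)) (suc (suc n))
    M = adjMat (joinV (unionV G))
    rest : Mat n (suc (suc n))
    rest i = M (suc (suc i))
    M′ : Mat (suc (suc n)) (suc (suc n))
    M′ = M (suc zero) ∷ M zero ∷ rest
    M″ : Mat (suc n) (suc n)
    M″ = minor zero M′

  abs-det-stepV² : ∀ {n} (G : Graph n) → ℤ.∣ det (adjMat (stepV (stepV G))) ∣ ≡ ℤ.∣ det (adjMat G) ∣
  abs-det-stepV² G = begin
    ℤ.∣ det (adjMat (stepV (stepV G))) ∣ ≡⟨ cong ℤ.∣_∣ (det-cong {M = adjMat (stepV (stepV G))} {adjMat (joinV (unionV G))} (λ i j → cong b2z (eq i j))) ⟩
    ℤ.∣ det (adjMat (joinV (unionV G))) ∣ ≡⟨ cong ℤ.∣_∣ (det-joinV-unionV G) ⟩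
    ℤ.∣ - det (adjMat G) ∣ ≡⟨ ℤₚ.∣-i∣≡∣i∣ (det (adjMat G)) ⟩
    ℤ.∣ det (adjMat G) ∣ ∎
    where
    eq : stepV (stepV G) ≗ᴳ joinV (unionV G)
    eq i j = trans (complement-unionV (stepV G) i j) (joinV-cong {G = complement (stepV G)} {unionV G} (complement-involutive (unionV G)) i j)

  det-congruence : ∀ x {n} {M N : Mat n n} → (∀ i j → x ∣ M i j + - N i j) → x ∣ det M + - det N
  det-congruence x = DetRelation.det-related ℤOps ℤOps (λ a b → x ∣ a + - b) (λ _ a b → x ∣ a + - b)
    ∣0
    (λ {_} {a} {b} {p} {q} h h′ → ∣-resp (mul a b p q) (∣m∣n⇒∣m+n (∣n⇒∣m*n a h′) (∣n⇒∣m*n q h)))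
    (λ {_} {p} {q} {p′} {q′} h h′ → ∣-resp (add p q p′ q′) (∣m∣n⇒∣m+n h h′))
    (λ {_} {p} {q} h → ∣-resp (neg p q) (∣m⇒∣-m h))
    where
    mul : ∀ a b p q → a * (p + - q) + q * (a + - b) ≡ a * p + - (b * q)
    mul = solve-∀
    add : ∀ p q p′ q′ → (p + - q) + (p′ + - q′) ≡ (p + p′) + - (q + q′)
    add = solve-∀
    neg : ∀ p q → - (p + - q) ≡ - p + - (- q)
    neg = solve-∀

  -- Changing the signs below the diagonal gives a skew-symmetric matrix, of determinant 0 in odd order.
  det-adjMat-even : ∀ m (G : Graph (suc (m ℕ.+ m))) → + 2 ∣ det (adjMat G)
  det-adjMat-even m G = ∣m+n∣m⇒∣n (∣-resp (cancel (det S) (det (adjMat G))) (∣m⇒∣-m (det-congruence (+ 2) {M = S} {adjMat G} S≡A))) (∣-resp (sym det-S) ∣0)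
    where
    s : ∀ {n} → Mat n n
    s zero zero = + 0
    s zero (suc j) = + 1
    s (suc i) zero = - + 1
    s (suc i) (suc j) = s i j
    s-skew : ∀ {n} (i j : Fin n) → s j i ≡ - s i j
    s-skew zero zero = refl
    s-skew zero (suc j) = refl
    s-skew (suc i) zero = refl
    s-skew (suc i) (suc j) = s-skew i j
    s-odd : ∀ {n} (i j : Fin n) → i ≡ j ⊎ + 2 ∣ s i j + - + 1
    s-odd zero zero = inj₁ refl
    s-odd zero (suc j) = inj₂ ∣0
    s-odd (suc i) zero = inj₂ (divides (- + 1) refl)
    s-odd (suc i) (suc j) with s-odd i j
    ... | inj₁ eq = inj₁ (cong suc eq)
    ... | inj₂ h = inj₂ h
    S : Mat (suc (m ℕ.+ m)) (suc (m ℕ.+ m))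
    S i j = s i j * adjMat G i j
    S≡A : ∀ i j → + 2 ∣ S i j + - adjMat G i j
    S≡A i j with s-odd i j
    ... | inj₁ refl = ∣-resp (sym (trans (cong (λ z → s i i * z + - z) (adjMat-diag G i)) (cong (_+ + 0) (ℤₚ.*-zeroʳ (s i i))))) ∣0
    ... | inj₂ h = ∣-resp (factor (s i j) (adjMat G i j)) (∣m⇒∣m*n (adjMat G i j) h)
      where
      factor : ∀ s a → (s + - + 1) * a ≡ s * a + - a
      factor = solve-∀
    cancel : ∀ s a → - (s + - a) ≡ - s + a
    cancel = solve-∀
    sign : ∀ m → product {suc (m ℕ.+ m)} (λ _ → - + 1) ≡ - + 1
    sign zero = refl
    sign (suc m) = trans (cong (λ z → product {suc z} (λ _ → - + 1)) (cong suc (ℕₚ.+-suc m m)))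
      (trans (double (product {suc (m ℕ.+ m)} (λ _ → - + 1))) (sign m))
      where
      double : ∀ x → - + 1 * (- + 1 * x) ≡ x
      double = solve-∀
    det-S-skew : det S ≡ - det S
    det-S-skew = begin
      det S ≡⟨ sym (det-transpose S) ⟩
      det (S ᵀ) ≡⟨ det-cong {M = S ᵀ} {λ i j → - S i j} (λ i j → trans (cong₂ _*_ (s-skew i j) (adjMat-sym G j i)) (sym (ℤₚ.neg-distribˡ-* (s i j) (adjMat G i j)))) ⟩
      det (λ i j → - S i j) ≡⟨ det-neg S ⟩
      product {suc (m ℕ.+ m)} (λ _ → - + 1) * det S ≡⟨ cong (_* det S) (sign m) ⟩
      - + 1 * det S ≡⟨ ℤₚ.-1*i≡-i (det S) ⟩
      - det S ∎
    det-S : - det S ≡ + 0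
    det-S = trans (sym det-S-skew) (self-negative (det S) det-S-skew)
      where
      self-negative : ∀ x → x ≡ - x → x ≡ + 0
      self-negative (+ zero) _ = refl
      self-negative (+ suc x) ()
      self-negative -[1+ x ] ()

  walkVec≡walk : ∀ {n} (G : Graph n) k i → walkVec G k i ≡ walk (adjMat G) k i
  walkVec≡walk G zero i = refl
  walkVec≡walk G (suc k) i = trans (sumFin≡sum (λ j → adjMat G i j * walkVec G k j)) (sum-cong-≗ (λ j → cong (adjMat G i j *_) (walkVec≡walk G k j)))
    where
    sumFin≡sum : ∀ {n} (f : Vect n) → sumFin f ≡ sum f
    sumFin≡sum {zero} f = refl
    sumFin≡sum {suc n} f = cong (λ z → f zero + z) (sumFin≡sum (f ∘ suc))

  det-walkMat : ∀ {n} (G : Graph n) → detℤ (walkMat G) ≡ det (krylov (adjMat G))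
  det-walkMat G = trans (det-cong {M = walkMat G} {krylov (adjMat G) ᵀ} (λ r c → walkVec≡walk G (toℕ c) r)) (det-transpose (krylov (adjMat G)))

  -- The determinant which the parity of the order δ + 2m forces on the alternating sequence 1, 2, 1, 2, ...
  expected : ℕ → ℕ
  expected zero = 1
  expected (suc _) = 2

  -- The invariant of the sequence: c stays fixed while δ alternates. Two consecutive adjacency
  -- determinants are recorded, because |det A| is reproduced only after two steps.
  record Stage {n} (c : ℕ) (G : Graph n) : Set where
    field
      δ m : ℕ
      δ≤1 : δ ≤ 1
      order : n ≡ δ ℕ.+ (m ℕ.+ m)
      walk-det : ℤ.∣ det (krylov (adjMat G)) ∣ ≡ 2 ℕ.^ m ℕ.* c
      adj-det : ℤ.∣ det (adjMat G) ∣ ≡ expected δ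
      next-adj-det : ℤ.∣ det (adjMat (stepV G)) ∣ ≡ expected (1 ∸ δ)

  stage-step : ∀ {n c} (G : Graph n) → Stage c G → Stage c (stepV G)
  stage-step {n} {c} G st = go δ δ≤1 order adj-det next-adj-det
    where
    open Stage st
    go : ∀ δ → δ ≤ 1 → n ≡ δ ℕ.+ (m ℕ.+ m) → ℤ.∣ det (adjMat G) ∣ ≡ expected δ → ℤ.∣ det (adjMat (stepV G)) ∣ ≡ expected (1 ∸ δ) → Stage c (stepV G)
    go zero _ order a≡ a′≡ = record
      { δ = 1 ; m = m ; δ≤1 = s≤s z≤n ; order = cong suc order
      ; walk-det = trans (abs-det-krylov-stepV G) (trans (cong₂ ℕ._*_ a≡ walk-det) (ℕₚ.*-identityˡ _))
      ; adj-det = a′≡ ; next-adj-det = trans (abs-det-stepV² G) a≡ }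
    go (suc zero) _ order a≡ a′≡ = record
      { δ = 0 ; m = suc m ; δ≤1 = z≤n ; order = trans (cong suc order) (cong suc (sym (ℕₚ.+-suc m m)))
      ; walk-det = trans (abs-det-krylov-stepV G) (trans (cong₂ ℕ._*_ a≡ walk-det) (sym (ℕₚ.*-assoc 2 (2 ℕ.^ m) c)))
      ; adj-det = a′≡ ; next-adj-det = trans (abs-det-stepV² G) a≡ }
    go (suc (suc _)) (s≤s ()) _ _ _

  stages : ∀ {n c} (G : Graph n) → Stage c G → ∀ i → Stage c (iterateStep G i)
  stages G st zero = st
  stages G st (suc i) = stage-step (iterateStep G i) (stages G st i)

  stage⇒criterion : ∀ {n c} (G : Graph n) → Odd c → SquareFree c → Stage c G → Criterion (adjMat G)
  stage⇒criterion {n} {c} G c-odd c-sf st = record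
    { δ = δ ; m = m ; c = proj₁ signed ; δ≤1 = δ≤1 ; order = order ; det≡ = proj₂ (proj₂ signed)
    ; odd = λ h → 0≢1 (trans (sym (ℕᵈ.n∣m⇒m%n≡0 c 2 (subst (2 ℕᵈ.∣_) (proj₁ (proj₂ signed)) (∣⇒∣ᵤ h)))) c-odd)
    ; square-free = λ d h → c-sf d (subst₂ ℕᵈ._∣_ (ℤₚ.abs-* (+ d) (+ d)) (proj₁ (proj₂ signed)) (∣⇒∣ᵤ h)) }
    where
    open Stage st
    0≢1 : 0 ≢ 1
    0≢1 ()
    pos-^ : ∀ k → + (2 ℕ.^ k) ≡ (+ 2) ^ k
    pos-^ zero = refl
    pos-^ (suc k) = trans (ℤₚ.pos-* 2 (2 ℕ.^ k)) (cong (+ 2 *_) (pos-^ k))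
    abs≡ : ∀ x {a} → ℤ.∣ x ∣ ≡ a → x ≡ + a ⊎ x ≡ - + a
    abs≡ (+ x) refl = inj₁ refl
    abs≡ -[1+ x ] refl = inj₂ refl
    magnitude : + (2 ℕ.^ m ℕ.* c) ≡ (+ 2) ^ m * + c
    magnitude = trans (ℤₚ.pos-* (2 ℕ.^ m) c) (cong (_* + c) (pos-^ m))
    -- The hypothesis concerns the absolute value only; the sign of the determinant is put into c′.
    signed : Σ ℤ λ c′ → ℤ.∣ c′ ∣ ≡ c × det (krylov (adjMat G)) ≡ (+ 2) ^ m * c′
    signed with abs≡ (det (krylov (adjMat G))) walk-det
    ... | inj₁ eq = + c , refl , trans eq magnitude
    ... | inj₂ eq = - + c , ℤₚ.∣-i∣≡∣i∣ (+ c) , trans eq (trans (cong -_ magnitude) (ℤₚ.neg-distribʳ-* ((+ 2) ^ m) (+ c)))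

  initial-stage : ∀ {n c} (G : Graph n) →
    (ℤ.∣ det (adjMat G) ∣ ≡ 1 × ℤ.∣ det (adjMat (stepV G)) ∣ ≡ 2) ⊎ (ℤ.∣ det (adjMat G) ∣ ≡ 2 × ℤ.∣ det (adjMat (stepV G)) ∣ ≡ 1) →
    ℤ.∣ det (krylov (adjMat G)) ∣ ≡ c ℕ.* 2 ℕ.^ (n ℕ./ 2) → Stage c G
  initial-stage {n} {c} G ap b≡ = go (half n) ap
    where
    halves : ∀ δ m → δ < 2 → (δ ℕ.+ (m ℕ.+ m)) ℕ./ 2 ≡ m
    halves δ m δ<2 = begin
      (δ ℕ.+ (m ℕ.+ m)) ℕ./ 2 ≡⟨ cong (λ z → (δ ℕ.+ z) ℕ./ 2) (trans (cong (m ℕ.+_) (sym (ℕₚ.+-identityʳ m))) (ℕₚ.*-comm 2 m)) ⟩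
      (δ ℕ.+ m ℕ.* 2) ℕ./ 2 ≡⟨ ℕᵐ.+-distrib-/-∣ʳ δ (ℕᵈ.divides m refl) ⟩
      δ ℕ./ 2 ℕ.+ m ℕ.* 2 ℕ./ 2 ≡⟨ cong₂ ℕ._+_ (ℕᵐ.m<n⇒m/n≡0 δ<2) (ℕᵐ.m*n/n≡m m 2) ⟩
      m ∎
    walk-det : ∀ δ m → δ < 2 → n ≡ δ ℕ.+ (m ℕ.+ m) → ℤ.∣ det (krylov (adjMat G)) ∣ ≡ 2 ℕ.^ m ℕ.* c
    walk-det δ m δ<2 eq = trans b≡ (trans (cong (λ z → c ℕ.* 2 ℕ.^ z) (trans (cong (ℕ._/ 2) eq) (halves δ m δ<2))) (ℕₚ.*-comm c (2 ℕ.^ m)))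
    odd-order : ∀ {k} (H : Graph k) m → k ≡ suc (m ℕ.+ m) → ℤ.∣ det (adjMat H) ∣ ≢ 1
    odd-order H m refl eq = 2∤1 (subst (2 ℕᵈ.∣_) eq (∣⇒∣ᵤ (det-adjMat-even m H)))
      where
      2∤1 : ¬ 2 ℕᵈ.∣ 1
      2∤1 h with ℕᵈ.∣1⇒≡1 h
      ... | ()
    go : (Σ ℕ λ m → (n ≡ m ℕ.+ m) ⊎ (n ≡ suc (m ℕ.+ m))) →
      (ℤ.∣ det (adjMat G) ∣ ≡ 1 × ℤ.∣ det (adjMat (stepV G)) ∣ ≡ 2) ⊎ (ℤ.∣ det (adjMat G) ∣ ≡ 2 × ℤ.∣ det (adjMat (stepV G)) ∣ ≡ 1) → Stage c G
    go (m , inj₁ eq) (inj₁ (a , p)) = record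
      { δ = 0 ; m = m ; δ≤1 = z≤n ; order = eq ; walk-det = walk-det 0 m (s≤s z≤n) eq ; adj-det = a ; next-adj-det = p }
    go (m , inj₂ eq) (inj₂ (a , p)) = record
      { δ = 1 ; m = m ; δ≤1 = s≤s z≤n ; order = eq ; walk-det = walk-det 1 m (s≤s (s≤s z≤n)) eq ; adj-det = a ; next-adj-det = p }
    -- The parity of the order decides which of the two determinants is 2: the value 1 would be an
    -- odd adjacency determinant at odd order, here for the next graph and in the last case for `G`
    -- itself.
    go (m , inj₁ eq) (inj₂ (a , p)) = ⊥-elim (odd-order (stepV G) m (cong suc eq) p)
    go (m , inj₂ eq) (inj₁ (a , p)) = ⊥-elim (odd-order G m eq a)

open GeneralizedSpectrum using (Gseq-DGS; criterion⇒DGS; iterateStep; stage⇒criterion; stages; initial-stage; det-walkMat)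
open import Data.Nat using (_*_; _^_; _/_)
open import Data.Integer using (∣_∣)

theorem3p4 : (n₀ : ℕ) (G₀ : Graph n₀) →
    let a = ∣ detℤ (adjMat G₀) ∣
        b = ∣ detℤ (walkMat G₀) ∣
        p = ∣ detℤ (adjMat (complement (Gseq G₀ 1))) ∣
    in ((a ≡ 1 × p ≡ 2) ⊎ (a ≡ 2 × p ≡ 1)) →
       (Σ ℕ λ c → (b ≡ c * 2 ^ (n₀ / 2)) × Odd c × SquareFree c) →
       ∀ i → DGS (Gseq G₀ (suc i))
theorem3p4 n₀ G₀ ap (c , b≡ , c-odd , c-sf) i = Gseq-DGS G₀ (suc i) (criterion⇒DGS K
  (stage⇒criterion K c-odd c-sf (stages G₀ (initial-stage G₀ ap walk-det) (suc i))))
  where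
  K : Graph (suc i ℕ.+ n₀)
  K = iterateStep G₀ (suc i)
  walk-det : _ ≡ c * 2 ^ (n₀ / 2)
  walk-det = ≡.trans (≡.cong ∣_∣ (≡.sym (det-walkMat G₀))) b≡
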